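{- Let $\mathsf M_1,\mathsf M_2$ be matroids on finite sets $S_1,S_2$ with $S_1\cap S_2=\{i\}$, where $\{i\}$ is a flat of $\mathsf M_1$ and $i$ is not a loop of $\mathsf M_2$, and let $\Bbbk$ be a field. Let $\mathsf P=\mathsf M_1\oplus_{\{i\}}\mathsf M_2$ be their parallel connection and $\phi\colon S_1\sqcup S_2'\to S_1\cup S_2$ the identification map. Then there is a short exact sequence of graded $\Bbbk$-vector spaces $$0\to A(\mathsf P)[-1]\to A(\mathsf M_1\oplus\mathsf M_2)\xrightarrow{A(\phi)}A(\mathsf P)\to0,$$ and an isomorphism of graded $\Bbbk$-algebras $\overline A(\mathsf M_1)\otimes_\Bbbk\overline A(\mathsf M_2)\cong\overline A(\mathsf P)$.
   Context: The parallel connection $\mathsf P$ (with basepoint $i$) is the matroid on $S_1\cup S_2$ whose circuits are the circuits of $\mathsf M_1$, the circuits of $\mathsf M_2$, and the sets $(C_1\setminus\{i\})\cup(C_2\setminus\{i\})$ where $C_j$ is a circuit of $\mathsf M_j$ containing $i$. The direct sum $\mathsf M_1\oplus\mathsf M_2$ is taken on $S_1\sqcup S_2'$, where $S_2'$ is a disjoint copy of $S_2$ (the copy of $i$ denoted $i'$); $\phi$ is the identity on $S_1$ and sends each element of $S_2'$ to the corresponding element of $S_2$ (so $\phi(i')=i$). For a matroid $\mathsf N$ on $S$: $V(\mathsf N)=\Bbbk^S$ with basis $\{e_s\}$, $E=\Lambda(V(\mathsf N))$, $\partial$ the graded derivation with $\partial(e_s)=1$, $e_C=\prod_{s\in C}e_s$;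 $A(\mathsf N)=E/I$ with $I$ generated by $\partial(e_C)$ over circuits $C$; $\overline A(\mathsf N)$ is the subalgebra generated by $\overline V(\mathsf N)=\{v:\sum_s v_s=0\}$. $A(\phi)$ is the algebra homomorphism induced by $e_s\mapsto e_{\phi(s)}$. For a graded space $B$, $B[-1]$ has degree-$p$ part $B^{p-1}$. -}

module Defs where

open import Level using (Level; _⊔_; 0ℓ) renaming (suc to lsuc)
open import Data.Nat using (ℕ; zero; suc) renaming (_*_ to _*ℕ_; _+_ to _+ℕ_)
open import Data.Bool using (Bool; true; false; if_then_else_)
open import Data.Fin using (Fin; zero; suc; _↑ˡ_; _↑ʳ_; splitAt)
open import Data.Fin.Subset using (Subset; ⁅_⁆; _∈_; _∉_; _⊆_; _∪_; _-_; ∣_∣; ⊥)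
open import Data.Vec using (Vec; []; _∷_)
open import Data.Vec.Properties using (≡-dec)
open import Data.List using (List; []; _∷_; map; foldr; _++_; allFin; [_])
open import Data.Product using (Σ; ∃; ∃-syntax; _×_; _,_)
open import Data.Sum using (_⊎_; [_,_]′)
open import Relation.Nullary using (¬_; does)
open import Relation.Binary.PropositionalEquality using (_≡_; _≢_)
open import Algebra.Bundles using (CommutativeRing)
open import Function.Bundles using (_⇔_)
import Data.Bool as B

record Field (c ℓ : Level) : Set (lsuc (c ⊔ ℓ)) where
  field
    commutativeRing : CommutativeRing c ℓ
  open CommutativeRing commutativeRing public
  field
    0≉1 : ¬ (0# ≈ 1#)
    inverse : ∀ x → ¬ (x ≈ 0#) → ∃[ y ] (x * y ≈ 1#)

record Matroid (n : ℕ) : Set₁ where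
  field
    IsCircuit : Subset n → Set
    circuit-nonempty : ¬ IsCircuit ⊥
    circuit-minimal : ∀ {C D} → IsCircuit C → IsCircuit D → C ⊆ D → C ≡ D
    circuit-elim : ∀ {C D e} → IsCircuit C → IsCircuit D → C ≢ D →
                   e ∈ C → e ∈ D → ∃[ F ] (IsCircuit F × F ⊆ ((C ∪ D) - e))

open Matroid public

Loop : ∀ {n} → Matroid n → Fin n → Set
Loop M s = IsCircuit M ⁅ s ⁆

-- X is a flat: closed under the closure operator
-- (e ∈ cl X iff e ∈ X or e ∈ C ⊆ X ∪ {e} for some circuit C).
Flat : ∀ {n} → Matroid n → Subset n → Set
Flat M X = ∀ C e → IsCircuit M C → e ∈ C → (C - e) ⊆ X → e ∈ X

IsImage : ∀ {a b} → (Fin a → Fin b) → Subset a → Subset b → Set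
IsImage f A B = ∀ y → (y ∈ B) ⇔ (∃[ x ] (x ∈ A × f x ≡ y))

-- Ground sets.  S₁ = Fin (suc m), S₂ = Fin (suc n), the common element i
-- is `zero` in both.  S₁ ∪ S₂ = Fin (suc m +ℕ n) (S₁ first, then S₂ ∖ {i});
-- S₁ ⊔ S₂' = Fin (suc m +ℕ suc n).

ι₁ : ∀ m n → Fin (suc m) → Fin (suc m +ℕ n)
ι₁ m n x = x ↑ˡ n

ι₂ : ∀ m n → Fin (suc n) → Fin (suc m +ℕ n)
ι₂ m n zero = zero
ι₂ m n (suc k) = suc m ↑ʳ k

φ : ∀ m n → Fin (suc m +ℕ suc n) → Fin (suc m +ℕ n)
φ m n x = [ ι₁ m n , ι₂ m n ]′ (splitAt (suc m) x)

DirectSumCircuit : ∀ {m n} → Matroid (suc m) → Matroid (suc n) →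
                   Subset (suc m +ℕ suc n) → Set
DirectSumCircuit {m} {n} M₁ M₂ C =
  (∃[ C₁ ] (IsCircuit M₁ C₁ × IsImage (_↑ˡ suc n) C₁ C)) ⊎
  (∃[ C₂ ] (IsCircuit M₂ C₂ × IsImage (suc m ↑ʳ_) C₂ C))

ParallelCircuit : ∀ {m n} → Matroid (suc m) → Matroid (suc n) →
                  Subset (suc m +ℕ n) → Set
ParallelCircuit {m} {n} M₁ M₂ C =
  (∃[ C₁ ] (IsCircuit M₁ C₁ × IsImage (ι₁ m n) C₁ C)) ⊎
  (∃[ C₂ ] (IsCircuit M₂ C₂ × IsImage (ι₂ m n) C₂ C)) ⊎
  (∃[ C₁ ] ∃[ C₂ ] (IsCircuit M₁ C₁ × IsCircuit M₂ C₂ × zero ∈ C₁ × zero ∈ C₂ ×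
     (∀ y → (y ∈ C) ⇔ ((∃[ x ] (x ∈ (C₁ - zero) × ι₁ m n x ≡ y)) ⊎
                       (∃[ x ] (x ∈ (C₂ - zero) × ι₂ m n x ≡ y))))))

allSub : (n : ℕ) → List (Subset n)
allSub zero = [ [] ]
allSub (suc n) = map (false ∷_) (allSub n) ++ map (true ∷_) (allSub n)

elems : ∀ {n} → Subset n → List (Fin n)
elems {zero} [] = []
elems {suc n} (false ∷ p) = map suc (elems p)
elems {suc n} (true ∷ p) = zero ∷ map suc (elems p)

disjointᵇ : ∀ {n} → Subset n → Subset n → Bool
disjointᵇ [] [] = true
disjointᵇ (x ∷ A) (y ∷ B) = B.not (x B.∧ y) B.∧ disjointᵇ A B

inversions : ∀ {n} → Subset n → Subset n → ℕ
inversions [] [] = 0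
inversions (x ∷ A) (y ∷ B) = (if y then ∣ A ∣ else 0) +ℕ inversions A B

module OS {c ℓ} (K : Field c ℓ) where
  open Field K renaming (Carrier to 𝕜)

  -- an element of E(S) is its coefficient vector in the basis {e_A}
  E : ℕ → Set c
  E n = Subset n → 𝕜

  _≈E_ : ∀ {n} → E n → E n → Set ℓ
  x ≈E y = ∀ A → x A ≈ y A

  0E : ∀ {n} → E n
  0E _ = 0#

  _+E_ : ∀ {n} → E n → E n → E n
  (x +E y) A = x A + y A

  -E_ : ∀ {n} → E n → E n
  (-E x) A = - (x A)

  _•_ : ∀ {n} → 𝕜 → E n → E n
  (a • x) A = a * x A

  sumE : ∀ {n} → List (E n) → E n
  sumE = foldr _+E_ 0E

  basis : ∀ {n} → Subset n → E n
  basis A B = if does (≡-dec B._≟_ A B) then 1# else 0#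

  sign : ℕ → 𝕜
  sign zero = 1#
  sign (suc k) = - sign k

  mulBasis : ∀ {n} → Subset n → Subset n → E n
  mulBasis A B = if disjointᵇ A B then sign (inversions A B) • basis (A ∪ B) else 0E

  _*E_ : ∀ {n} → E n → E n → E n
  _*E_ {n} x y = sumE (map (λ A → sumE (map (λ B → (x A * y B) • mulBasis A B) (allSub n))) (allSub n))

  1E : ∀ {n} → E n
  1E = basis ⊥

  gen : ∀ {n} → Fin n → E n
  gen s = basis ⁅ s ⁆

  prodE : ∀ {n} → List (E n) → E n
  prodE = foldr _*E_ 1E

  eSet : ∀ {n} → Subset n → E n
  eSet C = prodE (map gen (elems C))

  -- the graded derivation ∂ with ∂ e_s = 1, on products of generators:
  -- ∂(e_s w) = w - e_s ∂ w
  ∂L : ∀ {n} → List (Fin n) → E n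
  ∂L [] = 0E
  ∂L (s ∷ ss) = prodE (map gen ss) +E (-E (gen s *E ∂L ss))

  ∂ : ∀ {n} → E n → E n
  ∂ {n} x = sumE (map (λ A → x A • ∂L (elems A)) (allSub n))

  Homog : ∀ {n} → ℕ → E n → Set ℓ
  Homog p x = ∀ A → ¬ (∣ A ∣ ≡ p) → x A ≈ 0#

  data InI {n} (Circ : Subset n → Set) : E n → Set (c ⊔ ℓ) where
    gen∈ : ∀ {C} → Circ C → InI Circ (∂ (eSet C))
    0∈ : InI Circ 0E
    +∈ : ∀ {x y} → InI Circ x → InI Circ y → InI Circ (x +E y)
    *∈ˡ : ∀ {x} (a : E n) → InI Circ x → InI Circ (a *E x)
    *∈ʳ : ∀ {x} → InI Circ x → (a : E n) → InI Circ (x *E a)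
    ≈∈ : ∀ {x y} → x ≈E y → InI Circ x → InI Circ y

  _≈A[_]_ : ∀ {n} → E n → (Subset n → Set) → E n → Set (c ⊔ ℓ)
  x ≈A[ Circ ] y = InI Circ (x +E (-E y))

  sumK : List 𝕜 → 𝕜
  sumK = foldr _+_ 0#

  data InĀ {n} (Circ : Subset n → Set) : E n → Set (c ⊔ ℓ) where
    one∈ : InĀ Circ 1E
    v̄∈ : (v : Fin n → 𝕜) → sumK (map v (allFin n)) ≈ 0# →
         InĀ Circ (sumE (map (λ s → v s • gen s) (allFin n)))
    +∈ : ∀ {x y} → InĀ Circ x → InĀ Circ y → InĀ Circ (x +E y)
    •∈ : ∀ {x} (a : 𝕜) → InĀ Circ x → InĀ Circ (a • x)
    *∈ : ∀ {x y} → InĀ Circ x → InĀ Circ y → InĀ Circ (x *E y)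
    ≈∈ : ∀ {x y} → x ≈A[ Circ ] y → InĀ Circ x → InĀ Circ y

  Emap : ∀ {a b} → (Fin a → Fin b) → E a → E b
  Emap {a} g x = sumE (map (λ A → x A • prodE (map (λ s → gen (g s)) (elems A))) (allSub a))

  -- Graded tensor product E(a) ⊗ E(b), basis e_A ⊗ e_B, with the Koszul
  -- sign rule (x ⊗ y)(x' ⊗ y') = (-1)^{|y||x'|} x x' ⊗ y y'.

  T : ℕ → ℕ → Set c
  T a b = Subset a → Subset b → 𝕜

  _≈T_ : ∀ {a b} → T a b → T a b → Set ℓ
  t ≈T u = ∀ A B → t A B ≈ u A B

  _⊗_ : ∀ {a b} → E a → E b → T a b
  (x ⊗ y) A B = x A * y B

  0T : ∀ {a b} → T a b
  0T _ _ = 0#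

  _+T_ : ∀ {a b} → T a b → T a b → T a b
  (t +T u) A B = t A B + u A B

  -T_ : ∀ {a b} → T a b → T a b
  (-T t) A B = - (t A B)

  _•T_ : ∀ {a b} → 𝕜 → T a b → T a b
  (k •T t) A B = k * t A B

  sumT : ∀ {a b} → List (T a b) → T a b
  sumT = foldr _+T_ 0T

  1T : ∀ {a b} → T a b
  1T = 1E ⊗ 1E

  _*T_ : ∀ {a b} → T a b → T a b → T a b
  _*T_ {a} {b} t u =
    sumT (map (λ A → sumT (map (λ B → sumT (map (λ C → sumT (map (λ D →
      (t A B * u C D * sign (∣ B ∣ *ℕ ∣ C ∣)) •T (mulBasis A C ⊗ mulBasis B D))
      (allSub b))) (allSub a))) (allSub b))) (allSub a))

  HomogT : ∀ {a b} → ℕ → T a b → Set ℓ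
  HomogT p t = ∀ A B → ¬ (∣ A ∣ +ℕ ∣ B ∣ ≡ p) → t A B ≈ 0#

  -- A(M₁) ⊗ A(M₂) = (E₁ ⊗ E₂) / (I₁ ⊗ E₂ + E₁ ⊗ I₂)
  data InJ {a b} (Circ₁ : Subset a → Set) (Circ₂ : Subset b → Set) : T a b → Set (c ⊔ ℓ) where
    left : ∀ {x} → InI Circ₁ x → (y : E b) → InJ Circ₁ Circ₂ (x ⊗ y)
    right : ∀ {y} (x : E a) → InI Circ₂ y → InJ Circ₁ Circ₂ (x ⊗ y)
    0∈ : InJ Circ₁ Circ₂ 0T
    +∈ : ∀ {t u} → InJ Circ₁ Circ₂ t → InJ Circ₁ Circ₂ u → InJ Circ₁ Circ₂ (t +T u)
    ≈∈ : ∀ {t u} → t ≈T u → InJ Circ₁ Circ₂ t → InJ Circ₁ Circ₂ u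

  _≈⊗[_,_]_ : ∀ {a b} → T a b → (Subset a → Set) → (Subset b → Set) → T a b → Set (c ⊔ ℓ)
  t ≈⊗[ Circ₁ , Circ₂ ] u = InJ Circ₁ Circ₂ (t +T (-T u))

  data InĀ⊗Ā {a b} (Circ₁ : Subset a → Set) (Circ₂ : Subset b → Set) : T a b → Set (c ⊔ ℓ) where
    pure : ∀ {x y} → InĀ Circ₁ x → InĀ Circ₂ y → InĀ⊗Ā Circ₁ Circ₂ (x ⊗ y)
    0∈ : InĀ⊗Ā Circ₁ Circ₂ 0T
    +∈ : ∀ {t u} → InĀ⊗Ā Circ₁ Circ₂ t → InĀ⊗Ā Circ₁ Circ₂ u → InĀ⊗Ā Circ₁ Circ₂ (t +T u)
    ≈∈ : ∀ {t u} → t ≈⊗[ Circ₁ , Circ₂ ] u → InĀ⊗Ā Circ₁ Circ₂ t → InĀ⊗Ā Circ₁ Circ₂ u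

  record ShortExact {a b} (CircD : Subset a → Set) (CircP : Subset b → Set)
                    (g : Fin a → Fin b) (f : E b → E a) : Set (c ⊔ ℓ) where
    field
      -- f : A(P)[-1] → A(D) is a well-defined graded linear map of degree 0
      -- (i.e. A(P)^{p} → A(D)^{p+1})
      f-wd : ∀ x y → x ≈A[ CircP ] y → f x ≈A[ CircD ] f y
      f-+ : ∀ x y → f (x +E y) ≈A[ CircD ] (f x +E f y)
      f-• : ∀ k x → f (k • x) ≈A[ CircD ] (k • f x)
      f-deg : ∀ p x → Homog p x → ∃[ y ] (Homog (suc p) y × f x ≈A[ CircD ] y)
      g-wd : ∀ x y → x ≈A[ CircD ] y → Emap g x ≈A[ CircP ] Emap g y
      g-+ : ∀ x y → Emap g (x +E y) ≈A[ CircP ] (Emap g x +E Emap g y)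
      g-• : ∀ k x → Emap g (k • x) ≈A[ CircP ] (k • Emap g x)
      g-deg : ∀ p x → Homog p x → ∃[ y ] (Homog p y × Emap g x ≈A[ CircP ] y)
      f-injective : ∀ x → f x ≈A[ CircD ] 0E → x ≈A[ CircP ] 0E
      exact-middle : ∀ y → (Emap g y ≈A[ CircP ] 0E) ⇔ (∃[ x ] (f x ≈A[ CircD ] y))
      g-surjective : ∀ z → ∃[ y ] (Emap g y ≈A[ CircP ] z)

  record GradedAlgIso {a b n} (Circ₁ : Subset a → Set) (Circ₂ : Subset b → Set)
                      (Circ : Subset n → Set) (ψ : T a b → E n) : Set (c ⊔ ℓ) where
    field
      into : ∀ t → InĀ⊗Ā Circ₁ Circ₂ t → InĀ Circ (ψ t)
      wd : ∀ t u → InĀ⊗Ā Circ₁ Circ₂ t → InĀ⊗Ā Circ₁ Circ₂ u →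
           t ≈⊗[ Circ₁ , Circ₂ ] u → ψ t ≈A[ Circ ] ψ u
      ψ-+ : ∀ t u → InĀ⊗Ā Circ₁ Circ₂ t → InĀ⊗Ā Circ₁ Circ₂ u →
            ψ (t +T u) ≈A[ Circ ] (ψ t +E ψ u)
      ψ-• : ∀ k t → InĀ⊗Ā Circ₁ Circ₂ t → ψ (k •T t) ≈A[ Circ ] (k • ψ t)
      ψ-* : ∀ t u → InĀ⊗Ā Circ₁ Circ₂ t → InĀ⊗Ā Circ₁ Circ₂ u →
            ψ (t *T u) ≈A[ Circ ] (ψ t *E ψ u)
      ψ-1 : ψ 1T ≈A[ Circ ] 1E
      ψ-deg : ∀ p t → InĀ⊗Ā Circ₁ Circ₂ t → HomogT p t →
              ∃[ y ] (Homog p y × ψ t ≈A[ Circ ] y)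
      injective : ∀ t u → InĀ⊗Ā Circ₁ Circ₂ t → InĀ⊗Ā Circ₁ Circ₂ u →
                  ψ t ≈A[ Circ ] ψ u → t ≈⊗[ Circ₁ , Circ₂ ] u
      surjective : ∀ z → InĀ Circ z → ∃[ t ] (InĀ⊗Ā Circ₁ Circ₂ t × ψ t ≈A[ Circ ] z)

{-# OPTIONS --safe #-}

-- Write D for the direct sum and let w = e_i - e_i'.  The ideal of P is exactly the image under φ of the
-- ideal of D: the glued circuits contribute nothing new, by the computation at gluing-element.  Hence
-- A(P) = A(D)/(w).  The derivation ∂₁ of A(D) that is ∂ on A(M₁) and 0 on A(M₂) satisfies ∂₁ w = 1, so it
-- contracts multiplication by w, and the sequence is exact with first map x ↦ w σ(x) for a section σ of φ.
-- For the isomorphism, φ restricted to Ā(M₁) ⊗ Ā(M₂) is injective because ∂₁ kills this subalgebra: an element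
-- w u killed by ∂₁ satisfies u = w ∂₁ u, whence w u = 0.  It is surjective because V̄(P) is the sum of the
-- images of V̄(M₁) and V̄(M₂).
module Submission where

open import Defs
open import Level using (_⊔_)
open import Data.Nat using (ℕ; zero; suc) renaming (_+_ to _+ℕ_; _*_ to _*ℕ_)
import Data.Nat.Properties as ℕₚ
open import Data.Bool using (true; false)
open import Data.Empty using (⊥-elim)
open import Data.Fin using (Fin; zero; suc; _↑ˡ_; _↑ʳ_; splitAt; join)
open import Data.Fin.Properties using (splitAt-↑ˡ; splitAt-↑ʳ; join-splitAt)
open import Data.Fin.Subset using (Subset; ⁅_⁆; ∣_∣; ⊥; _∈_) renaming (_-_ to _∖_)
open import Data.Fin.Subset.Properties using (⊆-antisym; ∉⊥; drop-there; p─⊥≡p)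
open import Data.List using (List; []; _∷_; map; _++_; allFin)
open import Data.List.Properties using (map-∘; map-++; map-tabulate)
open import Data.Maybe using (Maybe; just; nothing)
open import Data.Product using (∃-syntax; _×_; _,_; proj₁; proj₂)
open import Data.Sum using (_⊎_; inj₁; inj₂; [_,_]′)
import Data.Vec as Vec
open import Data.Vec using ([]; _∷_; here; there)
open import Function using (_∘_; id)
open import Function.Bundles using (_⇔_; mk⇔; Equivalence)
open import Relation.Nullary using (¬_; yes; no)
open import Relation.Binary.Bundles using (Setoid)
import Relation.Binary.PropositionalEquality as ≡
open ≡ using (_≡_)
import Relation.Binary.Reasoning.Setoid as SetoidReasoning
open import Algebra.Bundles using (CommutativeRing; RawRing)
open import Algebra.Solver.Ring.AlmostCommutativeRing using (fromCommutativeRing; _-Raw-AlmostCommutative⟶_)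
import Algebra.Solver.Ring
import Algebra.Properties.Ring
import Algebra.Properties.Semiring.Mult.TCOptimised
import Algebra.Properties.CommutativeSemigroup
open Equivalence using (to; from)

-- All computation takes place in full exterior algebras; equality in a quotient means that a
-- difference lies in the inductively generated ideal. The product and `∂` of the statement are sums
-- over all subsets with inversion signs. They are identified once with operations recursive in the
-- first generator, after which identities become inductions on the ground set. The section σ need
-- not respect the ideals: it sends a relation of M₂ through i to one mixing the two summands. But x
-- ↦ w σ(x) does, because w² = 0 makes w σ(φ z) equal to w z, so a relation of P may be replaced by
-- any lift of it in the ideal of D. A glued circuit C has such a lift because the ideal of D is
-- stable under ∂: e_C is the image of an element of that ideal, so ∂ e_C is the image of its
-- derivative. A circuit of D lies in one summand, where ∂₁ acts as ∂ or 0, so ∂₁ descends to A(D).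
-- Injectivity on Ā(M₁) ⊗ Ā(M₂) also requires the ideal of D to be no larger than that of the graded
-- tensor product A(M₁) ⊗ A(M₂).

-- Normalisation in commutative rings with integer coefficients.

module IntegerCoefficientSolver {c ℓ} (R : CommutativeRing c ℓ) where
  open CommutativeRing R
  open Algebra.Properties.Ring ring
  open Algebra.Properties.Semiring.Mult.TCOptimised semiring using (×-homo-+; ×1-homo-*) renaming (_×_ to _⋆_)
  open Algebra.Properties.CommutativeSemigroup +-commutativeSemigroup using (interchange)
  open SetoidReasoning setoid

  -- The pair (a , b) stands for the integer a - b.
  differences : RawRing _ _
  differences = record
    { Carrier = ℕ × ℕ
    ; _≈_ = _≡_
    ; _+_ = λ { (a , b) (c , d) → (a +ℕ c , b +ℕ d) }
    ; _*_ = λ { (a , b) (c , d) → (a *ℕ c +ℕ b *ℕ d , a *ℕ d +ℕ b *ℕ c) }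
    ; -_ = λ { (a , b) → (b , a) }
    ; 0# = 0 , 0
    ; 1# = 1 , 0
    }

  ⌊_⌋ : ℕ → Carrier
  ⌊ a ⌋ = a ⋆ 1#

  -- The special case makes the literals 0 and 1 evaluate to 0# and 1# definitionally.
  ⟦_⟧ : ℕ × ℕ → Carrier
  ⟦ a , zero ⟧  = ⌊ a ⌋
  ⟦ a , suc b ⟧ = ⌊ a ⌋ - ⌊ suc b ⌋

  ⟦⟧≈ : ∀ p → ⟦ p ⟧ ≈ ⌊ proj₁ p ⌋ - ⌊ proj₂ p ⌋
  ⟦⟧≈ (a , zero)  = sym (trans (+-congˡ -0#≈0#) (+-identityʳ _))
  ⟦⟧≈ (a , suc b) = refl

  +-difference : ∀ p q r s → (p + q) - (r + s) ≈ (p - r) + (q - s)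
  +-difference p q r s = begin
    (p + q) - (r + s)       ≈⟨ +-congˡ (-‿+-comm r s) ⟨
    (p + q) + (- r + - s)   ≈⟨ interchange p q (- r) (- s) ⟩
    (p - r) + (q - s)       ∎

  *-difference : ∀ p q r s → (p - q) * (r - s) ≈ (p * r + q * s) - (p * s + q * r)
  *-difference p q r s = begin
    (p - q) * (r - s)                           ≈⟨ [y-z]x≈yx-zx (r - s) p q ⟩
    p * (r - s) - q * (r - s)                   ≈⟨ +-cong (x[y-z]≈xy-xz p r s) (-‿cong (x[y-z]≈xy-xz q r s)) ⟩
    (p * r - p * s) - (q * r - q * s)           ≈⟨ +-congˡ (-‿+-comm (q * r) (- (q * s))) ⟨
    (p * r - p * s) + (- (q * r) - - (q * s))   ≈⟨ +-congˡ (+-comm _ _) ⟩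
    (p * r - p * s) + (- - (q * s) - (q * r))   ≈⟨ +-congˡ (+-congʳ (-‿involutive _)) ⟩
    (p * r - p * s) + (q * s - q * r)           ≈⟨ +-difference _ _ _ _ ⟨
    (p * r + q * s) - (p * s + q * r)           ∎

  ⌊*+*⌋ : ∀ a b c d → ⌊ a *ℕ b +ℕ c *ℕ d ⌋ ≈ ⌊ a ⌋ * ⌊ b ⌋ + ⌊ c ⌋ * ⌊ d ⌋
  ⌊*+*⌋ a b c d = trans (×-homo-+ 1# (a *ℕ b) (c *ℕ d)) (+-cong (×1-homo-* a b) (×1-homo-* c d))

  evaluation : differences -Raw-AlmostCommutative⟶ fromCommutativeRing R
  evaluation = record
    { ⟦_⟧ = ⟦_⟧
    ; +-homo = λ { p@(a , b) q@(c , d) → begin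
        ⟦ (a +ℕ c , b +ℕ d) ⟧                ≈⟨ ⟦⟧≈ (a +ℕ c , b +ℕ d) ⟩
        ⌊ a +ℕ c ⌋ - ⌊ b +ℕ d ⌋              ≈⟨ +-cong (×-homo-+ 1# a c) (-‿cong (×-homo-+ 1# b d)) ⟩
        (⌊ a ⌋ + ⌊ c ⌋) - (⌊ b ⌋ + ⌊ d ⌋)    ≈⟨ +-difference _ _ _ _ ⟩
        (⌊ a ⌋ - ⌊ b ⌋) + (⌊ c ⌋ - ⌊ d ⌋)    ≈⟨ +-cong (⟦⟧≈ p) (⟦⟧≈ q) ⟨
        ⟦ p ⟧ + ⟦ q ⟧                        ∎ }
    ; *-homo = λ { p@(a , b) q@(c , d) → begin
        ⟦ (a *ℕ c +ℕ b *ℕ d , a *ℕ d +ℕ b *ℕ c) ⟧        ≈⟨ ⟦⟧≈ (a *ℕ c +ℕ b *ℕ d , a *ℕ d +ℕ b *ℕ c) ⟩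
        ⌊ a *ℕ c +ℕ b *ℕ d ⌋ - ⌊ a *ℕ d +ℕ b *ℕ c ⌋      ≈⟨ +-cong (⌊*+*⌋ a c b d) (-‿cong (⌊*+*⌋ a d b c)) ⟩
        (⌊ a ⌋ * ⌊ c ⌋ + ⌊ b ⌋ * ⌊ d ⌋) - (⌊ a ⌋ * ⌊ d ⌋ + ⌊ b ⌋ * ⌊ c ⌋)   ≈⟨ *-difference _ _ _ _ ⟨
        (⌊ a ⌋ - ⌊ b ⌋) * (⌊ c ⌋ - ⌊ d ⌋)                ≈⟨ *-cong (⟦⟧≈ p) (⟦⟧≈ q) ⟨
        ⟦ p ⟧ * ⟦ q ⟧                                    ∎ }
    ; -‿homo = λ { p@(a , b) → begin
        ⟦ (b , a) ⟧           ≈⟨ ⟦⟧≈ (b , a) ⟩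
        ⌊ b ⌋ - ⌊ a ⌋         ≈⟨ +-congʳ (-‿involutive ⌊ b ⌋) ⟨
        - - ⌊ b ⌋ - ⌊ a ⌋     ≈⟨ +-comm _ _ ⟩
        - ⌊ a ⌋ - - ⌊ b ⌋     ≈⟨ -‿+-comm _ _ ⟩
        - (⌊ a ⌋ - ⌊ b ⌋)     ≈⟨ -‿cong (⟦⟧≈ p) ⟨
        - ⟦ p ⟧               ∎ }
    ; 0-homo = refl
    ; 1-homo = refl
    }

  ⟦⟧-cong : ∀ {p q} → proj₁ p +ℕ proj₂ q ≡ proj₁ q +ℕ proj₂ p → ⟦ p ⟧ ≈ ⟦ q ⟧
  ⟦⟧-cong {p@(a , b)} {q@(c , d)} eq = begin
    ⟦ p ⟧                               ≈⟨ ⟦⟧≈ p ⟩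
    ⌊ a ⌋ - ⌊ b ⌋                       ≈⟨ +-identityʳ _ ⟨
    (⌊ a ⌋ - ⌊ b ⌋) + 0#                ≈⟨ +-congˡ (-‿inverseʳ ⌊ d ⌋) ⟨
    (⌊ a ⌋ - ⌊ b ⌋) + (⌊ d ⌋ - ⌊ d ⌋)   ≈⟨ +-difference _ _ _ _ ⟨
    (⌊ a ⌋ + ⌊ d ⌋) - (⌊ b ⌋ + ⌊ d ⌋)   ≈⟨ +-congʳ (×-homo-+ 1# a d) ⟨
    ⌊ a +ℕ d ⌋ - (⌊ b ⌋ + ⌊ d ⌋)        ≈⟨ +-congʳ (reflexive (≡.cong ⌊_⌋ eq)) ⟩
    ⌊ c +ℕ b ⌋ - (⌊ b ⌋ + ⌊ d ⌋)        ≈⟨ +-cong (×-homo-+ 1# c b) (-‿cong (+-comm _ _)) ⟩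
    (⌊ c ⌋ + ⌊ b ⌋) - (⌊ d ⌋ + ⌊ b ⌋)   ≈⟨ +-difference _ _ _ _ ⟩
    (⌊ c ⌋ - ⌊ d ⌋) + (⌊ b ⌋ - ⌊ b ⌋)   ≈⟨ +-congˡ (-‿inverseʳ ⌊ b ⌋) ⟩
    (⌊ c ⌋ - ⌊ d ⌋) + 0#                ≈⟨ +-identityʳ _ ⟩
    ⌊ c ⌋ - ⌊ d ⌋                       ≈⟨ ⟦⟧≈ q ⟨
    ⟦ q ⟧                               ∎

  -- Equality in the ring is not assumed decidable, but cancelling terms only takes a test on
  -- integer coefficients. A failed test proves nothing, as distinct integers can agree in positive
  -- characteristic; hence `Maybe`.
  ⟦⟧≟ : ∀ p q → Maybe (⟦ p ⟧ ≈ ⟦ q ⟧)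
  ⟦⟧≟ p@(a , b) q@(c , d) with a +ℕ d ℕₚ.≟ c +ℕ b
  ... | yes eq = just (⟦⟧-cong {p} {q} eq)
  ... | no _   = nothing

  open Algebra.Solver.Ring differences (fromCommutativeRing R) evaluation ⟦⟧≟ public
    using (solve; _:=_; _:+_; _:*_; _:-_; :-_; con)

  :0 :1 : ∀ {n} → Algebra.Solver.Ring.Polynomial differences (fromCommutativeRing R) evaluation ⟦⟧≟ n
  :0 = con (0 , 0)
  :1 = con (1 , 0)

-- The exterior algebra by recursion on the first generator.

module Exterior {c ℓ} (K : Field c ℓ) where
  open Field K hiding (zero)
  open Algebra.Properties.Ring ring using (-0#≈0#)
  open OS K using (E; 0E; 1E; gen)
    renaming (_+E_ to infixl 6 _⊕_; -E_ to infix 8 ⊖_; _•_ to infixr 7 _•_)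
  open IntegerCoefficientSolver commutativeRing using (solve; _:=_; _:+_; _:*_; :-_; _:-_; :1)

  infix 4 _≋_
  -- A record and not the bare function type `_≈E_`, so that unification can recover `x` and `y`
  -- from a proof and equational reasoning needs few explicit arguments.
  record _≋_ {n} (x y : E n) : Set ℓ where
    constructor ⟪_⟫
    field at : ∀ A → x A ≈ y A
  open _≋_ public

  ≋-setoid : ℕ → Setoid c ℓ
  ≋-setoid n = record
    { Carrier = E n
    ; _≈_ = _≋_
    ; isEquivalence = record
      { refl = ⟪ (λ _ → refl) ⟫
      ; sym = λ p → ⟪ (λ A → sym (at p A)) ⟫
      ; trans = λ p q → ⟪ (λ A → trans (at p A) (at q A)) ⟫
      }
    }

  module ≋ {n} = Setoid (≋-setoid n)
  module ≋-Reasoning {n} = SetoidReasoning (≋-setoid n)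
  open ≋-Reasoning

  ⊕-cong : ∀ {n} {x x' y y' : E n} → x ≋ x' → y ≋ y' → x ⊕ y ≋ x' ⊕ y'
  ⊕-cong p q = ⟪ (λ A → +-cong (at p A) (at q A)) ⟫

  ⊖-cong : ∀ {n} {x x' : E n} → x ≋ x' → ⊖ x ≋ ⊖ x'
  ⊖-cong p = ⟪ (λ A → -‿cong (at p A)) ⟫

  •-cong : ∀ {n} {k k'} {x x' : E n} → k ≈ k' → x ≋ x' → k • x ≋ k' • x'
  •-cong p q = ⟪ (λ A → *-cong p (at q A)) ⟫

  ⊕-identityˡ : ∀ {n} (x : E n) → 0E ⊕ x ≋ x
  ⊕-identityˡ x = ⟪ (λ A → +-identityˡ (x A)) ⟫

  ⊕-identityʳ : ∀ {n} (x : E n) → x ⊕ 0E ≋ x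
  ⊕-identityʳ x = ⟪ (λ A → +-identityʳ (x A)) ⟫

  ⊕-assoc : ∀ {n} (x y z : E n) → (x ⊕ y) ⊕ z ≋ x ⊕ (y ⊕ z)
  ⊕-assoc x y z = ⟪ (λ A → +-assoc (x A) (y A) (z A)) ⟫

  ⊕-comm : ∀ {n} (x y : E n) → x ⊕ y ≋ y ⊕ x
  ⊕-comm x y = ⟪ (λ A → +-comm (x A) (y A)) ⟫

  ⊕-interchange : ∀ {n} (x y z t : E n) → (x ⊕ y) ⊕ (z ⊕ t) ≋ (x ⊕ z) ⊕ (y ⊕ t)
  ⊕-interchange x y z t = ⟪ (λ A →
    solve 4 (λ x y z t → (x :+ y) :+ (z :+ t) := (x :+ z) :+ (y :+ t)) refl (x A) (y A) (z A) (t A)) ⟫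

  ⊕-inverseʳ : ∀ {n} (x : E n) → x ⊕ ⊖ x ≋ 0E
  ⊕-inverseʳ x = ⟪ (λ A → -‿inverseʳ (x A)) ⟫

  ⊖-involutive : ∀ {n} (x : E n) → ⊖ ⊖ x ≋ x
  ⊖-involutive x = ⟪ (λ A → solve 1 (λ x → :- (:- x) := x) refl (x A)) ⟫

  ⊖0 : ∀ {n} → ⊖ 0E {n} ≋ 0E
  ⊖0 = ⟪ (λ _ → -0#≈0#) ⟫

  ⊖-⊕ : ∀ {n} (x y : E n) → ⊖ (x ⊕ y) ≋ ⊖ x ⊕ ⊖ y
  ⊖-⊕ x y = ⟪ (λ A → solve 2 (λ x y → :- (x :+ y) := :- x :+ :- y) refl (x A) (y A)) ⟫

  •-⊕ : ∀ {n} k (x y : E n) → k • (x ⊕ y) ≋ k • x ⊕ k • y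
  •-⊕ k x y = ⟪ (λ A → distribˡ k (x A) (y A)) ⟫

  •-assoc : ∀ {n} k l (x : E n) → k • (l • x) ≋ (k * l) • x
  •-assoc k l x = ⟪ (λ A → sym (*-assoc k l (x A))) ⟫

  1• : ∀ {n} (x : E n) → 1# • x ≋ x
  1• x = ⟪ (λ A → *-identityˡ (x A)) ⟫

  0• : ∀ {n} (x : E n) → 0# • x ≋ 0E
  0• x = ⟪ (λ A → zeroˡ (x A)) ⟫

  •0 : ∀ {n} k → k • 0E {n} ≋ 0E
  •0 k = ⟪ (λ _ → zeroʳ k) ⟫

  ⊖≋-1• : ∀ {n} (x : E n) → ⊖ x ≋ (- 1#) • x
  ⊖≋-1• x = ⟪ (λ A → solve 1 (λ x → :- x := (:- :1) :* x) refl (x A)) ⟫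

  -- x = lo x + e₀ hi x, where lo x and hi x do not involve the first generator e₀.
  lo hi : ∀ {n} → E (suc n) → E n
  lo x A = x (false ∷ A)
  hi x A = x (true ∷ A)

  ≋-split : ∀ {n} {x y : E (suc n)} → lo x ≋ lo y → hi x ≋ hi y → x ≋ y
  ≋-split p q = ⟪ (λ { (false ∷ A) → at p A ; (true ∷ A) → at q A }) ⟫

  lo-cong : ∀ {n} {x y : E (suc n)} → x ≋ y → lo x ≋ lo y
  lo-cong p = ⟪ (λ A → at p (false ∷ A)) ⟫

  hi-cong : ∀ {n} {x y : E (suc n)} → x ≋ y → hi x ≋ hi y
  hi-cong p = ⟪ (λ A → at p (true ∷ A)) ⟫

  -- The grading involution, (-1)^p in degree p. It carries every sign that arises when a generator
  -- moves past an inhomogeneous element.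
  α : ∀ {n} → E n → E n
  α x []          = x []
  α x (false ∷ A) = α (lo x) A
  α x (true ∷ A)  = - α (hi x) A

  α-cong : ∀ {n} {x y : E n} → x ≋ y → α x ≋ α y
  α-cong {zero}  p = ⟪ (λ { [] → at p [] }) ⟫
  α-cong {suc n} p = ≋-split (α-cong (lo-cong p)) (⊖-cong (α-cong (hi-cong p)))

  α-⊕ : ∀ {n} (x y : E n) → α (x ⊕ y) ≋ α x ⊕ α y
  α-⊕ {zero}  x y = ⟪ (λ { [] → refl }) ⟫
  α-⊕ {suc n} x y = ≋-split (α-⊕ (lo x) (lo y)) (begin
    ⊖ α (hi x ⊕ hi y)           ≈⟨ ⊖-cong (α-⊕ (hi x) (hi y)) ⟩
    ⊖ (α (hi x) ⊕ α (hi y))     ≈⟨ ⊖-⊕ _ _ ⟩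
    ⊖ α (hi x) ⊕ ⊖ α (hi y)     ∎)

  α-• : ∀ {n} k (x : E n) → α (k • x) ≋ k • α x
  α-• {zero}  k x = ⟪ (λ { [] → refl }) ⟫
  α-• {suc n} k x = ≋-split (α-• k (lo x)) ⟪ (λ A → trans (-‿cong (at (α-• k (hi x)) A))
    (solve 2 (λ k x → :- (k :* x) := k :* (:- x)) refl k (α (hi x) A))) ⟫

  α-0 : ∀ {n} → α (0E {n}) ≋ 0E
  α-0 = ≋.trans (α-cong (≋.sym (0• 0E))) (≋.trans (α-• 0# 0E) (0• _))

  α-⊖ : ∀ {n} (x : E n) → α (⊖ x) ≋ ⊖ α x
  α-⊖ x = begin
    α (⊖ x)          ≈⟨ α-cong (⊖≋-1• x) ⟩
    α ((- 1#) • x)   ≈⟨ α-• (- 1#) x ⟩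
    (- 1#) • α x     ≈⟨ ⊖≋-1• (α x) ⟨
    ⊖ α x            ∎

  α-involutive : ∀ {n} (x : E n) → α (α x) ≋ x
  α-involutive {zero}  x = ⟪ (λ { [] → refl }) ⟫
  α-involutive {suc n} x = ≋-split (α-involutive (lo x)) (begin
    ⊖ α (⊖ α (hi x))      ≈⟨ ⊖-cong (α-⊖ _) ⟩
    ⊖ ⊖ α (α (hi x))      ≈⟨ ⊖-involutive _ ⟩
    α (α (hi x))          ≈⟨ α-involutive (hi x) ⟩
    hi x                  ∎)

  infixl 7 _·_
  -- With e₀ e₀ = 0 and x₀ e₀ = e₀ α(x₀), the product (x₀ + e₀ x₁)(y₀ + e₀ y₁) expands to x₀ y₀ + e₀
  -- (x₁ y₀ + α(x₀) y₁). No inversion count appears.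
  _·_ : ∀ {n} → E n → E n → E n
  (x · y) []          = x [] * y []
  (x · y) (false ∷ A) = (lo x · lo y) A
  (x · y) (true ∷ A)  = (hi x · lo y) A + (α (lo x) · hi y) A

  ·-cong : ∀ {n} {x x' y y' : E n} → x ≋ x' → y ≋ y' → x · y ≋ x' · y'
  ·-cong {zero}  p q = ⟪ (λ { [] → *-cong (at p []) (at q []) }) ⟫
  ·-cong {suc n} p q = ≋-split (·-cong (lo-cong p) (lo-cong q))
    (⊕-cong (·-cong (hi-cong p) (lo-cong q)) (·-cong (α-cong (lo-cong p)) (hi-cong q)))

  ·-congˡ : ∀ {n} {x y y' : E n} → y ≋ y' → x · y ≋ x · y'
  ·-congˡ = ·-cong ≋.refl

  ·-congʳ : ∀ {n} {x x' y : E n} → x ≋ x' → x · y ≋ x' · y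
  ·-congʳ p = ·-cong p ≋.refl

  ·-distribˡ : ∀ {n} (x y z : E n) → x · (y ⊕ z) ≋ x · y ⊕ x · z
  ·-distribˡ {zero}  x y z = ⟪ (λ { [] → distribˡ _ _ _ }) ⟫
  ·-distribˡ {suc n} x y z = ≋-split (·-distribˡ (lo x) (lo y) (lo z))
    (≋.trans (⊕-cong (·-distribˡ (hi x) (lo y) (lo z)) (·-distribˡ (α (lo x)) (hi y) (hi z)))
             (⊕-interchange _ _ _ _))

  ·-distribʳ : ∀ {n} (x y z : E n) → (x ⊕ y) · z ≋ x · z ⊕ y · z
  ·-distribʳ {zero}  x y z = ⟪ (λ { [] → distribʳ _ _ _ }) ⟫
  ·-distribʳ {suc n} x y z = ≋-split (·-distribʳ (lo x) (lo y) (lo z))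
    (≋.trans (⊕-cong (·-distribʳ (hi x) (hi y) (lo z))
                     (≋.trans (·-congʳ (α-⊕ (lo x) (lo y))) (·-distribʳ (α (lo x)) (α (lo y)) (hi z))))
             (⊕-interchange _ _ _ _))

  ·-•ˡ : ∀ {n} k (x y : E n) → (k • x) · y ≋ k • (x · y)
  ·-•ˡ {zero}  k x y = ⟪ (λ { [] → *-assoc _ _ _ }) ⟫
  ·-•ˡ {suc n} k x y = ≋-split (·-•ˡ k (lo x) (lo y))
    (≋.trans (⊕-cong (·-•ˡ k (hi x) (lo y)) (≋.trans (·-congʳ (α-• k (lo x))) (·-•ˡ k (α (lo x)) (hi y))))
             (≋.sym (•-⊕ k _ _)))

  ·-•ʳ : ∀ {n} k (x y : E n) → x · (k • y) ≋ k • (x · y)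
  ·-•ʳ {zero}  k x y = ⟪ (λ { [] → solve 3 (λ k x y → x :* (k :* y) := k :* (x :* y)) refl k (x []) (y []) }) ⟫
  ·-•ʳ {suc n} k x y = ≋-split (·-•ʳ k (lo x) (lo y))
    (≋.trans (⊕-cong (·-•ʳ k (hi x) (lo y)) (·-•ʳ k (α (lo x)) (hi y))) (≋.sym (•-⊕ k _ _)))

  ·-zeroˡ : ∀ {n} (x : E n) → 0E · x ≋ 0E
  ·-zeroˡ x = ≋.trans (·-congʳ (≋.sym (0• 0E))) (≋.trans (·-•ˡ 0# 0E x) (0• _))

  ·-zeroʳ : ∀ {n} (x : E n) → x · 0E ≋ 0E
  ·-zeroʳ x = ≋.trans (·-congˡ (≋.sym (0• 0E))) (≋.trans (·-•ʳ 0# x 0E) (0• _))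

  ·-⊖ˡ : ∀ {n} (x y : E n) → (⊖ x) · y ≋ ⊖ (x · y)
  ·-⊖ˡ x y = ≋.trans (·-congʳ (⊖≋-1• x)) (≋.trans (·-•ˡ _ x y) (≋.sym (⊖≋-1• _)))

  ·-⊖ʳ : ∀ {n} (x y : E n) → x · (⊖ y) ≋ ⊖ (x · y)
  ·-⊖ʳ x y = ≋.trans (·-congˡ (⊖≋-1• y)) (≋.trans (·-•ʳ _ x y) (≋.sym (⊖≋-1• _)))

  α-· : ∀ {n} (x y : E n) → α (x · y) ≋ α x · α y
  α-· {zero}  x y = ⟪ (λ { [] → refl }) ⟫
  α-· {suc n} x y = ≋-split (α-· (lo x) (lo y)) (begin
    ⊖ α (hi x · lo y ⊕ α (lo x) · hi y)                       ≈⟨ ⊖-cong (α-⊕ _ _) ⟩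
    ⊖ (α (hi x · lo y) ⊕ α (α (lo x) · hi y))                 ≈⟨ ⊖-⊕ _ _ ⟩
    ⊖ α (hi x · lo y) ⊕ ⊖ α (α (lo x) · hi y)                 ≈⟨ ⊕-cong (⊖-cong (α-· _ _)) (⊖-cong (α-· _ _)) ⟩
    ⊖ (α (hi x) · α (lo y)) ⊕ ⊖ (α (α (lo x)) · α (hi y))     ≈⟨ ⊕-cong (·-⊖ˡ _ _) (·-⊖ʳ _ _) ⟨
    (⊖ α (hi x)) · α (lo y) ⊕ α (α (lo x)) · (⊖ α (hi y))     ∎)

  ·-assoc : ∀ {n} (x y z : E n) → (x · y) · z ≋ x · (y · z)
  ·-assoc {zero}  x y z = ⟪ (λ { [] → *-assoc _ _ _ }) ⟫
  ·-assoc {suc n} x y z = ≋-split (·-assoc (lo x) (lo y) (lo z)) (begin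
    (x₁ · y₀ ⊕ α x₀ · y₁) · z₀ ⊕ α (x₀ · y₀) · z₁
      ≈⟨ ⊕-cong (·-distribʳ _ _ _) (·-congʳ (α-· x₀ y₀)) ⟩
    ((x₁ · y₀) · z₀ ⊕ (α x₀ · y₁) · z₀) ⊕ (α x₀ · α y₀) · z₁
      ≈⟨ ⊕-cong (⊕-cong (·-assoc _ _ _) (·-assoc _ _ _)) (·-assoc _ _ _) ⟩
    (x₁ · (y₀ · z₀) ⊕ α x₀ · (y₁ · z₀)) ⊕ α x₀ · (α y₀ · z₁)
      ≈⟨ ⊕-assoc _ _ _ ⟩
    x₁ · (y₀ · z₀) ⊕ (α x₀ · (y₁ · z₀) ⊕ α x₀ · (α y₀ · z₁))
      ≈⟨ ⊕-cong ≋.refl (·-distribˡ _ _ _) ⟨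
    x₁ · (y₀ · z₀) ⊕ α x₀ · (y₁ · z₀ ⊕ α y₀ · z₁) ∎)
    where
    x₀ = lo x ; x₁ = hi x ; y₀ = lo y ; y₁ = hi y ; z₀ = lo z ; z₁ = hi z

  α-1 : ∀ {n} → α (1E {n}) ≋ 1E
  α-1 {zero}  = ⟪ (λ { [] → refl }) ⟫
  α-1 {suc n} = ≋-split (α-1 {n}) (≋.trans (⊖-cong (α-0 {n})) ⊖0)

  ·-identityˡ : ∀ {n} (x : E n) → 1E · x ≋ x
  ·-identityˡ {zero}  x = ⟪ (λ { [] → *-identityˡ _ }) ⟫
  ·-identityˡ {suc n} x = ≋-split (·-identityˡ (lo x))
    (≋.trans (⊕-cong (·-zeroˡ (lo x)) (≋.trans (·-congʳ α-1) (·-identityˡ (hi x)))) (⊕-identityˡ _))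

  ·-identityʳ : ∀ {n} (x : E n) → x · 1E ≋ x
  ·-identityʳ {zero}  x = ⟪ (λ { [] → *-identityʳ _ }) ⟫
  ·-identityʳ {suc n} x = ≋-split (·-identityʳ (lo x))
    (≋.trans (⊕-cong (·-identityʳ (hi x)) (·-zeroʳ _)) (⊕-identityʳ _))

  α-gen : ∀ {n} (s : Fin n) → α (gen s) ≋ ⊖ gen s
  α-gen zero    = ≋-split (≋.trans α-0 (≋.sym ⊖0)) (⊖-cong α-1)
  α-gen (suc s) = ≋-split (α-gen s) (⊖-cong α-0)

  -- An inhomogeneous `x` has no single Koszul sign; `α` applies the right one in each degree.
  ·-gen : ∀ {n} (x : E n) s → x · gen s ≋ gen s · α x
  ·-gen x zero = ≋-split (≋.trans (·-zeroʳ _) (≋.sym (·-zeroˡ _))) (begin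
    hi x · 0E ⊕ α (lo x) · 1E                     ≈⟨ ⊕-cong (·-zeroʳ _) (·-identityʳ _) ⟩
    0E ⊕ α (lo x)                                 ≈⟨ ⊕-comm _ _ ⟩
    α (lo x) ⊕ 0E                                 ≈⟨ ⊕-cong (·-identityˡ _) (≋.trans (·-congʳ α-0) (·-zeroˡ _)) ⟨
    1E · α (lo x) ⊕ α 0E · (⊖ α (hi x))           ∎)
  ·-gen x (suc s) = ≋-split (·-gen (lo x) s) (begin
    hi x · gen s ⊕ α (lo x) · 0E                  ≈⟨ ⊕-cong (·-gen (hi x) s) (·-zeroʳ _) ⟩
    gen s · α (hi x) ⊕ 0E                         ≈⟨ ⊕-comm _ _ ⟩
    0E ⊕ gen s · α (hi x)                         ≈⟨ ⊕-cong (·-zeroˡ _) (⊖-involutive _) ⟨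
    0E · α (lo x) ⊕ ⊖ ⊖ (gen s · α (hi x))        ≈⟨ ⊕-cong ≋.refl (⊖-cong (·-⊖ʳ _ _)) ⟨
    0E · α (lo x) ⊕ ⊖ (gen s · (⊖ α (hi x)))      ≈⟨ ⊕-cong ≋.refl (·-⊖ˡ _ _) ⟨
    0E · α (lo x) ⊕ (⊖ gen s) · (⊖ α (hi x))      ≈⟨ ⊕-cong ≋.refl (·-congʳ (α-gen s)) ⟨
    0E · α (lo x) ⊕ α (gen s) · (⊖ α (hi x))      ∎)
  gen-sq : ∀ {n} (s : Fin n) → gen s · gen s ≋ 0E
  gen-sq zero    = ≋-split (·-zeroˡ 0E)
    (≋.trans (⊕-cong (·-zeroʳ _) (≋.trans (·-congʳ α-0) (·-zeroˡ _))) (⊕-identityˡ _))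
  gen-sq (suc s) = ≋-split (gen-sq s) (≋.trans (⊕-cong (·-zeroˡ _) (·-zeroʳ _)) (⊕-identityˡ _))

-- Induced homomorphisms and contractions with linear forms.

module Derivations {c ℓ} (K : Field c ℓ) where
  open Field K hiding (zero) renaming (Carrier to 𝕜)
  open OS K using (E; 0E; 1E; gen)
    renaming (_+E_ to infixl 6 _⊕_; -E_ to infix 8 ⊖_; _•_ to infixr 7 _•_)
  open IntegerCoefficientSolver commutativeRing using (solve; _:=_; _:+_; _:*_; :-_; _:-_; :0)
  open Exterior K
  open ≋-Reasoning

  gen-· : ∀ {n} s (x : E n) → gen s · x ≋ α x · gen s
  gen-· s x = ≋.sym (≋.trans (·-gen (α x) s) (·-congˡ (α-involutive x)))

  gen-anticomm : ∀ {n} (s t : Fin n) → gen s · gen t ≋ ⊖ (gen t · gen s)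
  gen-anticomm s t = begin
    gen s · gen t        ≈⟨ ·-gen (gen s) t ⟩
    gen t · α (gen s)    ≈⟨ ·-congˡ (α-gen s) ⟩
    gen t · (⊖ gen s)    ≈⟨ ·-⊖ʳ _ _ ⟩
    ⊖ (gen t · gen s)    ∎

  gen·x·gen : ∀ {n} s (x : E n) → gen s · x · gen s ≋ 0E
  gen·x·gen s x = begin
    gen s · x · gen s         ≈⟨ ·-assoc _ _ _ ⟩
    gen s · (x · gen s)       ≈⟨ ·-congˡ (·-gen x s) ⟩
    gen s · (gen s · α x)     ≈⟨ ·-assoc _ _ _ ⟨
    gen s · gen s · α x       ≈⟨ ·-congʳ (gen-sq s) ⟩
    0E · α x                  ≈⟨ ·-zeroˡ _ ⟩
    0E                        ∎

  -- The recursive form of `Emap`: the homomorphism induced by e_s ↦ e_(g s), obtained by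
  -- substitution in x = lo x + e₀ hi x. For non-injective `g`, colliding generators give zero
  -- because they square to zero.
  push : ∀ {n k} → (Fin n → Fin k) → E n → E k
  push {zero}  g x = x [] • 1E
  push {suc n} g x = push (g ∘ suc) (lo x) ⊕ gen (g zero) · push (g ∘ suc) (hi x)

  push-cong : ∀ {n k} (g : Fin n → Fin k) {x y} → x ≋ y → push g x ≋ push g y
  push-cong {zero}  g p = •-cong (at p []) ≋.refl
  push-cong {suc n} g p = ⊕-cong (push-cong (g ∘ suc) (lo-cong p)) (·-congˡ (push-cong (g ∘ suc) (hi-cong p)))

  push-ext : ∀ {n k} {g h : Fin n → Fin k} → (∀ s → g s ≡ h s) → ∀ x → push g x ≋ push h x
  push-ext {zero}  e x = ≋.refl
  push-ext {suc n} e x = ⊕-cong (push-ext (e ∘ suc) _)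
    (·-cong (≋.reflexive (≡.cong gen (e zero))) (push-ext (e ∘ suc) _))

  push-⊕ : ∀ {n k} (g : Fin n → Fin k) x y → push g (x ⊕ y) ≋ push g x ⊕ push g y
  push-⊕ {zero}  g x y = ⟪ (λ A → distribʳ _ _ _) ⟫
  push-⊕ {suc n} g x y = ≋.trans
    (⊕-cong (push-⊕ (g ∘ suc) _ _) (≋.trans (·-congˡ (push-⊕ (g ∘ suc) _ _)) (·-distribˡ _ _ _)))
    (⊕-interchange _ _ _ _)

  push-• : ∀ {n k} (g : Fin n → Fin k) a x → push g (a • x) ≋ a • push g x
  push-• {zero}  g a x = ≋.sym (•-assoc a (x []) 1E)
  push-• {suc n} g a x = ≋.trans
    (⊕-cong (push-• (g ∘ suc) _ _) (≋.trans (·-congˡ (push-• (g ∘ suc) _ _)) (·-•ʳ _ _ _)))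
    (≋.sym (•-⊕ a _ _))

  push-0 : ∀ {n k} (g : Fin n → Fin k) → push g 0E ≋ 0E
  push-0 g = ≋.trans (push-cong g (≋.sym (0• 0E))) (≋.trans (push-• g 0# 0E) (0• _))

  push-⊖ : ∀ {n k} (g : Fin n → Fin k) x → push g (⊖ x) ≋ ⊖ push g x
  push-⊖ g x = ≋.trans (push-cong g (⊖≋-1• x)) (≋.trans (push-• g _ x) (≋.sym (⊖≋-1• _)))

  push-1 : ∀ {n k} (g : Fin n → Fin k) → push g 1E ≋ 1E
  push-1 {zero}  g = 1• 1E
  push-1 {suc n} g = ≋.trans
    (⊕-cong (push-1 (g ∘ suc)) (≋.trans (·-congˡ (push-0 (g ∘ suc))) (·-zeroʳ _)))
    (⊕-identityʳ _)

  push-gen : ∀ {n k} (g : Fin n → Fin k) s → push g (gen s) ≋ gen (g s)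
  push-gen g zero    = ≋.trans
    (⊕-cong (push-0 (g ∘ suc)) (≋.trans (·-congˡ (push-1 (g ∘ suc))) (·-identityʳ _)))
    (⊕-identityˡ _)
  push-gen g (suc s) = ≋.trans
    (⊕-cong (push-gen (g ∘ suc) s) (≋.trans (·-congˡ (push-0 (g ∘ suc))) (·-zeroʳ _)))
    (⊕-identityʳ _)

  α-push : ∀ {n k} (g : Fin n → Fin k) x → α (push g x) ≋ push g (α x)
  α-push {zero}  g x = ≋.trans (α-• _ _) (•-cong refl α-1)
  α-push {suc n} g x = begin
    α (X₀ ⊕ e · X₁)                              ≈⟨ α-⊕ _ _ ⟩
    α X₀ ⊕ α (e · X₁)                            ≈⟨ ⊕-cong ≋.refl (≋.trans (α-· _ _) (·-congʳ (α-gen (g zero)))) ⟩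
    α X₀ ⊕ (⊖ e) · α X₁                          ≈⟨ ⊕-cong ≋.refl (≋.trans (·-⊖ˡ _ _) (≋.sym (·-⊖ʳ _ _))) ⟩
    α X₀ ⊕ e · (⊖ α X₁)                          ≈⟨ ⊕-cong (α-push (g ∘ suc) _) (·-congˡ (⊖-cong (α-push (g ∘ suc) _))) ⟩
    push _ (α (lo x)) ⊕ e · (⊖ push _ (α (hi x)))  ≈⟨ ⊕-cong ≋.refl (·-congˡ (push-⊖ (g ∘ suc) _)) ⟨
    push g (α x)                                 ∎
    where e = gen (g zero) ; X₀ = push (g ∘ suc) (lo x) ; X₁ = push (g ∘ suc) (hi x)

  push-· : ∀ {n k} (g : Fin n → Fin k) x y → push g (x · y) ≋ push g x · push g y
  push-· {zero}  g x y = begin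
    (x [] * y []) • 1E             ≈⟨ •-assoc _ _ _ ⟨
    x [] • y [] • 1E               ≈⟨ •-cong refl (·-identityˡ _) ⟨
    x [] • (1E · (y [] • 1E))      ≈⟨ ·-•ˡ _ _ _ ⟨
    (x [] • 1E) · (y [] • 1E)      ∎
  push-· {suc n} g x y = begin
    f (x₀ · y₀) ⊕ e · f (x₁ · y₀ ⊕ α x₀ · y₁)
      ≈⟨ ⊕-cong (push-· (g ∘ suc) _ _) (·-congˡ (≋.trans (push-⊕ (g ∘ suc) _ _) (⊕-cong (push-· (g ∘ suc) _ _) (push-· (g ∘ suc) _ _)))) ⟩
    X₀ · Y₀ ⊕ e · (X₁ · Y₀ ⊕ f (α x₀) · Y₁)
      ≈⟨ ⊕-cong ≋.refl (·-distribˡ _ _ _) ⟩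
    X₀ · Y₀ ⊕ (e · (X₁ · Y₀) ⊕ e · (f (α x₀) · Y₁))
      ≈⟨ ⊕-cong ≋.refl (⊕-cong (≋.sym (·-assoc _ _ _)) step) ⟩
    X₀ · Y₀ ⊕ (e · X₁ · Y₀ ⊕ X₀ · (e · Y₁))
      -- The product with two factors `e` is zero; it is inserted here so that the four terms
      -- factor.
      ≈⟨ ⊕-cong ≋.refl (≋.trans (⊕-comm _ _) (≋.sym (≋.trans (⊕-cong ≋.refl vanish) (⊕-identityʳ _)))) ⟩
    X₀ · Y₀ ⊕ ((X₀ · (e · Y₁) ⊕ e · X₁ · Y₀) ⊕ e · X₁ · (e · Y₁))
      ≈⟨ ⟪ (λ A → solve 4 (λ a b c d → a :+ ((b :+ c) :+ d) := (a :+ b) :+ (c :+ d)) refl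
             ((X₀ · Y₀) A) ((X₀ · (e · Y₁)) A) ((e · X₁ · Y₀) A) ((e · X₁ · (e · Y₁)) A)) ⟫ ⟩
    (X₀ · Y₀ ⊕ X₀ · (e · Y₁)) ⊕ (e · X₁ · Y₀ ⊕ e · X₁ · (e · Y₁))
      ≈⟨ ⊕-cong (·-distribˡ _ _ _) (·-distribˡ _ _ _) ⟨
    X₀ · (Y₀ ⊕ e · Y₁) ⊕ e · X₁ · (Y₀ ⊕ e · Y₁)
      ≈⟨ ·-distribʳ _ _ _ ⟨
    (X₀ ⊕ e · X₁) · (Y₀ ⊕ e · Y₁) ∎
    where
    f = push (g ∘ suc)
    e = gen (g zero)
    x₀ = lo x ; x₁ = hi x ; y₀ = lo y ; y₁ = hi y
    X₀ = f x₀ ; X₁ = f x₁ ; Y₀ = f y₀ ; Y₁ = f y₁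
    step : e · (f (α x₀) · Y₁) ≋ X₀ · (e · Y₁)
    step = begin
      e · (f (α x₀) · Y₁)     ≈⟨ ·-congˡ (·-congʳ (α-push (g ∘ suc) _)) ⟨
      e · (α X₀ · Y₁)         ≈⟨ ·-assoc _ _ _ ⟨
      e · α X₀ · Y₁           ≈⟨ ·-congʳ (·-gen X₀ (g zero)) ⟨
      X₀ · e · Y₁             ≈⟨ ·-assoc _ _ _ ⟩
      X₀ · (e · Y₁)           ∎
    vanish : e · X₁ · (e · Y₁) ≋ 0E
    vanish = begin
      e · X₁ · (e · Y₁)       ≈⟨ ·-assoc _ _ _ ⟨
      e · X₁ · e · Y₁         ≈⟨ ·-congʳ (gen·x·gen (g zero) X₁) ⟩
      0E · Y₁                 ≈⟨ ·-zeroˡ _ ⟩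
      0E                      ∎

  push-∘ : ∀ {n k l} (f : Fin k → Fin l) (g : Fin n → Fin k) x → push f (push g x) ≋ push (f ∘ g) x
  push-∘ {zero}  f g x = ≋.trans (push-• f _ _) (•-cong refl (push-1 f))
  push-∘ {suc n} f g x = begin
    push f (push _ (lo x) ⊕ gen (g zero) · push _ (hi x))
      ≈⟨ push-⊕ f _ _ ⟩
    push f (push _ (lo x)) ⊕ push f (gen (g zero) · push _ (hi x))
      ≈⟨ ⊕-cong (push-∘ f (g ∘ suc) _) (≋.trans (push-· f _ _) (·-cong (push-gen f _) (push-∘ f (g ∘ suc) _))) ⟩
    push (f ∘ g) x ∎

  gen₀-· : ∀ {n} (x : E (suc n)) → gen zero · x ≋ (λ { (false ∷ A) → 0# ; (true ∷ A) → lo x A })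
  gen₀-· x = ≋-split (·-zeroˡ _)
    (≋.trans (⊕-cong (·-identityˡ _) (≋.trans (·-congʳ α-0) (·-zeroˡ _))) (⊕-identityʳ _))

  inj₀ : ∀ {n} → E n → E (suc n)
  inj₀ x (false ∷ A) = x A
  inj₀ x (true ∷ A)  = 0#

  inj₀-· : ∀ {n} (x y : E n) → inj₀ (x · y) ≋ inj₀ x · inj₀ y
  inj₀-· x y = ≋-split ≋.refl (≋.sym (≋.trans (⊕-cong (·-zeroˡ _) (·-zeroʳ _)) (⊕-identityʳ _)))

  push-suc : ∀ {n k} (g : Fin n → Fin k) x → push (suc ∘ g) x ≋ inj₀ (push g x)
  push-suc {zero}  g x = ≋-split ≋.refl (•0 _)
  push-suc {suc n} g x = ≋.trans
    (⊕-cong (push-suc (g ∘ suc) (lo x))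
      (≋.trans (·-cong (≋-split ≋.refl ≋.refl) (push-suc (g ∘ suc) (hi x))) (≋.sym (inj₀-· (gen (g zero)) _))))
    (≋-split ≋.refl (⊕-identityˡ _))

  -- A map that fixes the first index and preserves the rest acts on `lo` and `hi` separately. This
  -- allows induction along the block inclusions of ground sets.
  push-extend : ∀ {n k} (g : Fin (suc n) → Fin (suc k)) (h : Fin n → Fin k) → g zero ≡ zero →
                (∀ s → g (suc s) ≡ suc (h s)) → ∀ x →
                (lo (push g x) ≋ push h (lo x)) × (hi (push g x) ≋ push h (hi x))
  push-extend g h g0 gs x = ≋.trans (lo-cong e) (⊕-identityʳ _) , ≋.trans (hi-cong e) (⊕-identityˡ _)
    where
    e = ⊕-cong
      (≋.trans (push-ext gs (lo x)) (push-suc h (lo x)))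
      (≋.trans (·-cong (≋.reflexive (≡.cong gen g0)) (≋.trans (push-ext gs (hi x)) (push-suc h (hi x))))
               (gen₀-· (inj₀ (push h (hi x)))))

  push-id : ∀ {n} (x : E n) → push (λ s → s) x ≋ x
  push-id {zero}  x = ⟪ (λ { [] → *-identityʳ _ }) ⟫
  push-id {suc n} x = ≋-split (≋.trans (proj₁ e) (push-id (lo x))) (≋.trans (proj₂ e) (push-id (hi x)))
    where e = push-extend (λ s → s) (λ s → s) ≡.refl (λ _ → ≡.refl) x

  -- Contraction with the linear form c: the graded derivation sending gen s to c s.
  δ : ∀ {n} → (Fin n → 𝕜) → E n → E n
  δ c x []          = 0#
  δ c x (false ∷ A) = δ (c ∘ suc) (lo x) A + c zero * hi x A
  δ c x (true ∷ A)  = - δ (c ∘ suc) (hi x) A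

  δ-cong : ∀ {n} (c : Fin n → 𝕜) {x y} → x ≋ y → δ c x ≋ δ c y
  δ-cong {zero}  c p = ⟪ (λ { [] → refl }) ⟫
  δ-cong {suc n} c p = ≋-split
    (⊕-cong (δ-cong _ (lo-cong p)) (•-cong refl (hi-cong p)))
    (⊖-cong (δ-cong _ (hi-cong p)))

  δ-⊕ : ∀ {n} (c : Fin n → 𝕜) x y → δ c (x ⊕ y) ≋ δ c x ⊕ δ c y
  δ-⊕ {zero}  c x y = ⟪ (λ { [] → sym (+-identityˡ _) }) ⟫
  δ-⊕ {suc n} c x y = ≋-split
    (≋.trans (⊕-cong (δ-⊕ _ _ _) (•-⊕ _ _ _)) (⊕-interchange _ _ _ _))
    (≋.trans (⊖-cong (δ-⊕ _ _ _)) (⊖-⊕ _ _))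

  δ-• : ∀ {n} (c : Fin n → 𝕜) k x → δ c (k • x) ≋ k • δ c x
  δ-• {zero}  c k x = ⟪ (λ { [] → sym (zeroʳ _) }) ⟫
  δ-• {suc n} c k x = ≋-split
    ⟪ (λ A → trans (+-congʳ (at (δ-• _ _ _) A))
        (solve 4 (λ k d c h → k :* d :+ c :* (k :* h) := k :* (d :+ c :* h)) refl
          k (δ (c ∘ suc) (lo x) A) (c zero) (hi x A))) ⟫
    ⟪ (λ A → trans (-‿cong (at (δ-• _ _ _) A))
        (solve 2 (λ k d → :- (k :* d) := k :* (:- d)) refl k (δ (c ∘ suc) (hi x) A))) ⟫

  δ-0 : ∀ {n} (c : Fin n → 𝕜) → δ c 0E ≋ 0E
  δ-0 c = ≋.trans (δ-cong c (≋.sym (0• 0E))) (≋.trans (δ-• c 0# 0E) (0• _))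

  δ-⊖ : ∀ {n} (c : Fin n → 𝕜) x → δ c (⊖ x) ≋ ⊖ δ c x
  δ-⊖ c x = ≋.trans (δ-cong c (⊖≋-1• x)) (≋.trans (δ-• c _ x) (≋.sym (⊖≋-1• _)))

  δ-1 : ∀ {n} (c : Fin n → 𝕜) → δ c 1E ≋ 0E
  δ-1 {zero}  c = ⟪ (λ { [] → refl }) ⟫
  δ-1 {suc n} c = ≋-split
    (≋.trans (⊕-cong (δ-1 _) (•0 _)) (⊕-identityʳ _))
    (≋.trans (⊖-cong (δ-0 _)) ⊖0)

  δ-gen : ∀ {n} (c : Fin n → 𝕜) s → δ c (gen s) ≋ c s • 1E
  δ-gen c zero = ≋-split
    (≋.trans (⊕-cong (δ-0 _) ≋.refl) (⊕-identityˡ _))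
    (≋.trans (⊖-cong (δ-1 _)) (≋.trans ⊖0 (≋.sym (•0 _))))
  δ-gen c (suc s) = ≋-split
    (≋.trans (⊕-cong (δ-gen _ s) (•0 _)) (⊕-identityʳ _))
    (≋.trans (⊖-cong (δ-0 _)) (≋.trans ⊖0 (≋.sym (•0 _))))

  -- Contraction lowers the degree by one, which flips the sign of the grading involution.
  α-δ : ∀ {n} (c : Fin n → 𝕜) x → α (δ c x) ≋ ⊖ δ c (α x)
  α-δ {zero}  c x = ⟪ (λ { [] → sym (at (⊖0 {zero}) []) }) ⟫
  α-δ {suc n} c x = ≋-split
    (begin
      α (δ c' x₀ ⊕ c zero • x₁)           ≈⟨ α-⊕ _ _ ⟩
      α (δ c' x₀) ⊕ α (c zero • x₁)       ≈⟨ ⊕-cong (α-δ c' x₀) (α-• _ _) ⟩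
      ⊖ δ c' (α x₀) ⊕ c zero • α x₁       ≈⟨ ⟪ (λ A → solve 3 (λ d c a → :- d :+ c :* a := :- (d :+ c :* (:- a))) refl
                                                  (δ c' (α x₀) A) (c zero) (α x₁ A)) ⟫ ⟩
      ⊖ (δ c' (α x₀) ⊕ c zero • ⊖ α x₁)   ∎)
    (begin
      ⊖ α (⊖ δ c' x₁)         ≈⟨ ⊖-cong (α-⊖ _) ⟩
      ⊖ ⊖ α (δ c' x₁)         ≈⟨ ⊖-cong (⊖-cong (α-δ c' x₁)) ⟩
      ⊖ ⊖ ⊖ δ c' (α x₁)       ≈⟨ ⊖-cong (⊖-cong (δ-⊖ c' _)) ⟨
      ⊖ ⊖ δ c' (⊖ α x₁)       ∎)
    where c' = c ∘ suc ; x₀ = lo x ; x₁ = hi x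

  δ-· : ∀ {n} (c : Fin n → 𝕜) x y → δ c (x · y) ≋ δ c x · y ⊕ α x · δ c y
  δ-· {zero}  c x y = ⟪ (λ { [] → sym (trans (+-cong (zeroˡ _) (zeroʳ _)) (+-identityʳ _)) }) ⟫
  δ-· {suc n} c x y = ≋-split
    (begin
      d (x₀ · y₀) ⊕ k • (x₁ · y₀ ⊕ α x₀ · y₁)
        ≈⟨ ⊕-cong (δ-· _ _ _) (•-⊕ _ _ _) ⟩
      (d x₀ · y₀ ⊕ α x₀ · d y₀) ⊕ (k • (x₁ · y₀) ⊕ k • (α x₀ · y₁))
        ≈⟨ ⊕-interchange _ _ _ _ ⟩
      (d x₀ · y₀ ⊕ k • (x₁ · y₀)) ⊕ (α x₀ · d y₀ ⊕ k • (α x₀ · y₁))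
        ≈⟨ ⊕-cong (⊕-cong ≋.refl (·-•ˡ _ _ _)) (⊕-cong ≋.refl (·-•ʳ _ _ _)) ⟨
      (d x₀ · y₀ ⊕ (k • x₁) · y₀) ⊕ (α x₀ · d y₀ ⊕ α x₀ · (k • y₁))
        ≈⟨ ⊕-cong (·-distribʳ _ _ _) (·-distribˡ _ _ _) ⟨
      (d x₀ ⊕ k • x₁) · y₀ ⊕ α x₀ · (d y₀ ⊕ k • y₁) ∎)
    (begin
      ⊖ d (x₁ · y₀ ⊕ α x₀ · y₁)
        ≈⟨ ⊖-cong (≋.trans (δ-⊕ _ _ _) (⊕-cong (δ-· _ _ _) (≋.trans (δ-· _ _ _)
             (⊕-cong ≋.refl (·-congʳ (α-involutive x₀)))))) ⟩
      ⊖ ((d x₁ · y₀ ⊕ α x₁ · d y₀) ⊕ (d (α x₀) · y₁ ⊕ x₀ · d y₁))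
        -- Contracting e₀ in `x` and contracting it in `y` each give k α(x₁) y₁, with opposite
        -- signs. The pair is introduced here to complete both products.
        ≈⟨ ⟪ (λ A → solve 6 (λ a b c' d' k e →
               :- ((a :+ b) :+ (c' :+ d')) := (:- a :+ (:- c' :+ k :* e)) :+ (:- (b :+ k :* e) :+ :- d')) refl
               ((d x₁ · y₀) A) ((α x₁ · d y₀) A) ((d (α x₀) · y₁) A) ((x₀ · d y₁) A) k ((α x₁ · y₁) A)) ⟫ ⟩
      (⊖ (d x₁ · y₀) ⊕ (⊖ (d (α x₀) · y₁) ⊕ k • (α x₁ · y₁))) ⊕ (⊖ (α x₁ · d y₀ ⊕ k • (α x₁ · y₁)) ⊕ ⊖ (x₀ · d y₁))
        ≈⟨ ⊕-cong (⊕-cong (·-⊖ˡ _ _) (≋.trans (·-distribʳ _ _ _) (⊕-cong (·-⊖ˡ _ _) (·-•ˡ _ _ _))))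
                  (⊕-cong (≋.trans (·-⊖ˡ _ _) (⊖-cong (≋.trans (·-distribˡ _ _ _) (⊕-cong ≋.refl (·-•ʳ _ _ _))))) (·-⊖ʳ _ _)) ⟨
      ((⊖ d x₁) · y₀ ⊕ (⊖ d (α x₀) ⊕ k • α x₁) · y₁) ⊕ ((⊖ α x₁) · (d y₀ ⊕ k • y₁) ⊕ x₀ · (⊖ d y₁))
        ≈⟨ ⊕-cong (⊕-cong ≋.refl (·-congʳ (≋.trans (α-⊕ _ _) (⊕-cong (α-δ _ x₀) (α-• _ _)))))
                  (⊕-cong ≋.refl (·-congʳ (α-involutive x₀))) ⟨
      ((⊖ d x₁) · y₀ ⊕ α (d x₀ ⊕ k • x₁) · y₁) ⊕ ((⊖ α x₁) · (d y₀ ⊕ k • y₁) ⊕ α (α x₀) · (⊖ d y₁)) ∎)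
    where
    d = δ (c ∘ suc) ; k = c zero
    x₀ = lo x ; x₁ = hi x ; y₀ = lo y ; y₁ = hi y

  -- Two generators can be removed in either order, and the two orders have opposite signs.
  δ-δ : ∀ {n} (c : Fin n → 𝕜) x → δ c (δ c x) ≋ 0E
  δ-δ {zero}  c x = ⟪ (λ { [] → refl }) ⟫
  δ-δ {suc n} c x = ≋-split
    (begin
      d (d x₀ ⊕ k • x₁) ⊕ k • (⊖ d x₁)          ≈⟨ ⊕-cong (≋.trans (δ-⊕ _ _ _) (⊕-cong (δ-δ _ x₀) (δ-• _ _ _))) ≋.refl ⟩
      (0E ⊕ k • d x₁) ⊕ k • (⊖ d x₁)            ≈⟨ ⟪ (λ A → solve 2 (λ k e → (:0 :+ k :* e) :+ k :* (:- e) := :0) refl k (d x₁ A)) ⟫ ⟩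
      0E                                        ∎)
    (begin
      ⊖ d (⊖ d x₁)      ≈⟨ ⊖-cong (≋.trans (δ-⊖ _ _) (⊖-cong (δ-δ _ x₁))) ⟩
      ⊖ ⊖ 0E            ≈⟨ ⊖-involutive _ ⟩
      0E                ∎)
    where d = δ (c ∘ suc) ; k = c zero ; x₀ = lo x ; x₁ = hi x

  -- Both sides obey the same twisted Leibniz rule and agree on generators. For the constant form 1
  -- it says that ∂ commutes with every `push`; for an indicator form it localises the derivation to
  -- one summand.
  δ-push : ∀ {n k} (c : Fin k → 𝕜) (g : Fin n → Fin k) x → δ c (push g x) ≋ push g (δ (c ∘ g) x)
  δ-push {zero}  c g x = ≋.trans (δ-• c _ _) (≋.trans (•-cong refl (δ-1 c)) (≋.trans (•0 _) (≋.sym (0• _))))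
  δ-push {suc n} c g x = begin
    δ c (f x₀ ⊕ e · f x₁)
      ≈⟨ ≋.trans (δ-⊕ _ _ _) (⊕-cong ≋.refl (δ-· _ _ _)) ⟩
    δ c (f x₀) ⊕ (δ c e · f x₁ ⊕ α e · δ c (f x₁))
      ≈⟨ ⊕-cong ≋.refl (⊕-cong (≋.trans (·-congʳ (δ-gen c (g zero))) (≋.trans (·-•ˡ _ _ _) (•-cong refl (·-identityˡ _))))
           (≋.trans (·-congʳ (α-gen (g zero))) (≋.trans (·-⊖ˡ _ _) (≋.sym (·-⊖ʳ _ _))))) ⟩
    δ c (f x₀) ⊕ (k • f x₁ ⊕ e · (⊖ δ c (f x₁)))
      ≈⟨ ⊕-assoc _ _ _ ⟨
    δ c (f x₀) ⊕ k • f x₁ ⊕ e · (⊖ δ c (f x₁))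
      ≈⟨ ⊕-cong (⊕-cong (δ-push c (g ∘ suc) _) (≋.sym (push-• (g ∘ suc) _ _))) (·-congˡ (≋.trans (⊖-cong (δ-push c (g ∘ suc) _)) (≋.sym (push-⊖ (g ∘ suc) _)))) ⟩
    f (d x₀) ⊕ f (k • x₁) ⊕ e · f (⊖ d x₁)
      ≈⟨ ⊕-cong (push-⊕ (g ∘ suc) _ _) ≋.refl ⟨
    f (d x₀ ⊕ k • x₁) ⊕ e · f (⊖ d x₁) ∎
    where
    f = push (g ∘ suc) ; e = gen (g zero) ; d = δ (c ∘ g ∘ suc) ; k = c (g zero)
    x₀ = lo x ; x₁ = hi x

  δ-zero : ∀ {n} (c : Fin n → 𝕜) → (∀ s → c s ≈ 0#) → ∀ x → δ c x ≋ 0E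
  δ-zero {zero}  c p x = ⟪ (λ { [] → refl }) ⟫
  δ-zero {suc n} c p x = ≋-split
    (≋.trans (⊕-cong (δ-zero _ (p ∘ suc) _) (≋.trans (•-cong (p zero) ≋.refl) (0• _))) (⊕-identityʳ _))
    (≋.trans (⊖-cong (δ-zero _ (p ∘ suc) _)) ⊖0)

  δ-ext : ∀ {n} {c c' : Fin n → 𝕜} → (∀ s → c s ≈ c' s) → ∀ x → δ c x ≋ δ c' x
  δ-ext {zero}  p x = ⟪ (λ { [] → refl }) ⟫
  δ-ext {suc n} p x = ≋-split
    (⊕-cong (δ-ext (p ∘ suc) (lo x)) (•-cong (p zero) ≋.refl))
    (⊖-cong (δ-ext (p ∘ suc) (hi x)))

-- Agreement of the recursive operations with those of the statement.

module Linking {c ℓ} (K : Field c ℓ) where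
  open Field K hiding (zero) renaming (Carrier to 𝕜)
  open Algebra.Properties.Ring ring using (-‿distribˡ-*)
  open OS K using (E; 0E; 1E; basis; gen; sign; sumE; prodE; eSet; mulBasis; _*E_; ∂; ∂L; Emap)
    renaming (_+E_ to infixl 6 _⊕_; -E_ to infix 8 ⊖_; _•_ to infixr 7 _•_)
  open Exterior K
  open Derivations K
  open ≋-Reasoning

  sumE-cong : ∀ {a} {I : Set a} {n} {F G : I → E n} (is : List I) → (∀ i → F i ≋ G i) →
              sumE (map F is) ≋ sumE (map G is)
  sumE-cong []       p = ≋.refl
  sumE-cong (i ∷ is) p = ⊕-cong (p i) (sumE-cong is p)

  record IsLinear {n k} (L : E n → E k) : Set (c ⊔ ℓ) where
    field
      congruent : ∀ {x y} → x ≋ y → L x ≋ L y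
      additive  : ∀ x y → L (x ⊕ y) ≋ L x ⊕ L y
      scalable  : ∀ a x → L (a • x) ≋ a • L x

    preserves-0 : L 0E ≋ 0E
    preserves-0 = ≋.trans (congruent (≋.sym (0• 0E))) (≋.trans (scalable 0# 0E) (0• _))

    preserves-⊖ : ∀ x → L (⊖ x) ≋ ⊖ L x
    preserves-⊖ x = ≋.trans (congruent (⊖≋-1• x)) (≋.trans (scalable _ x) (≋.sym (⊖≋-1• _)))

    preserves-sumE : ∀ {a} {I : Set a} (F : I → E n) is → L (sumE (map F is)) ≋ sumE (map (L ∘ F) is)
    preserves-sumE F []       = preserves-0
    preserves-sumE F (i ∷ is) = ≋.trans (additive _ _) (⊕-cong ≋.refl (preserves-sumE F is))

  open IsLinear public

  ·ʳ-linear : ∀ {n} (z : E n) → IsLinear (z ·_)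
  ·ʳ-linear z = record { congruent = ·-congˡ ; additive = ·-distribˡ z ; scalable = λ a x → ·-•ʳ a z x }

  ·ˡ-linear : ∀ {n} (z : E n) → IsLinear (_· z)
  ·ˡ-linear z = record { congruent = ·-congʳ ; additive = λ x y → ·-distribʳ x y z ; scalable = λ a x → ·-•ˡ a x z }

  push-linear : ∀ {n k} (g : Fin n → Fin k) → IsLinear (push g)
  push-linear g = record { congruent = push-cong g ; additive = push-⊕ g ; scalable = push-• g }

  δ-linear : ∀ {n} (c : Fin n → 𝕜) → IsLinear (δ c)
  δ-linear c = record { congruent = δ-cong c ; additive = δ-⊕ c ; scalable = δ-• c }

  lo-linear : ∀ {n} → IsLinear (lo {n})
  lo-linear = record { congruent = lo-cong ; additive = λ _ _ → ≋.refl ; scalable = λ _ _ → ≋.refl }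

  hi-linear : ∀ {n} → IsLinear (hi {n})
  hi-linear = record { congruent = hi-cong ; additive = λ _ _ → ≋.refl ; scalable = λ _ _ → ≋.refl }

  -- The shape in which `∂` and `Emap` are defined: values on monomials, extended linearly.
  extend : ∀ {n k} → (Subset n → E k) → E n → E k
  extend {n} F x = sumE (map (λ A → x A • F A) (allSub n))

  extend-cong : ∀ {n k} {F G : Subset n → E k} → (∀ A → F A ≋ G A) → ∀ x → extend F x ≋ extend G x
  extend-cong p x = sumE-cong (allSub _) (λ A → •-cong refl (p A))

  sumE-++ : ∀ {n} (xs ys : List (E n)) → sumE (xs ++ ys) ≋ sumE xs ⊕ sumE ys
  sumE-++ []       ys = ≋.sym (⊕-identityˡ _)
  sumE-++ (x ∷ xs) ys = ≋.trans (⊕-cong ≋.refl (sumE-++ xs ys)) (≋.sym (⊕-assoc _ _ _))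

  sumE-allSub : ∀ {n k} (F : Subset (suc n) → E k) →
    sumE (map F (allSub (suc n))) ≋
    sumE (map (F ∘ (false ∷_)) (allSub n)) ⊕ sumE (map (F ∘ (true ∷_)) (allSub n))
  sumE-allSub {n} F = begin
    sumE (map F (map (false ∷_) (allSub n) ++ map (true ∷_) (allSub n)))
      ≈⟨ ≋.reflexive (≡.cong sumE (map-++ F (map (false ∷_) (allSub n)) _)) ⟩
    sumE (map F (map (false ∷_) (allSub n)) ++ map F (map (true ∷_) (allSub n)))
      ≈⟨ sumE-++ (map F (map (false ∷_) (allSub n))) _ ⟩
    sumE (map F (map (false ∷_) (allSub n))) ⊕ sumE (map F (map (true ∷_) (allSub n)))
      ≈⟨ ⊕-cong (≋.reflexive (≡.cong sumE (map-∘ (allSub n)))) (≋.reflexive (≡.cong sumE (map-∘ (allSub n)))) ⟨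
    sumE (map (F ∘ (false ∷_)) (allSub n)) ⊕ sumE (map (F ∘ (true ∷_)) (allSub n)) ∎

  extend-basis : ∀ {n} (x : E n) → extend basis x ≋ x
  extend-basis {zero}  x = ⟪ (λ { [] → trans (+-identityʳ _) (*-identityʳ _) }) ⟫
  extend-basis {suc n} x = ≋.trans (sumE-allSub F) (≋-split
    (≋.trans (⊕-cong
      (≋.trans (preserves-sumE lo-linear F₀ (allSub n)) (extend-basis (lo x)))
      (≋.trans (preserves-sumE lo-linear F₁ (allSub n)) (vanish (hi x) (allSub n)))) (⊕-identityʳ _))
    (≋.trans (⊕-cong
      (≋.trans (preserves-sumE hi-linear F₀ (allSub n)) (vanish (lo x) (allSub n)))
      (≋.trans (preserves-sumE hi-linear F₁ (allSub n)) (extend-basis (hi x)))) (⊕-identityˡ _)))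
    where
    F : Subset (suc n) → E (suc n)
    F A = x A • basis A
    F₀ = F ∘ (false ∷_)
    F₁ = F ∘ (true ∷_)
    vanish : ∀ (y : E n) As → sumE (map (λ A → y A • 0E {n}) As) ≋ 0E
    vanish y []       = ≋.refl
    vanish y (A ∷ As) = ≋.trans (⊕-cong (•0 _) (vanish y As)) (⊕-identityˡ _)

  -- A linear map is determined by its values on monomials, so identifying an operator of the
  -- statement with a recursive one reduces to the case of `basis A`.
  extend-unique : ∀ {n k} {L : E n → E k} → IsLinear L → ∀ {F : Subset n → E k} →
                  (∀ A → F A ≋ L (basis A)) → ∀ x → extend F x ≋ L x
  extend-unique {n} {L = L} lin {F} p x = begin
    extend F x                                     ≈⟨ extend-cong p x ⟩
    sumE (map (λ A → x A • L (basis A)) (allSub n))  ≈⟨ sumE-cong (allSub n) (λ A → scalable lin _ _) ⟨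
    sumE (map (λ A → L (x A • basis A)) (allSub n))  ≈⟨ preserves-sumE lin _ (allSub n) ⟨
    L (extend basis x)                             ≈⟨ congruent lin (extend-basis x) ⟩
    L x                                            ∎

  sign-+ : ∀ a b → sign (a +ℕ b) ≈ sign a * sign b
  sign-+ zero    b = sym (*-identityˡ _)
  sign-+ (suc a) b = trans (-‿cong (sign-+ a b)) (-‿distribˡ-* _ _)

  α-basis : ∀ {n} (A : Subset n) → α (basis A) ≋ sign ∣ A ∣ • basis A
  α-basis []          = ⟪ (λ { [] → sym (*-identityˡ _) }) ⟫
  α-basis (false ∷ A) = ≋-split (α-basis A) (≋.trans (⊖-cong α-0) (≋.trans ⊖0 (≋.sym (•0 _))))
  α-basis (true ∷ A)  = ≋-split (≋.trans α-0 (≋.sym (•0 _)))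
    (≋.trans (⊖-cong (α-basis A)) ⟪ (λ B → -‿distribˡ-* _ _) ⟫)

  -- If e₀ occurs only in the second factor, it moves to the front past all of e_A. The `∣ A ∣`
  -- inversions counted there are exactly the sign that `α` puts on e_A. If it occurs in both, both
  -- sides vanish.
  mulBasis-· : ∀ {n} (A B : Subset n) → mulBasis A B ≋ basis A · basis B
  mulBasis-· [] [] = ⟪ (λ { [] → refl }) ⟫
  mulBasis-· (false ∷ A) (false ∷ B) = ≋-split
    (≋.trans (lo-mul A B) (mulBasis-· A B))
    (≋.trans (hi-mul A B) (≋.sym (≋.trans (⊕-cong (·-zeroˡ _) (·-zeroʳ _)) (⊕-identityʳ _))))
    where
    lo-mul : ∀ {n} (A B : Subset n) → lo (mulBasis (false ∷ A) (false ∷ B)) ≋ mulBasis A B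
    lo-mul A B with disjointᵇ A B
    ... | true  = ≋.refl
    ... | false = ≋.refl
    hi-mul : ∀ {n} (A B : Subset n) → hi (mulBasis (false ∷ A) (false ∷ B)) ≋ 0E
    hi-mul A B with disjointᵇ A B
    ... | true  = •0 _
    ... | false = ≋.refl
  mulBasis-· (false ∷ A) (true ∷ B) = ≋-split
    (≋.trans (lo-mul A B) (≋.sym (·-zeroʳ _)))
    (begin
      hi (mulBasis (false ∷ A) (true ∷ B))              ≈⟨ hi-mul A B ⟩
      sign ∣ A ∣ • mulBasis A B                         ≈⟨ •-cong refl (mulBasis-· A B) ⟩
      sign ∣ A ∣ • (basis A · basis B)                  ≈⟨ ·-•ˡ _ _ _ ⟨
      (sign ∣ A ∣ • basis A) · basis B                  ≈⟨ ·-congʳ (α-basis A) ⟨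
      α (basis A) · basis B                             ≈⟨ ⊕-identityˡ _ ⟨
      0E ⊕ α (basis A) · basis B                        ≈⟨ ⊕-cong (·-zeroˡ _) ≋.refl ⟨
      0E · 0E ⊕ α (basis A) · basis B                   ∎)
    where
    lo-mul : ∀ {n} (A B : Subset n) → lo (mulBasis (false ∷ A) (true ∷ B)) ≋ 0E
    lo-mul A B with disjointᵇ A B
    ... | true  = •0 _
    ... | false = ≋.refl
    hi-mul : ∀ {n} (A B : Subset n) → hi (mulBasis (false ∷ A) (true ∷ B)) ≋ sign ∣ A ∣ • mulBasis A B
    hi-mul A B with disjointᵇ A B
    ... | true  = ≋.trans (•-cong (sign-+ ∣ A ∣ (inversions A B)) ≋.refl) (≋.sym (•-assoc _ _ _))
    ... | false = ≋.sym (•0 _)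
  mulBasis-· (true ∷ A) (false ∷ B) = ≋-split
    (≋.trans (lo-mul A B) (≋.sym (·-zeroˡ _)))
    (≋.trans (hi-mul A B) (≋.trans (mulBasis-· A B)
      (≋.sym (≋.trans (⊕-cong ≋.refl (·-zeroʳ _)) (⊕-identityʳ _)))))
    where
    lo-mul : ∀ {n} (A B : Subset n) → lo (mulBasis (true ∷ A) (false ∷ B)) ≋ 0E
    lo-mul A B with disjointᵇ A B
    ... | true  = •0 _
    ... | false = ≋.refl
    hi-mul : ∀ {n} (A B : Subset n) → hi (mulBasis (true ∷ A) (false ∷ B)) ≋ mulBasis A B
    hi-mul A B with disjointᵇ A B
    ... | true  = ≋.refl
    ... | false = ≋.refl
  mulBasis-· (true ∷ A) (true ∷ B) = ≋-split
    (≋.sym (·-zeroˡ _))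
    (≋.sym (≋.trans (⊕-cong (·-zeroʳ _) (≋.trans (·-congʳ α-0) (·-zeroˡ _))) (⊕-identityˡ _)))

  *E≋· : ∀ {n} (x y : E n) → x *E y ≋ x · y
  *E≋· {n} x y = begin
    sumE (map (λ A → sumE (map (λ B → (x A * y B) • mulBasis A B) (allSub n))) (allSub n))
      ≈⟨ sumE-cong (allSub n) (λ A → sumE-cong (allSub n) (λ B →
           ≋.trans (≋.sym (•-assoc _ _ _)) (≋.trans (•-cong refl (•-cong refl (mulBasis-· A B))) (≋.sym (≋.trans (·-•ˡ _ _ _) (•-cong refl (·-•ʳ _ _ _))))))) ⟩
    sumE (map (λ A → sumE (map (λ B → (x A • basis A) · (y B • basis B)) (allSub n))) (allSub n))
      ≈⟨ sumE-cong (allSub n) (λ A → preserves-sumE (·ʳ-linear _) _ (allSub n)) ⟨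
    sumE (map (λ A → (x A • basis A) · extend basis y) (allSub n))
      ≈⟨ preserves-sumE (·ˡ-linear _) _ (allSub n) ⟨
    extend basis x · extend basis y
      ≈⟨ ·-cong (extend-basis x) (extend-basis y) ⟩
    x · y ∎

  prodE-gen : ∀ {n k} (g : Fin n → Fin k) (A : Subset n) →
              prodE (map (gen ∘ g) (elems A)) ≋ push g (basis A)
  prodE-gen g []          = ≋.sym (1• 1E)
  prodE-gen g (false ∷ A) = begin
    prodE (map (gen ∘ g) (map suc (elems A)))         ≈⟨ ≋.reflexive (≡.cong prodE (map-∘ (elems A))) ⟨
    prodE (map (gen ∘ g ∘ suc) (elems A))             ≈⟨ prodE-gen (g ∘ suc) A ⟩
    push (g ∘ suc) (basis A)                          ≈⟨ ⊕-identityʳ _ ⟨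
    push (g ∘ suc) (basis A) ⊕ 0E                     ≈⟨ ⊕-cong ≋.refl (≋.trans (·-congˡ (push-0 (g ∘ suc))) (·-zeroʳ _)) ⟨
    push g (basis (false ∷ A))                        ∎
  prodE-gen g (true ∷ A) = begin
    gen (g zero) *E prodE (map (gen ∘ g) (map suc (elems A)))   ≈⟨ *E≋· _ _ ⟩
    gen (g zero) · prodE (map (gen ∘ g) (map suc (elems A)))    ≈⟨ ·-congˡ (≋.reflexive (≡.cong prodE (map-∘ (elems A)))) ⟨
    gen (g zero) · prodE (map (gen ∘ g ∘ suc) (elems A))        ≈⟨ ·-congˡ (prodE-gen (g ∘ suc) A) ⟩
    gen (g zero) · push (g ∘ suc) (basis A)                     ≈⟨ ⊕-identityˡ _ ⟨
    0E ⊕ gen (g zero) · push (g ∘ suc) (basis A)                ≈⟨ ⊕-cong (push-0 (g ∘ suc)) ≋.refl ⟨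
    push g (basis (true ∷ A))                                   ∎

  Emap≋push : ∀ {n k} (g : Fin n → Fin k) x → Emap g x ≋ push g x
  Emap≋push g x = extend-unique (push-linear g) (prodE-gen g) x

  eSet≋basis : ∀ {n} (A : Subset n) → eSet A ≋ basis A
  eSet≋basis A = ≋.trans (prodE-gen id A) (push-id (basis A))

  δ₁ : ∀ {n} → E n → E n
  δ₁ = δ (λ _ → 1#)

  ∂L≋δ₁ : ∀ {n} (ss : List (Fin n)) → ∂L ss ≋ δ₁ (prodE (map gen ss))
  ∂L≋δ₁ []       = ≋.sym (δ-1 _)
  ∂L≋δ₁ (s ∷ ss) = begin
    p ⊕ ⊖ (gen s *E ∂L ss)             ≈⟨ ⊕-cong ≋.refl (⊖-cong (≋.trans (*E≋· _ _) (·-congˡ (∂L≋δ₁ ss)))) ⟩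
    p ⊕ ⊖ (gen s · δ₁ p)               ≈⟨ ⊕-cong (≋.sym (≋.trans (·-congʳ (≋.trans (δ-gen _ s) (1• _))) (·-identityˡ p)))
                                            (≋.sym (≋.trans (·-congʳ (α-gen s)) (·-⊖ˡ _ _))) ⟩
    δ₁ (gen s) · p ⊕ α (gen s) · δ₁ p  ≈⟨ δ-· _ _ _ ⟨
    δ₁ (gen s · p)                     ≈⟨ δ-cong _ (*E≋· _ _) ⟨
    δ₁ (gen s *E p)                    ∎
    where p = prodE (map gen ss)

  ∂≋δ₁ : ∀ {n} (x : E n) → ∂ x ≋ δ₁ x
  ∂≋δ₁ x = extend-unique (δ-linear _) (λ A → ≋.trans (∂L≋δ₁ (elems A)) (δ-cong _ (eSet≋basis A))) x

-- Stability of the Orlik-Solomon ideal.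

module Ideals {c ℓ} (K : Field c ℓ) where
  open Field K hiding (zero)
  open OS K using (E; 0E; 1E; basis; InI; gen∈; 0∈; +∈; *∈ˡ; *∈ʳ; ≈∈; _≈A[_]_)
    renaming (_+E_ to infixl 6 _⊕_; -E_ to infix 8 ⊖_; _•_ to infixr 7 _•_)
  open IntegerCoefficientSolver commutativeRing using (solve; _:=_; _:+_; _:*_; :-_; _:-_)
  open Exterior K
  open Derivations K
  open Linking K
  open ≋-Reasoning

  module Ideal {n} (Circ : Subset n → Set) where

    I-resp : ∀ {x y} → x ≋ y → InI Circ x → InI Circ y
    I-resp p = ≈∈ (at p)

    I-·ˡ : ∀ {x} a → InI Circ x → InI Circ (a · x)
    I-·ˡ a i = I-resp (*E≋· a _) (*∈ˡ a i)

    I-·ʳ : ∀ {x} a → InI Circ x → InI Circ (x · a)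
    I-·ʳ a i = I-resp (*E≋· _ a) (*∈ʳ i a)

    I-• : ∀ {x} k → InI Circ x → InI Circ (k • x)
    I-• k i = I-resp (≋.trans (·-•ˡ k 1E _) (•-cong refl (·-identityˡ _))) (I-·ˡ (k • 1E) i)

    I-⊖ : ∀ {x} → InI Circ x → InI Circ (⊖ x)
    I-⊖ i = I-resp (≋.sym (⊖≋-1• _)) (I-• (- 1#) i)

    I-gen : ∀ {C} → Circ C → InI Circ (δ₁ (basis C))
    I-gen {C} i = I-resp (≋.trans (∂≋δ₁ _) (δ-cong _ (eSet≋basis C))) (gen∈ i)

    -- Induction on membership, phrased through `≋`, `·` and `δ₁`. The multiplication cases also
    -- supply the membership itself, which the Leibniz rule needs for the term where the cofactor is
    -- differentiated.
    I-rec : ∀ {p} (P : E n → Set p) →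
            (∀ {x y} → x ≋ y → P x → P y) →
            P 0E →
            (∀ {x y} → P x → P y → P (x ⊕ y)) →
            (∀ {x} a → InI Circ x → P x → P (a · x)) →
            (∀ {x} a → InI Circ x → P x → P (x · a)) →
            (∀ {C} → Circ C → P (δ₁ (basis C))) →
            ∀ {x} → InI Circ x → P x
    I-rec P resp z add mulˡ mulʳ gens = go
      where
      go : ∀ {x} → InI Circ x → P x
      go (gen∈ {C} i) = resp (≋.sym (≋.trans (∂≋δ₁ _) (δ-cong _ (eSet≋basis C)))) (gens i)
      go 0∈           = z
      go (+∈ i j)     = add (go i) (go j)
      go (*∈ˡ a i)    = resp (≋.sym (*E≋· a _)) (mulˡ a i (go i))
      go (*∈ʳ i a)    = resp (≋.sym (*E≋· _ a)) (mulʳ a i (go i))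
      go (≈∈ p i)     = resp ⟪ p ⟫ (go i)

    -- The ideal is graded: each generator ∂ e_C is homogeneous, so `α` only multiplies it by a
    -- sign.
    I-α : ∀ {x} → InI Circ x → InI Circ (α x)
    I-α = I-rec (InI Circ ∘ α)
      (λ p → I-resp (α-cong p))
      (I-resp (≋.sym α-0) 0∈)
      (λ i j → I-resp (≋.sym (α-⊕ _ _)) (+∈ i j))
      (λ a _ i → I-resp (≋.sym (α-· a _)) (I-·ˡ (α a) i))
      (λ a _ i → I-resp (≋.sym (α-· _ a)) (I-·ʳ (α a) i))
      (λ {C} i → I-resp (≋.sym (≋.trans (α-δ _ (basis C)) (⊖-cong (≋.trans (δ-cong _ (α-basis C)) (δ-• _ _ _)))))
        (I-⊖ (I-• _ (I-gen i))))

    -- By the Leibniz rule a derivation preserves the ideal as soon as it sends the generators into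
    -- it. Right multiples also require stability under `α`, which twists the left factor.
    I-δ : ∀ c → (∀ {C} → Circ C → InI Circ (δ c (δ₁ (basis C)))) → ∀ {x} → InI Circ x → InI Circ (δ c x)
    I-δ c = I-rec (InI Circ ∘ δ c)
      (λ p → I-resp (δ-cong c p))
      (I-resp (≋.sym (δ-0 c)) 0∈)
      (λ i j → I-resp (≋.sym (δ-⊕ c _ _)) (+∈ i j))
      (λ a i j → I-resp (≋.sym (δ-· c a _)) (+∈ (I-·ˡ (δ c a) i) (I-·ˡ (α a) j)))
      (λ a i j → I-resp (≋.sym (δ-· c _ a)) (+∈ (I-·ʳ a j) (I-·ʳ (δ c a) (I-α i))))

    -- Each generator is itself a value of ∂, and ∂ squares to zero.
    I-δ₁ : ∀ {x} → InI Circ x → InI Circ (δ₁ x)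
    I-δ₁ = I-δ _ (λ {C} _ → I-resp (≋.sym (δ-δ _ (basis C))) 0∈)

    ≋⇒≈A : ∀ {x y} → x ≋ y → x ≈A[ Circ ] y
    ≋⇒≈A {x} {y} p = I-resp (≋.trans (≋.sym (⊕-inverseʳ x)) (⊕-cong ≋.refl (⊖-cong p))) 0∈

    ≈A-trans : ∀ {x y z} → x ≈A[ Circ ] y → y ≈A[ Circ ] z → x ≈A[ Circ ] z
    ≈A-trans {x} {y} {z} i j = I-resp
      ⟪ (λ A → solve 3 (λ x y z → (x :- y) :+ (y :- z) := x :- z) refl (x A) (y A) (z A)) ⟫ (+∈ i j)

    ≈A-⊕ : ∀ {x x' y y'} → x ≈A[ Circ ] x' → y ≈A[ Circ ] y' → (x ⊕ y) ≈A[ Circ ] (x' ⊕ y')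
    ≈A-⊕ {x} {x'} {y} {y'} i j = I-resp
      ⟪ (λ A → solve 4 (λ x x' y y' → (x :- x') :+ (y :- y') := (x :+ y) :- (x' :+ y')) refl
           (x A) (x' A) (y A) (y' A)) ⟫ (+∈ i j)

    ≈A-linear : ∀ {k} {L : E k → E n} → IsLinear L → ∀ {x y} → InI Circ (L (x ⊕ ⊖ y)) → L x ≈A[ Circ ] L y
    ≈A-linear {L = L} lin {x} {y} = I-resp (begin
      L (x ⊕ ⊖ y)              ≈⟨ IsLinear.additive lin x (⊖ y) ⟩
      L x ⊕ L (⊖ y)            ≈⟨ ⊕-cong ≋.refl (preserves-⊖ lin y) ⟩
      L x ⊕ ⊖ L y              ∎)

    ≈A-• : ∀ k {x y} → x ≈A[ Circ ] y → (k • x) ≈A[ Circ ] (k • y)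
    ≈A-• k {x} {y} i = I-resp
      ⟪ (λ A → solve 3 (λ k x y → k :* (x :- y) := k :* x :- k :* y) refl k (x A) (y A)) ⟫ (I-• k i)

    ≈A-·ʳ : ∀ z {x y} → x ≈A[ Circ ] y → (x · z) ≈A[ Circ ] (y · z)
    ≈A-·ʳ z i = ≈A-linear (·ˡ-linear z) (I-·ʳ z i)

    ≈A0⇒I : ∀ {x} → x ≈A[ Circ ] 0E → InI Circ x
    ≈A0⇒I {x} = I-resp (≋.trans (⊕-cong ≋.refl ⊖0) (⊕-identityʳ x))

    I⇒≈A0 : ∀ {x} → InI Circ x → x ≈A[ Circ ] 0E
    I⇒≈A0 {x} = I-resp (≋.sym (≋.trans (⊕-cong ≋.refl ⊖0) (⊕-identityʳ x)))

  module _ {n k} {Circ : Subset n → Set} {Circ' : Subset k → Set} where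
    open Ideal

    I-push : ∀ (g : Fin n → Fin k) → (∀ {C} → Circ C → InI Circ' (push g (δ₁ (basis C)))) →
             ∀ {x} → InI Circ x → InI Circ' (push g x)
    I-push g = I-rec Circ (InI Circ' ∘ push g)
      (λ p → I-resp Circ' (push-cong g p))
      (I-resp Circ' (≋.sym (push-0 g)) 0∈)
      (λ i j → I-resp Circ' (≋.sym (push-⊕ g _ _)) (+∈ i j))
      (λ a _ i → I-resp Circ' (≋.sym (push-· g a _)) (I-·ˡ Circ' (push g a) i))
      (λ a _ i → I-resp Circ' (≋.sym (push-· g _ a)) (I-·ʳ Circ' (push g a) i))

-- Subsets of glued and disjoint ground sets.

-- The statement specifies circuits of `D` and `P` only through their members. This turns such a
-- description into equality with an explicit bit vector, whose monomial can be computed.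
subset-ext : ∀ {p n} {Q : Fin n → Set p} {A B : Subset n} →
             (∀ y → (y ∈ A) ⇔ Q y) → (∀ y → (y ∈ B) ⇔ Q y) → A ≡ B
subset-ext a b = ⊆-antisym (λ {y} i → from (b y) (to (a y) i)) (λ {y} i → from (a y) (to (b y) i))

∈-++⁺ˡ : ∀ {m n x} {A : Subset m} (B : Subset n) → x ∈ A → (x ↑ˡ n) ∈ (A Vec.++ B)
∈-++⁺ˡ B here      = here
∈-++⁺ˡ B (there i) = there (∈-++⁺ˡ B i)

∈-++⁺ʳ : ∀ {m n x} (A : Subset m) {B : Subset n} → x ∈ B → (m ↑ʳ x) ∈ (A Vec.++ B)
∈-++⁺ʳ []      i = i
∈-++⁺ʳ (_ ∷ A) i = there (∈-++⁺ʳ A i)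

∈-++⁻ : ∀ {m n y} (A : Subset m) {B : Subset n} → y ∈ (A Vec.++ B) →
        (∃[ x ] (x ∈ A × x ↑ˡ n ≡ y)) ⊎ (∃[ x ] (x ∈ B × m ↑ʳ x ≡ y))
∈-++⁻ []      i    = inj₂ (_ , i , ≡.refl)
∈-++⁻ (_ ∷ A) here = inj₁ (zero , here , ≡.refl)
∈-++⁻ (_ ∷ A) (there i) with ∈-++⁻ A i
... | inj₁ (x , j , e) = inj₁ (suc x , there j , ≡.cong suc e)
... | inj₂ (x , j , e) = inj₂ (x , j , ≡.cong suc e)

image-↑ˡ : ∀ {m} n (A : Subset m) → IsImage (_↑ˡ n) A (A Vec.++ ⊥)
image-↑ˡ n A y = mk⇔
  (λ i → [ id , (λ { (_ , j , _) → ⊥-elim (∉⊥ j) }) ]′ (∈-++⁻ A i))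
  (λ { (x , i , ≡.refl) → ∈-++⁺ˡ ⊥ i })

image-↑ʳ : ∀ m {n} (B : Subset n) → IsImage (m ↑ʳ_) B (⊥ Vec.++ B)
image-↑ʳ m B y = mk⇔
  (λ i → [ (λ { (_ , j , _) → ⊥-elim (∉⊥ j) }) , id ]′ (∈-++⁻ (⊥ {m}) i))
  (λ { (x , i , ≡.refl) → ∈-++⁺ʳ ⊥ i })

image-ι₂ : ∀ m {n} b (B : Subset n) → IsImage (ι₂ m n) (b ∷ B) (b ∷ (⊥ Vec.++ B))
image-ι₂ m b B zero = mk⇔ (λ { here → zero , here , ≡.refl }) (λ { (zero , here , _) → here })
image-ι₂ m b B (suc y) = mk⇔
  (λ i → let (x , j , e) = to (image-↑ʳ m B y) (drop-there i) in suc x , there j , ≡.cong suc e)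
  (λ { (suc x , there j , ≡.refl) → there (∈-++⁺ʳ ⊥ j) })

-- The membership condition for a glued circuit in `ParallelCircuit`, specialised to two circuits
-- whose first bit is known to be `true`.
InGlued : ∀ m n → Subset m → Subset n → Fin (suc (m +ℕ n)) → Set
InGlued m n X Y y = (∃[ x ] (x ∈ ((true ∷ X) ∖ zero) × ι₁ m n x ≡ y)) ⊎
                    (∃[ x ] (x ∈ ((true ∷ Y) ∖ zero) × ι₂ m n x ≡ y))

∈-glued : ∀ m n (X : Subset m) (Y : Subset n) y → (y ∈ (false ∷ (X Vec.++ Y))) ⇔ InGlued m n X Y y
∈-glued m n X Y y = mk⇔ fwd bwd
  where
  weaken : ∀ {k x} {p : Subset k} → x ∈ p → suc x ∈ ((true ∷ p) ∖ zero)
  -- Deleting `zero` leaves the tail `p ─ ⊥`, which equals `p` only propositionally; hence the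
  -- transport.
  weaken {p = p} i = there (≡.subst (_ ∈_) (≡.sym (p─⊥≡p p)) i)
  strengthen : ∀ {k x} {p : Subset k} → suc x ∈ ((true ∷ p) ∖ zero) → x ∈ p
  strengthen {p = p} i = ≡.subst (_ ∈_) (p─⊥≡p p) (drop-there i)
  fwd : ∀ {y} → y ∈ (false ∷ (X Vec.++ Y)) → InGlued m n X Y y
  fwd (there i) with ∈-++⁻ X i
  ... | inj₁ (x , j , e) = inj₁ (suc x , weaken j , ≡.cong suc e)
  ... | inj₂ (x , j , e) = inj₂ (suc x , weaken j , ≡.cong suc e)
  bwd : ∀ {y} → InGlued m n X Y y → y ∈ (false ∷ (X Vec.++ Y))
  bwd (inj₁ (zero , () , _))
  bwd (inj₁ (suc x , i , ≡.refl)) = there (∈-++⁺ˡ Y (strengthen i))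
  bwd (inj₂ (zero , () , _))
  bwd (inj₂ (suc x , i , ≡.refl)) = there (∈-++⁺ʳ X (strengthen i))

-- The graded tensor product as the exterior algebra of a disjoint union.

module Coordinates {c ℓ} (K : Field c ℓ) where
  open Field K hiding (zero)
  open OS K using (E; T; _⊗_; 0E; 1E; basis; gen; sign; sumE; sumT; 0T; _•T_; mulBasis; _*T_; _≈T_)
    renaming (_+E_ to infixl 6 _⊕_; -E_ to infix 8 ⊖_; _•_ to infixr 7 _•_; _+T_ to infixl 6 _+T_; -T_ to infix 8 -T_)
  open Exterior K
  open Derivations K
  open Linking K
  open ≋-Reasoning

  push-extend-basis : ∀ {n k} (g : Fin (suc n) → Fin (suc k)) (h : Fin n → Fin k) → g zero ≡ zero →
                      (∀ s → g (suc s) ≡ suc (h s)) → ∀ b A B → push h (basis A) ≋ basis B →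
                      push g (basis (b ∷ A)) ≋ basis (b ∷ B)
  push-extend-basis g h g0 gs false A B e = ≋-split
    (≋.trans (proj₁ (push-extend g h g0 gs (basis (false ∷ A)))) e)
    (≋.trans (proj₂ (push-extend g h g0 gs (basis (false ∷ A)))) (push-0 h))
  push-extend-basis g h g0 gs true A B e = ≋-split
    (≋.trans (proj₁ (push-extend g h g0 gs (basis (true ∷ A)))) (push-0 h))
    (≋.trans (proj₂ (push-extend g h g0 gs (basis (true ∷ A)))) e)

  push-↑ˡ-basis : ∀ {m} n (A : Subset m) → push (_↑ˡ n) (basis A) ≋ basis (A Vec.++ ⊥)
  push-↑ˡ-basis n []      = 1• 1E
  push-↑ˡ-basis n (b ∷ A) = push-extend-basis (_↑ˡ n) (_↑ˡ n) ≡.refl (λ _ → ≡.refl) b A (A Vec.++ ⊥) (push-↑ˡ-basis n A)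

  push-↑ʳ-basis : ∀ m {n} (B : Subset n) → push (m ↑ʳ_) (basis B) ≋ basis (⊥ Vec.++ B)
  push-↑ʳ-basis zero    B = push-id (basis B)
  push-↑ʳ-basis (suc m) B = ≋.trans (push-suc (m ↑ʳ_) (basis B)) (≋-split (push-↑ʳ-basis m B) ≋.refl)

  push-ι₂-basis : ∀ m {n} b (B : Subset n) → push (ι₂ m n) (basis (b ∷ B)) ≋ basis (b ∷ (⊥ Vec.++ B))
  push-ι₂-basis m b B = push-extend-basis (ι₂ m _) (m ↑ʳ_) ≡.refl (λ _ → ≡.refl) b B (⊥ {m} Vec.++ B) (push-↑ʳ-basis m B)

  -- A tensor and an element over the disjoint union are both coefficient tables indexed by pairs of
  -- subsets, so the linear isomorphism is a mere re-indexing along concatenation.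
  θ : ∀ a {b} → T a b → E (a +ℕ b)
  θ zero    t         = t []
  θ (suc a) t (x ∷ C) = θ a (λ A → t (x ∷ A)) C

  split : ∀ a {b} → E (a +ℕ b) → T a b
  split a x A B = x (A Vec.++ B)

  θ-cong : ∀ a {b} {t u : T a b} → t ≈T u → θ a t ≋ θ a u
  θ-cong zero    p = ⟪ p [] ⟫
  θ-cong (suc a) p = ≋-split (θ-cong a (λ A → p (false ∷ A))) (θ-cong a (λ A → p (true ∷ A)))

  split-θ : ∀ a {b} (t : T a b) → split a (θ a t) ≈T t
  split-θ zero    t []      B = refl
  split-θ (suc a) t (x ∷ A) B = split-θ a (λ A → t (x ∷ A)) A B

  θ-0 : ∀ a {b} → θ a (0T {a} {b}) ≋ 0E
  θ-0 zero    = ≋.refl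
  θ-0 (suc a) = ≋-split (θ-0 a) (θ-0 a)

  θ-+ : ∀ a {b} (t u : T a b) → θ a (t +T u) ≋ θ a t ⊕ θ a u
  θ-+ zero    t u = ≋.refl
  θ-+ (suc a) t u = ≋-split (θ-+ a _ _) (θ-+ a _ _)

  θ-- : ∀ a {b} (t : T a b) → θ a (-T t) ≋ ⊖ θ a t
  θ-- zero    t = ≋.refl
  θ-- (suc a) t = ≋-split (θ-- a _) (θ-- a _)

  θ-• : ∀ a {b} k (t : T a b) → θ a (k •T t) ≋ k • θ a t
  θ-• zero    k t = ≋.refl
  θ-• (suc a) k t = ≋-split (θ-• a k _) (θ-• a k _)

  -- No sign occurs, because the first block precedes the second in the order of `Fin (a +ℕ b)`.
  θ-⊗ : ∀ a {b} (x : E a) (y : E b) → θ a (x ⊗ y) ≋ push (_↑ˡ b) x · push (a ↑ʳ_) y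
  θ-⊗ zero x y = begin
    x [] • y                          ≈⟨ •-cong refl (≋.trans (·-identityˡ _) (push-id y)) ⟨
    x [] • (1E · push id y)           ≈⟨ ·-•ˡ _ _ _ ⟨
    (x [] • 1E) · push id y           ∎
  θ-⊗ (suc a) {b} x y = ≋-split
    (begin
      θ a (lo x ⊗ y)                            ≈⟨ θ-⊗ a (lo x) y ⟩
      push (_↑ˡ b) (lo x) · push (a ↑ʳ_) y      ≈⟨ ·-cong (proj₁ X) (lo-cong Y) ⟨
      lo (push (_↑ˡ b) x) · lo (push (suc a ↑ʳ_) y) ∎)
    (begin
      θ a (hi x ⊗ y)                            ≈⟨ θ-⊗ a (hi x) y ⟩
      push (_↑ˡ b) (hi x) · push (a ↑ʳ_) y      ≈⟨ ·-cong (proj₂ X) (lo-cong Y) ⟨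
      hi (push (_↑ˡ b) x) · lo (push (suc a ↑ʳ_) y)
        ≈⟨ ≋.trans (⊕-cong ≋.refl (≋.trans (·-congˡ (hi-cong Y)) (·-zeroʳ _))) (⊕-identityʳ _) ⟨
      hi (push (_↑ˡ b) x · push (suc a ↑ʳ_) y) ∎)
    where
    X = push-extend (_↑ˡ b) (_↑ˡ b) ≡.refl (λ _ → ≡.refl) x
    Y = push-suc (a ↑ʳ_) y

  θ-0⊗ : ∀ a {b} (y : E b) → θ a (0E ⊗ y) ≋ 0E
  θ-0⊗ a y = ≋.trans (θ-cong a {t = 0E ⊗ y} {u = 0T} (λ _ B → zeroˡ (y B))) (θ-0 a)

  θ-basis : ∀ {a b} (A : Subset a) (B : Subset b) → θ a (basis A ⊗ basis B) ≋ basis (A Vec.++ B)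
  θ-basis []          B = 1• (basis B)
  θ-basis (false ∷ A) B = ≋-split (θ-basis A B) (θ-0⊗ _ (basis B))
  θ-basis (true ∷ A)  B = ≋-split (θ-0⊗ _ (basis B)) (θ-basis A B)

  basis-++ : ∀ {a b} (A : Subset a) (B : Subset b) →
             basis (A Vec.++ B) ≋ push (_↑ˡ b) (basis A) · push (a ↑ʳ_) (basis B)
  basis-++ A B = ≋.trans (≋.sym (θ-basis A B)) (θ-⊗ _ (basis A) (basis B))


  push-gens : ∀ {n k} (g : Fin (suc n) → Fin k) (A : Subset n) →
              (push g (basis (false ∷ A)) ≋ push (g ∘ suc) (basis A)) ×
              (push g (basis (true ∷ A)) ≋ gen (g zero) · push (g ∘ suc) (basis A))
  push-gens g A =
    ≋.trans (⊕-cong ≋.refl (≋.trans (·-congˡ (push-0 (g ∘ suc))) (·-zeroʳ _))) (⊕-identityʳ _) ,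
    ≋.trans (⊕-cong (push-0 (g ∘ suc)) ≋.refl) (⊕-identityˡ _)

  α^ : ∀ {n} → ℕ → E n → E n
  α^ zero    x = x
  α^ (suc k) x = α (α^ k x)

  -- Each of the `∣ B ∣` generators in the monomial applies `α` once as it moves past `z`.
  push-basis-· : ∀ {n k} (g : Fin n → Fin k) (B : Subset n) z →
                 push g (basis B) · z ≋ α^ (∣ B ∣) z · push g (basis B)
  push-basis-· g [] z = begin
    (1# • 1E) · z     ≈⟨ ≋.trans (·-congʳ (1• 1E)) (·-identityˡ z) ⟩
    z                 ≈⟨ ≋.trans (·-congˡ (1• 1E)) (·-identityʳ z) ⟨
    z · (1# • 1E)     ∎
  push-basis-· g (false ∷ B) z = begin
    push g (basis (false ∷ B)) · z                  ≈⟨ ·-congʳ (proj₁ (push-gens g B)) ⟩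
    push (g ∘ suc) (basis B) · z                    ≈⟨ push-basis-· (g ∘ suc) B z ⟩
    α^ (∣ B ∣) z · push (g ∘ suc) (basis B)           ≈⟨ ·-congˡ (proj₁ (push-gens g B)) ⟨
    α^ (∣ B ∣) z · push g (basis (false ∷ B))         ∎
  push-basis-· g (true ∷ B) z = begin
    push g (basis (true ∷ B)) · z            ≈⟨ ·-congʳ (proj₂ (push-gens g B)) ⟩
    e · p · z                                ≈⟨ ·-assoc _ _ _ ⟩
    e · (p · z)                              ≈⟨ ·-congˡ (push-basis-· (g ∘ suc) B z) ⟩
    e · (α^ (∣ B ∣) z · p)                     ≈⟨ ·-assoc _ _ _ ⟨
    e · α^ (∣ B ∣) z · p                       ≈⟨ ·-congʳ (gen-· (g zero) _) ⟩
    α (α^ (∣ B ∣) z) · e · p                   ≈⟨ ·-assoc _ _ _ ⟩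
    α (α^ (∣ B ∣) z) · (e · p)                 ≈⟨ ·-congˡ (proj₂ (push-gens g B)) ⟨
    α (α^ (∣ B ∣) z) · push g (basis (true ∷ B)) ∎
    where e = gen (g zero) ; p = push (g ∘ suc) (basis B)

  -- A homomorphism induced by generators commutes with `α`, which multiplies e_C by (-1)^|C|. With
  -- `push-basis-·` this yields the Koszul sign.
  α^-push-basis : ∀ {n k} (g : Fin n → Fin k) l (C : Subset n) →
                  α^ l (push g (basis C)) ≋ sign (l *ℕ ∣ C ∣) • push g (basis C)
  α^-push-basis g zero    C = ≋.sym (1• _)
  α^-push-basis g (suc l) C = begin
    α (α^ l p)                                 ≈⟨ α-cong (α^-push-basis g l C) ⟩
    α (sign (l *ℕ ∣ C ∣) • p)                  ≈⟨ α-• _ _ ⟩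
    sign (l *ℕ ∣ C ∣) • α p                    ≈⟨ •-cong refl (≋.trans (α-push g _) (≋.trans (push-cong g (α-basis C)) (push-• g _ _))) ⟩
    sign (l *ℕ ∣ C ∣) • sign (∣ C ∣) • p         ≈⟨ •-assoc _ _ _ ⟩
    (sign (l *ℕ ∣ C ∣) * sign ∣ C ∣) • p       ≈⟨ •-cong (trans (*-comm _ _) (sym (sign-+ ∣ C ∣ (l *ℕ ∣ C ∣)))) ≋.refl ⟩
    sign (∣ C ∣ +ℕ l *ℕ ∣ C ∣) • p             ∎
    where p = push g (basis C)

  θ-sumT : ∀ {i} {I : Set i} a {b} (F : I → T a b) is → θ a (sumT (map F is)) ≋ sumE (map (θ a ∘ F) is)
  θ-sumT a F []       = θ-0 a
  θ-sumT a F (i ∷ is) = ≋.trans (θ-+ a _ _) (⊕-cong ≋.refl (θ-sumT a F is))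

  sumE-0 : ∀ {i} {I : Set i} {n} (F : I → E n) is → (∀ j → F j ≋ 0E) → sumE (map F is) ≋ 0E
  sumE-0 F []       p = ≋.refl
  sumE-0 F (i ∷ is) p = ≋.trans (⊕-cong (p i) (sumE-0 F is p)) (⊕-identityˡ _)

  θ-rows : ∀ a {b} (t : T a b) → θ a t ≋ sumE (map (λ A → θ a (basis A ⊗ t A)) (allSub a))
  θ-rows zero    t = ≋.sym (≋.trans (⊕-identityʳ _) (1• _))
  θ-rows (suc a) t = ≋.sym (≋.trans (sumE-allSub F) (≋-split
    (≋.trans (⊕-cong
      (≋.trans (preserves-sumE lo-linear F₀ (allSub a)) (≋.sym (θ-rows a t₀)))
      (≋.trans (preserves-sumE lo-linear F₁ (allSub a)) (sumE-0 _ (allSub a) (λ A → θ-0⊗ a (t₁ A))))) (⊕-identityʳ _))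
    (≋.trans (⊕-cong
      (≋.trans (preserves-sumE hi-linear F₀ (allSub a)) (sumE-0 _ (allSub a) (λ A → θ-0⊗ a (t₀ A))))
      (≋.trans (preserves-sumE hi-linear F₁ (allSub a)) (≋.sym (θ-rows a t₁)))) (⊕-identityˡ _))))
    where
    F : Subset (suc a) → E _
    F A = θ (suc a) (basis A ⊗ t A)
    F₀ = F ∘ (false ∷_)
    F₁ = F ∘ (true ∷_)
    t₀ = λ A → t (false ∷ A)
    t₁ = λ A → t (true ∷ A)

  module _ {a b : ℕ} where
    private
      j₁ : E a → E (a +ℕ b)
      j₁ = push (_↑ˡ b)
      j₂ : E b → E (a +ℕ b)
      j₂ = push (a ↑ʳ_)

    monomial : Subset a → Subset b → E (a +ℕ b)
    monomial A B = j₁ (basis A) · j₂ (basis B)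

    θ-monomials : ∀ t → θ a t ≋ sumE (map (λ A → sumE (map (λ B → t A B • monomial A B) (allSub b))) (allSub a))
    θ-monomials t = ≋.trans (θ-rows a t) (sumE-cong (allSub a) (λ A → begin
      θ a (basis A ⊗ t A)                                ≈⟨ θ-⊗ a (basis A) (t A) ⟩
      j₁ (basis A) · j₂ (t A)                            ≈⟨ extend-unique (row-linear A) (λ B → ≋.refl) (t A) ⟨
      sumE (map (λ B → t A B • monomial A B) (allSub b)) ∎))
      where
      row-linear : ∀ A → IsLinear (λ y → j₁ (basis A) · j₂ y)
      row-linear A = record
        { congruent = λ p → ·-congˡ (push-cong (a ↑ʳ_) p)
        ; additive  = λ x y → ≋.trans (·-congˡ (push-⊕ (a ↑ʳ_) x y)) (·-distribˡ _ _ _)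
        ; scalable  = λ k x → ≋.trans (·-congˡ (push-• (a ↑ʳ_) k x)) (·-•ʳ _ _ _)
        }

    -- The only exchange is that of e_B with e_C, and its cost is the sign built into `_*T_`.
    monomial-· : ∀ A B C D → monomial A B · monomial C D ≋
                 sign (∣ B ∣ *ℕ ∣ C ∣) • θ a (mulBasis A C ⊗ mulBasis B D)
    monomial-· A B C D = begin
      (j₁ eA · j₂ eB) · (j₁ eC · j₂ eD)                ≈⟨ ·-assoc _ _ _ ⟩
      j₁ eA · (j₂ eB · (j₁ eC · j₂ eD))                ≈⟨ ·-congˡ (·-assoc _ _ _) ⟨
      j₁ eA · (j₂ eB · j₁ eC · j₂ eD)                  ≈⟨ ·-congˡ (·-congʳ (≋.trans (push-basis-· (a ↑ʳ_) B _) (·-congʳ (α^-push-basis (_↑ˡ b) ∣ B ∣ C)))) ⟩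
      j₁ eA · ((s • j₁ eC) · j₂ eB · j₂ eD)            ≈⟨ ·-congˡ (≋.trans (·-congʳ (·-•ˡ _ _ _)) (·-•ˡ _ _ _)) ⟩
      j₁ eA · (s • (j₁ eC · j₂ eB · j₂ eD))            ≈⟨ ·-•ʳ _ _ _ ⟩
      s • (j₁ eA · (j₁ eC · j₂ eB · j₂ eD))            ≈⟨ •-cong refl (≋.trans (·-congˡ (·-assoc _ _ _)) (≋.sym (·-assoc _ _ _))) ⟩
      s • ((j₁ eA · j₁ eC) · (j₂ eB · j₂ eD))          ≈⟨ •-cong refl (·-cong (push-· (_↑ˡ b) eA eC) (push-· (a ↑ʳ_) eB eD)) ⟨
      s • (j₁ (eA · eC) · j₂ (eB · eD))                ≈⟨ •-cong refl (·-cong (push-cong (_↑ˡ b) (mulBasis-· A C)) (push-cong (a ↑ʳ_) (mulBasis-· B D))) ⟨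
      s • (j₁ (mulBasis A C) · j₂ (mulBasis B D))      ≈⟨ •-cong refl (θ-⊗ a _ _) ⟨
      s • θ a (mulBasis A C ⊗ mulBasis B D)            ∎
      where
      s = sign (∣ B ∣ *ℕ ∣ C ∣)
      eA = basis A ; eB = basis B ; eC = basis C ; eD = basis D

    -- Expanding both factors into monomials turns the product into the fourfold sum that defines
    -- `_*T_`; the summands then agree by `monomial-·`.
    θ-*T : ∀ t u → θ a (t *T u) ≋ θ a t · θ a u
    θ-*T t u = ≋.sym (begin
      θ a t · θ a u
        ≈⟨ ·-congʳ (θ-monomials t) ⟩
      sumE (map (λ A → sumE (map (λ B → t A B • monomial A B) (allSub b))) (allSub a)) · θ a u
        ≈⟨ preserves-sumE (·ˡ-linear _) _ (allSub a) ⟩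
      sumE (map (λ A → sumE (map (λ B → t A B • monomial A B) (allSub b)) · θ a u) (allSub a))
        ≈⟨ ΣA (λ A → preserves-sumE (·ˡ-linear _) _ (allSub b)) ⟩
      sumE (map (λ A → sumE (map (λ B → (t A B • monomial A B) · θ a u) (allSub b))) (allSub a))
        ≈⟨ ΣA (λ A → ΣB (λ B → ≋.trans (·-congˡ (θ-monomials u)) (preserves-sumE (·ʳ-linear _) _ (allSub a)))) ⟩
      sumE (map (λ A → sumE (map (λ B → sumE (map (λ C →
        (t A B • monomial A B) · sumE (map (λ D → u C D • monomial C D) (allSub b)))
        (allSub a))) (allSub b))) (allSub a))
        ≈⟨ ΣA (λ A → ΣB (λ B → ΣA (λ C → preserves-sumE (·ʳ-linear _) _ (allSub b)))) ⟩
      sumE (map (λ A → sumE (map (λ B → sumE (map (λ C → sumE (map (λ D →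
        (t A B • monomial A B) · (u C D • monomial C D))
        (allSub b))) (allSub a))) (allSub b))) (allSub a))
        ≈⟨ ΣA (λ A → ΣB (λ B → ΣA (λ C → ΣB (λ D → term A B C D)))) ⟩
      sumE (map (λ A → sumE (map (λ B → sumE (map (λ C → sumE (map (λ D → θ a (F A B C D))
        (allSub b))) (allSub a))) (allSub b))) (allSub a))
        ≈⟨ ΣA (λ A → ΣB (λ B → ΣA (λ C → θ-sumT a (F A B C) (allSub b)))) ⟨
      sumE (map (λ A → sumE (map (λ B → sumE (map (λ C →
        θ a (sumT (map (F A B C) (allSub b)))) (allSub a))) (allSub b))) (allSub a))
        ≈⟨ ΣA (λ A → ΣB (λ B → θ-sumT a (λ C → sumT (map (F A B C) (allSub b))) (allSub a))) ⟨
      sumE (map (λ A → sumE (map (λ B → θ a (sumT (map (λ C →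
        sumT (map (F A B C) (allSub b))) (allSub a)))) (allSub b))) (allSub a))
        ≈⟨ ΣA (λ A → θ-sumT a (λ B → sumT (map (λ C → sumT (map (F A B C) (allSub b))) (allSub a))) (allSub b)) ⟨
      sumE (map (λ A → θ a (sumT (map (λ B → sumT (map (λ C →
        sumT (map (F A B C) (allSub b))) (allSub a))) (allSub b)))) (allSub a))
        ≈⟨ θ-sumT a (λ A → sumT (map (λ B → sumT (map (λ C → sumT (map (F A B C) (allSub b))) (allSub a))) (allSub b))) (allSub a) ⟨
      θ a (t *T u) ∎)
      where
      ΣA : ∀ {F G : Subset a → E (a +ℕ b)} → (∀ A → F A ≋ G A) → sumE (map F (allSub a)) ≋ sumE (map G (allSub a))
      ΣA = sumE-cong (allSub a)
      ΣB : ∀ {F G : Subset b → E (a +ℕ b)} → (∀ A → F A ≋ G A) → sumE (map F (allSub b)) ≋ sumE (map G (allSub b))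
      ΣB = sumE-cong (allSub b)
      F : Subset a → Subset b → Subset a → Subset b → T a b
      F A B C D = (t A B * u C D * sign (∣ B ∣ *ℕ ∣ C ∣)) •T (mulBasis A C ⊗ mulBasis B D)
      term : ∀ A B C D → (t A B • monomial A B) · (u C D • monomial C D) ≋ θ a (F A B C D)
      term A B C D = begin
        (t A B • monomial A B) · (u C D • monomial C D)     ≈⟨ ≋.trans (·-•ˡ _ _ _) (•-cong refl (·-•ʳ _ _ _)) ⟩
        t A B • u C D • (monomial A B · monomial C D)       ≈⟨ •-cong refl (•-cong refl (monomial-· A B C D)) ⟩
        t A B • u C D • s • m                               ≈⟨ •-assoc _ _ _ ⟩
        (t A B * u C D) • s • m                             ≈⟨ •-assoc _ _ _ ⟩
        (t A B * u C D * s) • m                             ≈⟨ θ-• a _ _ ⟨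
        θ a (F A B C D)                                     ∎
        where
        s = sign (∣ B ∣ *ℕ ∣ C ∣)
        m = θ a (mulBasis A C ⊗ mulBasis B D)

-- Homogeneity of products, homomorphisms and re-indexed tensors.

module Degrees {c ℓ} (K : Field c ℓ) where
  open Field K hiding (zero)
  open Algebra.Properties.Ring ring using (-0#≈0#)
  open OS K using (E; T; 1E; gen)
    renaming (_+E_ to infixl 6 _⊕_; -E_ to infix 8 ⊖_)
  open Exterior K
  open Derivations K
  open Coordinates K

  -- Homogeneity of degree p - k, stated without subtraction.
  Homog[_] : ∀ {n} → ℕ → ℕ → E n → Set ℓ
  Homog[ k ] p x = ∀ A → ¬ (k +ℕ ∣ A ∣ ≡ p) → x A ≈ 0#

  H-resp : ∀ {n} k {p} {x y : E n} → x ≋ y → Homog[ k ] p x → Homog[ k ] p y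
  H-resp k e h A ne = trans (sym (at e A)) (h A ne)

  H-⊕ : ∀ {n} k {p} {x y : E n} → Homog[ k ] p x → Homog[ k ] p y → Homog[ k ] p (x ⊕ y)
  H-⊕ k h i A ne = trans (+-cong (h A ne) (i A ne)) (+-identityʳ _)

  H-⊖ : ∀ {n} k {p} {x : E n} → Homog[ k ] p x → Homog[ k ] p (⊖ x)
  H-⊖ k h A ne = trans (-‿cong (h A ne)) -0#≈0#

  H-hi : ∀ {n} k {p} {x : E (suc n)} → Homog[ k ] p x → Homog[ suc k ] p (hi x)
  H-hi k h A ne = h (true ∷ A) (ne ∘ ≡.trans (≡.sym (ℕₚ.+-suc k ∣ A ∣)))

  H-join : ∀ {n} k {p} {x : E (suc n)} → Homog[ k ] p (lo x) → Homog[ suc k ] p (hi x) → Homog[ k ] p x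
  H-join k h i (false ∷ A) ne = h A ne
  H-join k h i (true ∷ A)  ne = i A (ne ∘ ≡.trans (ℕₚ.+-suc k ∣ A ∣))

  H-gen· : ∀ {n} k {p} s {x : E n} → Homog[ suc k ] p x → Homog[ k ] p (gen s · x)
  H-gen· k zero {x} h = H-resp k (≋.sym (gen₀-· x)) (H-join k (λ _ _ → refl) (λ A → h (false ∷ A)))
  H-gen· k (suc s) {x} h = H-join k
    (H-gen· k s {lo x} (λ A → h (false ∷ A)))
    (H-resp (suc k) (≋.sym (≋.trans (⊕-cong (·-zeroˡ (lo x)) (≋.trans (·-congʳ (α-gen s)) (·-⊖ˡ _ _))) (⊕-identityˡ _)))
      (H-⊖ (suc k) (H-gen· (suc k) s {hi x} (H-hi (suc k) {x = x} h))))

  1E-degree : ∀ {n} (A : Subset n) → ¬ (∣ A ∣ ≡ 0) → 1E A ≈ 0#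
  1E-degree []          ne = ⊥-elim (ne ≡.refl)
  1E-degree (false ∷ A) ne = 1E-degree A ne
  1E-degree (true ∷ A)  ne = refl

  H-push : ∀ {n l} k {p} (g : Fin n → Fin l) {x} → Homog[ k ] p x → Homog[ k ] p (push g x)
  -- An element of `E 0` is a scalar placed in degree 0. Either `k` differs from `p` and the scalar
  -- vanishes, or the coefficient of `1E` at a nonempty subset does.
  H-push {zero}  k {p} g {x} h A ne with k ℕₚ.≟ p
  ... | no k≢p  = trans (*-congʳ (h [] (k≢p ∘ ≡.trans (≡.sym (ℕₚ.+-identityʳ k))))) (zeroˡ _)
  ... | yes ≡.refl = trans (*-congˡ (1E-degree A (λ e → ne (≡.trans (≡.cong (k +ℕ_) e) (ℕₚ.+-identityʳ k))))) (zeroʳ _)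
  H-push {suc n} k g {x} h = H-⊕ k (H-push k (g ∘ suc) (λ A → h (false ∷ A)))
    (H-gen· k (g zero) (H-push (suc k) (g ∘ suc) (H-hi k {x = x} h)))

  H-θ : ∀ a {b} k {p} (t : T a b) → (∀ A B → ¬ (k +ℕ (∣ A ∣ +ℕ ∣ B ∣) ≡ p) → t A B ≈ 0#) → Homog[ k ] p (θ a t)
  H-θ zero    k t h = h []
  H-θ (suc a) k t h = H-join k
    (H-θ a k (λ A → t (false ∷ A)) (λ A → h (false ∷ A)))
    (H-θ a (suc k) (λ A → t (true ∷ A)) (λ A B ne → h (true ∷ A) B (ne ∘ ≡.trans (≡.sym (ℕₚ.+-suc k _)))))

-- The identification map, its section, the element w and the derivation ∂₁.

module GluedGroundSet {c ℓ} (K : Field c ℓ) (m n : ℕ) where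
  open Field K hiding (zero) renaming (Carrier to 𝕜)
  open OS K using (E; 0E; 1E; gen)
    renaming (_+E_ to infixl 6 _⊕_; -E_ to infix 8 ⊖_; _•_ to infixr 7 _•_)
  open IntegerCoefficientSolver commutativeRing using (solve; _:=_; _:+_; _:*_; :-_; _:-_; :0; :1)
  open Exterior K
  open Derivations K
  open Linking K
  open ≋-Reasoning

  E₁ E₂ ED EP : Set c
  E₁ = E (suc m)
  E₂ = E (suc n)
  ED = E (suc m +ℕ suc n)
  EP = E (suc m +ℕ n)

  j₁ : E₁ → ED
  j₁ = push (_↑ˡ suc n)
  j₂ : E₂ → ED
  j₂ = push (suc m ↑ʳ_)
  i₁ : E₁ → EP
  i₁ = push (ι₁ m n)
  i₂ : E₂ → EP
  i₂ = push (ι₂ m n)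
  φ* : ED → EP
  φ* = push (φ m n)

  data View : Fin (suc m +ℕ suc n) → Set where
    left  : (x : Fin (suc m)) → View (x ↑ˡ suc n)
    right : ∀ x → View (suc m ↑ʳ x)

  view : ∀ y → View y
  view y = ≡.subst View (join-splitAt (suc m) (suc n) y) (go (splitAt (suc m) y))
    where
    go : ∀ z → View (join (suc m) (suc n) z)
    go (inj₁ x) = left x
    go (inj₂ x) = right x

  data Viewₚ : Fin (suc m +ℕ n) → Set where
    left  : (x : Fin (suc m)) → Viewₚ (x ↑ˡ n)
    right : ∀ x → Viewₚ (suc m ↑ʳ x)

  viewₚ : ∀ y → Viewₚ y
  viewₚ y = ≡.subst Viewₚ (join-splitAt (suc m) n y) (go (splitAt (suc m) y))
    where
    go : ∀ z → Viewₚ (join (suc m) n z)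
    go (inj₁ x) = left x
    go (inj₂ x) = right x

  φ-↑ˡ : ∀ x → φ m n (x ↑ˡ suc n) ≡ ι₁ m n x
  φ-↑ˡ x = ≡.cong [ ι₁ m n , ι₂ m n ]′ (splitAt-↑ˡ (suc m) x (suc n))

  φ-↑ʳ : ∀ x → φ m n (suc m ↑ʳ x) ≡ ι₂ m n x
  φ-↑ʳ x = ≡.cong [ ι₁ m n , ι₂ m n ]′ (splitAt-↑ʳ (suc m) (suc n) x)

  -- The common element is lifted to `i` and not to `i′`. Consequently `i′` is the only element
  -- moved by `section ∘ φ m n`.
  section : Fin (suc m +ℕ n) → Fin (suc m +ℕ suc n)
  section y = [ (_↑ˡ suc n) , (λ x → suc m ↑ʳ suc x) ]′ (splitAt (suc m) y)

  section-↑ˡ : ∀ x → section (x ↑ˡ n) ≡ x ↑ˡ suc n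
  section-↑ˡ x = ≡.cong [ (_↑ˡ suc n) , (λ x → suc m ↑ʳ suc x) ]′ (splitAt-↑ˡ (suc m) x n)

  section-↑ʳ : ∀ x → section (suc m ↑ʳ x) ≡ suc m ↑ʳ suc x
  section-↑ʳ x = ≡.cong [ (_↑ˡ suc n) , (λ x → suc m ↑ʳ suc x) ]′ (splitAt-↑ʳ (suc m) n x)

  φ-section : ∀ y → φ m n (section y) ≡ y
  φ-section y with viewₚ y
  ... | left x  = ≡.trans (≡.cong (φ m n) (section-↑ˡ x)) (φ-↑ˡ x)
  ... | right x = ≡.trans (≡.cong (φ m n) (section-↑ʳ x)) (φ-↑ʳ (suc x))

  σ : EP → ED
  σ = push section

  φ*-j₁ : ∀ x → φ* (j₁ x) ≋ i₁ x
  φ*-j₁ x = ≋.trans (push-∘ (φ m n) (_↑ˡ suc n) x) (push-ext φ-↑ˡ x)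

  φ*-j₂ : ∀ x → φ* (j₂ x) ≋ i₂ x
  φ*-j₂ x = ≋.trans (push-∘ (φ m n) (suc m ↑ʳ_) x) (push-ext φ-↑ʳ x)

  φ*-σ : ∀ x → φ* (σ x) ≋ x
  φ*-σ x = ≋.trans (push-∘ (φ m n) section x) (≋.trans (push-ext φ-section x) (push-id x))

  i i′ : Fin (suc m +ℕ suc n)
  i  = zero
  i′ = suc m ↑ʳ zero

  w : ED
  w = gen i ⊕ ⊖ gen i′

  α-w : α w ≋ ⊖ w
  α-w = begin
    α (gen i ⊕ ⊖ gen i′)         ≈⟨ ≋.trans (α-⊕ (gen i) (⊖ gen i′)) (⊕-cong (α-gen i) (≋.trans (α-⊖ (gen i′)) (⊖-cong (α-gen i′)))) ⟩
    ⊖ gen i ⊕ ⊖ ⊖ gen i′         ≈⟨ ⊖-⊕ (gen i) (⊖ gen i′) ⟨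
    ⊖ w                          ∎

  ·-w : ∀ x → x · w ≋ w · α x
  ·-w x = begin
    x · (gen i ⊕ ⊖ gen i′)               ≈⟨ ·-distribˡ x (gen i) (⊖ gen i′) ⟩
    x · gen i ⊕ x · (⊖ gen i′)           ≈⟨ ⊕-cong (·-gen x i) (≋.trans (·-⊖ʳ x (gen i′)) (⊖-cong (·-gen x i′))) ⟩
    gen i · α x ⊕ ⊖ (gen i′ · α x)       ≈⟨ ⊕-cong ≋.refl (·-⊖ˡ (gen i′) (α x)) ⟨
    gen i · α x ⊕ (⊖ gen i′) · α x       ≈⟨ ·-distribʳ (gen i) (⊖ gen i′) (α x) ⟨
    w · α x                              ∎

  w-sq : w · w ≋ 0E
  w-sq = begin
    w · (gen i ⊕ ⊖ gen i′)
      ≈⟨ ≋.trans (·-distribˡ w (gen i) (⊖ gen i′)) (⊕-cong ≋.refl (·-⊖ʳ w (gen i′))) ⟩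
    w · gen i ⊕ ⊖ (w · gen i′)
      ≈⟨ ⊕-cong (expand i) (⊖-cong (expand i′)) ⟩
    (gen i · gen i ⊕ ⊖ (gen i′ · gen i)) ⊕ ⊖ (gen i · gen i′ ⊕ ⊖ (gen i′ · gen i′))
      ≈⟨ ⊕-cong (⊕-cong (gen-sq i) ≋.refl) (⊖-cong (⊕-cong (gen-anticomm i i′) (⊖-cong (gen-sq i′)))) ⟩
    (0E ⊕ ⊖ (gen i′ · gen i)) ⊕ ⊖ (⊖ (gen i′ · gen i) ⊕ ⊖ 0E)
      ≈⟨ ⟪ (λ A → solve 1 (λ x → (:0 :+ :- x) :+ :- (:- x :+ :- :0) := :0) refl ((gen i′ · gen i) A)) ⟫ ⟩
    0E ∎
    where
    expand : ∀ s → w · gen s ≋ gen i · gen s ⊕ ⊖ (gen i′ · gen s)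
    expand s = ≋.trans (·-distribʳ (gen i) (⊖ gen i′) (gen s)) (⊕-cong ≋.refl (·-⊖ˡ (gen i′) (gen s)))

  w·w· : ∀ x → w · (w · x) ≋ 0E
  w·w· x = ≋.trans (≋.sym (·-assoc w w x)) (≋.trans (·-congʳ w-sq) (·-zeroˡ x))

  φ*-w : φ* w ≋ 0E
  φ*-w = begin
    φ* (gen i ⊕ ⊖ gen i′)          ≈⟨ ≋.trans (push-⊕ (φ m n) (gen i) (⊖ gen i′)) (⊕-cong (push-gen (φ m n) i)
                                        (≋.trans (push-⊖ (φ m n) (gen i′)) (⊖-cong (≋.trans (push-gen (φ m n) i′) (≋.reflexive (≡.cong gen (φ-↑ʳ zero))))))) ⟩
    gen zero ⊕ ⊖ gen zero          ≈⟨ ⊕-inverseʳ (gen zero) ⟩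
    0E                             ∎

  φ*-w· : ∀ x → φ* (w · x) ≋ 0E
  φ*-w· x = ≋.trans (push-· (φ m n) w x) (≋.trans (·-congʳ φ*-w) (·-zeroˡ _))

  -- Since w commutes with everything up to `α`, its right multiples form a two-sided ideal. A
  -- congruence modulo this ideal on generators therefore extends to products and sums.
  push-mod-w : ∀ {l} (g h : Fin l → Fin (suc m +ℕ suc n)) →
                    (∀ s → ∃[ t ] (gen (g s) ≋ gen (h s) ⊕ w · t)) →
                    ∀ x → ∃[ u ] (push g x ≋ push h x ⊕ w · u)
  push-mod-w {zero}  g h d x = 0E , ≋.sym (≋.trans (⊕-cong ≋.refl (·-zeroʳ w)) (⊕-identityʳ _))
  push-mod-w {suc l} g h d x
    with push-mod-w (g ∘ suc) (h ∘ suc) (d ∘ suc) (lo x)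
       | push-mod-w (g ∘ suc) (h ∘ suc) (d ∘ suc) (hi x)
       | d zero
  ... | u₀ , p₀ | u₁ , p₁ | t , p = u₀ ⊕ (α e · u₁ ⊕ t · G₁) , (begin
    push (g ∘ suc) (lo x) ⊕ gen (g zero) · G₁
      ≈⟨ ⊕-cong p₀ (≋.trans (·-congʳ p) (≋.trans (·-distribʳ e (w · t) G₁) (⊕-cong (·-congˡ p₁) (·-assoc w t G₁)))) ⟩
    (H₀ ⊕ w · u₀) ⊕ (e · (H₁ ⊕ w · u₁) ⊕ w · (t · G₁))
      ≈⟨ ⊕-cong ≋.refl (⊕-cong (≋.trans (·-distribˡ e H₁ (w · u₁)) (⊕-cong ≋.refl swap)) ≋.refl) ⟩
    (H₀ ⊕ w · u₀) ⊕ ((e · H₁ ⊕ w · (α e · u₁)) ⊕ w · (t · G₁))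
      ≈⟨ ⟪ (λ A → solve 5 (λ a b c d e → (a :+ b) :+ ((c :+ d) :+ e) := (a :+ c) :+ (b :+ (d :+ e))) refl
             (H₀ A) ((w · u₀) A) ((e · H₁) A) ((w · (α e · u₁)) A) ((w · (t · G₁)) A)) ⟫ ⟩
    (H₀ ⊕ e · H₁) ⊕ (w · u₀ ⊕ (w · (α e · u₁) ⊕ w · (t · G₁)))
      ≈⟨ ⊕-cong ≋.refl (≋.trans (·-distribˡ w u₀ _) (⊕-cong ≋.refl (·-distribˡ w (α e · u₁) (t · G₁)))) ⟨
    (H₀ ⊕ e · H₁) ⊕ w · (u₀ ⊕ (α e · u₁ ⊕ t · G₁)) ∎)
    where
    e = gen (h zero)
    G₁ = push (g ∘ suc) (hi x)
    H₀ = push (h ∘ suc) (lo x)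
    H₁ = push (h ∘ suc) (hi x)
    swap : e · (w · u₁) ≋ w · (α e · u₁)
    swap = ≋.trans (≋.sym (·-assoc e w u₁)) (≋.trans (·-congʳ (·-w e)) (·-assoc w (α e) u₁))

  section-φ : ∀ s → ∃[ t ] (gen s ≋ gen (section (φ m n s)) ⊕ w · t)
  section-φ s = go (view s)
    where
    equal : ∀ {s t} → s ≡ t → ∃[ u ] (gen t ≋ gen s ⊕ w · u)
    equal ≡.refl = 0E , ≋.sym (≋.trans (⊕-cong ≋.refl (·-zeroʳ w)) (⊕-identityʳ _))
    go : ∀ {s} → View s → ∃[ t ] (gen s ≋ gen (section (φ m n s)) ⊕ w · t)
    go (left x)        = equal (≡.trans (≡.cong section (φ-↑ˡ x)) (section-↑ˡ x))
    go (right (suc x)) = equal (≡.trans (≡.cong section (φ-↑ʳ (suc x))) (section-↑ʳ x))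
    -- The one nontrivial case is the identity e_i′ = e_i - w.
    go (right zero)    = ⊖ 1E , (begin
      gen i′                                   ≈⟨ ⟪ (λ A → solve 2 (λ x y → y := x :+ :- (x :- y)) refl (gen i A) (gen i′ A)) ⟫ ⟩
      gen i ⊕ ⊖ w                              ≈⟨ ⊕-cong (≋.reflexive (≡.cong (gen ∘ section) (φ-↑ʳ zero)))
                                                    (≋.trans (·-⊖ʳ w 1E) (⊖-cong (·-identityʳ w))) ⟨
      gen (section (φ m n i′)) ⊕ w · (⊖ 1E)    ∎)

  -- When `φ* y` vanishes this exhibits `y` as a multiple of w, so the kernel of `φ*` before passing
  -- to quotients is the principal ideal of w.
  mod-w : ∀ y → ∃[ u ] (y ≋ σ (φ* y) ⊕ w · u)
  mod-w y = proj₁ d , ≋.trans (≋.sym (push-id y)) (≋.trans (proj₂ d) (⊕-cong (≋.sym (push-∘ section (φ m n) y)) ≋.refl))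
    where d = push-mod-w id (section ∘ φ m n) section-φ y

  -- The error of `mod-w` is a multiple of w, and w kills it. Hence w times a lift depends only on
  -- the element lifted.
  w·σφ : ∀ y → w · σ (φ* y) ≋ w · y
  w·σφ y = ≋.sym (begin
    w · y                              ≈⟨ ·-congˡ (proj₂ (mod-w y)) ⟩
    w · (σ (φ* y) ⊕ w · u)             ≈⟨ ·-distribˡ w (σ (φ* y)) (w · u) ⟩
    w · σ (φ* y) ⊕ w · (w · u)         ≈⟨ ⊕-cong ≋.refl (w·w· u) ⟩
    w · σ (φ* y) ⊕ 0E                  ≈⟨ ⊕-identityʳ _ ⟩
    w · σ (φ* y)                       ∎)
    where u = proj₁ (mod-w y)

  indicator₁ : Fin (suc m +ℕ suc n) → 𝕜
  indicator₁ s = [ (λ _ → 1#) , (λ _ → 0#) ]′ (splitAt (suc m) s)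

  ∂₁ : ED → ED
  ∂₁ = δ indicator₁

  ∂₁-j₁ : ∀ x → ∂₁ (j₁ x) ≋ j₁ (δ₁ x)
  ∂₁-j₁ x = ≋.trans (δ-push indicator₁ (_↑ˡ suc n) x) (push-cong (_↑ˡ suc n)
    (δ-ext (λ s → reflexive (≡.cong [ (λ _ → 1#) , (λ _ → 0#) ]′ (splitAt-↑ˡ (suc m) s (suc n)))) x))

  indicator₁-↑ʳ : ∀ x → indicator₁ (suc m ↑ʳ x) ≈ 0#
  indicator₁-↑ʳ x = reflexive (≡.cong [ (λ _ → 1#) , (λ _ → 0#) ]′ (splitAt-↑ʳ (suc m) (suc n) x))

  ∂₁-j₂ : ∀ x → ∂₁ (j₂ x) ≋ 0E
  ∂₁-j₂ x = ≋.trans (δ-push indicator₁ (suc m ↑ʳ_) x)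
    (≋.trans (push-cong (suc m ↑ʳ_) (δ-zero _ indicator₁-↑ʳ x)) (push-0 (suc m ↑ʳ_)))

  ∂₁-w : ∂₁ w ≋ 1E
  ∂₁-w = begin
    ∂₁ (gen i ⊕ ⊖ gen i′)              ≈⟨ ≋.trans (δ-⊕ _ (gen i) (⊖ gen i′)) (⊕-cong ≋.refl (δ-⊖ _ (gen i′))) ⟩
    ∂₁ (gen i) ⊕ ⊖ ∂₁ (gen i′)         ≈⟨ ⊕-cong (δ-gen _ i) (⊖-cong (≋.trans (δ-gen _ i′) (•-cong (indicator₁-↑ʳ zero) ≋.refl))) ⟩
    1# • 1E ⊕ ⊖ (0# • 1E)              ≈⟨ ⟪ (λ A → solve 1 (λ x → :1 :* x :+ :- (:0 :* x) := x) refl (1E A)) ⟫ ⟩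
    1E                                 ∎

  -- ∂₁ is a contracting homotopy for multiplication by w.
  ∂₁-w· : ∀ x → ∂₁ (w · x) ≋ x ⊕ ⊖ (w · ∂₁ x)
  ∂₁-w· x = begin
    ∂₁ (w · x)                         ≈⟨ δ-· _ w x ⟩
    ∂₁ w · x ⊕ α w · ∂₁ x              ≈⟨ ⊕-cong (≋.trans (·-congʳ ∂₁-w) (·-identityˡ x)) (≋.trans (·-congʳ α-w) (·-⊖ˡ w (∂₁ x))) ⟩
    x ⊕ ⊖ (w · ∂₁ x)                   ∎

-- The ideals of D and P, and the short exact sequence.

module ExactSequence {c ℓ} (K : Field c ℓ) {m n : ℕ} (M₁ : Matroid (suc m)) (M₂ : Matroid (suc n)) where
  open Field K hiding (zero)
  open OS K using (0E; 1E; basis; gen; Homog; InI; 0∈; +∈; _≈A[_]_; Emap; ShortExact)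
    renaming (_+E_ to infixl 6 _⊕_; -E_ to infix 8 ⊖_; _•_ to infixr 7 _•_)
  open IntegerCoefficientSolver commutativeRing using (solve; _:=_; _:+_; :-_; _:-_; :0)
  open Exterior K
  open Derivations K
  open Linking K
  open Ideals K
  open Coordinates K
  open Degrees K
  open GluedGroundSet K m n
  open Ideal
  open ≋-Reasoning

  D : Subset (suc m +ℕ suc n) → Set
  D = DirectSumCircuit M₁ M₂

  P : Subset (suc m +ℕ n) → Set
  P = ParallelCircuit M₁ M₂

  -- ∂ commutes with `push`, so it suffices that e_A goes to a monomial without a sign; the
  -- inclusions to which this is applied are increasing. `B′` is the explicit bit vector, and `B`
  -- the subset supplied by the circuit.
  image-circuit : ∀ {k l} (g : Fin k → Fin l) {A : Subset k} {B B′ : Subset l} →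
                  IsImage g A B → IsImage g A B′ → push g (basis A) ≋ basis B′ →
                  push g (δ₁ (basis A)) ≋ δ₁ (basis B)
  image-circuit g {A} {B} {B′} im im′ e = begin
    push g (δ₁ (basis A))        ≈⟨ δ-push _ g (basis A) ⟨
    δ₁ (push g (basis A))        ≈⟨ δ-cong _ e ⟩
    δ₁ (basis B′)                ≈⟨ ≋.reflexive (≡.cong (δ₁ ∘ basis) (subset-ext im′ im)) ⟩
    δ₁ (basis B)                 ∎

  j₁-circuit : ∀ {A B} → IsImage (_↑ˡ suc n) A B → j₁ (δ₁ (basis A)) ≋ δ₁ (basis B)
  j₁-circuit {A} im = image-circuit (_↑ˡ suc n) im (image-↑ˡ (suc n) A) (push-↑ˡ-basis (suc n) A)

  j₂-circuit : ∀ {A B} → IsImage (suc m ↑ʳ_) A B → j₂ (δ₁ (basis A)) ≋ δ₁ (basis B)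
  j₂-circuit {A} im = image-circuit (suc m ↑ʳ_) im (image-↑ʳ (suc m) A) (push-↑ʳ-basis (suc m) A)

  i₁-circuit : ∀ {A B} → IsImage (ι₁ m n) A B → i₁ (δ₁ (basis A)) ≋ δ₁ (basis B)
  i₁-circuit {A} im = image-circuit (ι₁ m n) im (image-↑ˡ n A) (push-↑ˡ-basis n A)

  i₂-circuit : ∀ {A B} → IsImage (ι₂ m n) A B → i₂ (δ₁ (basis A)) ≋ δ₁ (basis B)
  i₂-circuit {b ∷ A} im = image-circuit (ι₂ m n) im (image-ι₂ m b A) (push-ι₂-basis m b A)

  j₁-I : ∀ {x} → InI (IsCircuit M₁) x → InI D (j₁ x)
  j₁-I = I-push (_↑ˡ suc n) (λ {C} cir →
    I-resp D (≋.sym (j₁-circuit (image-↑ˡ (suc n) C))) (I-gen D (inj₁ (C , cir , image-↑ˡ (suc n) C))))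

  j₂-I : ∀ {x} → InI (IsCircuit M₂) x → InI D (j₂ x)
  j₂-I = I-push (suc m ↑ʳ_) (λ {C} cir →
    I-resp D (≋.sym (j₂-circuit (image-↑ʳ (suc m) C))) (I-gen D (inj₂ (C , cir , image-↑ʳ (suc m) C))))

  φ*-I : ∀ {x} → InI D x → InI P (φ* x)
  φ*-I = I-push (φ m n) gens
    where
    gens : ∀ {C} → D C → InI P (φ* (δ₁ (basis C)))
    gens (inj₁ (A , cir , im)) = I-resp P
      (≋.trans (≋.sym (i₁-circuit (image-↑ˡ n A))) (≋.trans (≋.sym (φ*-j₁ (δ₁ (basis A)))) (push-cong (φ m n) (j₁-circuit im))))
      (I-gen P (inj₁ (A , cir , image-↑ˡ n A)))
    gens (inj₂ (b ∷ A , cir , im)) = I-resp P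
      (≋.trans (≋.sym (i₂-circuit (image-ι₂ m b A))) (≋.trans (≋.sym (φ*-j₂ (δ₁ (basis (b ∷ A))))) (push-cong (φ m n) (j₂-circuit im))))
      (I-gen P (inj₂ (inj₁ (b ∷ A , cir , image-ι₂ m b A))))

  φ*-i : φ* (gen i) ≋ gen zero
  φ*-i = push-gen (φ m n) i

  -- For circuits i ∪ X and i ∪ Y put x = e_X, y = e_Y.  Then x = ∂(e_i x) + e_i ∂x and similarly for y,
  -- so modulo the two circuit relations xy = e_i (∂x) e_i (∂y) = 0.
  gluing-element : ∀ X Y → ED
  gluing-element X Y = j₁ (δ₁ (basis (true ∷ X))) · j₂ y ⊕ gen i · j₁ (δ₁ x) · j₂ (δ₁ (basis (true ∷ Y)))
    where x = basis (false ∷ X) ; y = basis (false ∷ Y)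

  δ₁-true : ∀ {k} (X : Subset k) → δ₁ (basis (true ∷ X)) ≋ basis (false ∷ X) ⊕ ⊖ (gen zero · δ₁ (basis (false ∷ X)))
  δ₁-true X = begin
    δ₁ (basis (true ∷ X))                        ≈⟨ δ-cong _ (≋.trans (gen₀-· x) (≋-split ≋.refl ≋.refl)) ⟨
    δ₁ (gen zero · x)                            ≈⟨ δ-· _ (gen zero) x ⟩
    δ₁ (gen zero) · x ⊕ α (gen zero) · δ₁ x      ≈⟨ ⊕-cong (≋.trans (·-congʳ (≋.trans (δ-gen (λ _ → 1#) zero) (1• 1E))) (·-identityˡ x))
                                                      (≋.trans (·-congʳ (α-gen zero)) (·-⊖ˡ (gen zero) (δ₁ x))) ⟩
    x ⊕ ⊖ (gen zero · δ₁ x)                      ∎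
    where x = basis (false ∷ X)

  -- After `i` and `i′` are identified, the two terms e (∂x) y cancel and the last term contains e
  -- twice. The identity is exact, with no relations used, so ∂ may be applied to both sides.
  φ*-gluing-element : ∀ X Y → φ* (gluing-element X Y) ≋ i₁ (basis (false ∷ X)) · i₂ (basis (false ∷ Y))
  φ*-gluing-element X Y = begin
    φ* (gluing-element X Y)
      ≈⟨ push-⊕ (φ m n) (j₁ rx · j₂ y) (gen i · j₁ (δ₁ x) · j₂ ry) ⟩
    φ* (j₁ rx · j₂ y) ⊕ φ* (gen i · j₁ (δ₁ x) · j₂ ry)
      ≈⟨ ⊕-cong (≋.trans (push-· (φ m n) (j₁ rx) (j₂ y)) (·-cong (φ*-j₁ rx) (φ*-j₂ y)))
           (≋.trans (push-· (φ m n) (gen i · j₁ (δ₁ x)) (j₂ ry)) (·-cong (≋.trans (push-· (φ m n) (gen i) (j₁ (δ₁ x))) (·-cong φ*-i (φ*-j₁ (δ₁ x)))) (φ*-j₂ ry))) ⟩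
    i₁ rx · i₂ y ⊕ e · dx · i₂ ry
      ≈⟨ ⊕-cong (·-congʳ i₁-rx) (·-congˡ i₂-ry) ⟩
    (i₁ x ⊕ ⊖ (e · dx)) · i₂ y ⊕ e · dx · (i₂ y ⊕ ⊖ (e · dy))
      ≈⟨ ⊕-cong (≋.trans (·-distribʳ (i₁ x) (⊖ (e · dx)) (i₂ y)) (⊕-cong ≋.refl (·-⊖ˡ (e · dx) (i₂ y))))
           (≋.trans (·-distribˡ (e · dx) (i₂ y) (⊖ (e · dy))) (⊕-cong ≋.refl (≋.trans (·-⊖ʳ (e · dx) (e · dy)) (⊖-cong vanish)))) ⟩
    (i₁ x · i₂ y ⊕ ⊖ (e · dx · i₂ y)) ⊕ (e · dx · i₂ y ⊕ ⊖ 0E)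
      ≈⟨ ⟪ (λ A → solve 2 (λ p q → (p :- q) :+ (q :- :0) := p) refl ((i₁ x · i₂ y) A) ((e · dx · i₂ y) A)) ⟫ ⟩
    i₁ x · i₂ y ∎
    where
    x = basis (false ∷ X) ; y = basis (false ∷ Y)
    rx = δ₁ (basis (true ∷ X)) ; ry = δ₁ (basis (true ∷ Y))
    e : EP
    e = gen zero
    dx = i₁ (δ₁ x) ; dy = i₂ (δ₁ y)
    relation : ∀ {k} (g : Fin (suc k) → Fin (suc m +ℕ n)) → g zero ≡ zero → ∀ Z →
               push g (δ₁ (basis (true ∷ Z))) ≋ push g (basis (false ∷ Z)) ⊕ ⊖ (e · push g (δ₁ (basis (false ∷ Z))))
    relation g g0 Z = begin
      push g (δ₁ (basis (true ∷ Z)))                 ≈⟨ push-cong g (δ₁-true Z) ⟩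
      push g (z ⊕ ⊖ (gen zero · δ₁ z))               ≈⟨ ≋.trans (push-⊕ g z (⊖ (gen zero · δ₁ z))) (⊕-cong ≋.refl (push-⊖ g (gen zero · δ₁ z))) ⟩
      push g z ⊕ ⊖ push g (gen zero · δ₁ z)          ≈⟨ ⊕-cong ≋.refl (⊖-cong (≋.trans (push-· g (gen zero) (δ₁ z))
                                                          (·-congʳ (≋.trans (push-gen g zero) (≋.reflexive (≡.cong gen g0)))))) ⟩
      push g z ⊕ ⊖ (e · push g (δ₁ z))               ∎
      where z = basis (false ∷ Z)
    i₁-rx = relation (ι₁ m n) ≡.refl X
    i₂-ry = relation (ι₂ m n) ≡.refl Y
    vanish : e · dx · (e · dy) ≋ 0E
    vanish = ≋.trans (≋.sym (·-assoc (e · dx) e dy)) (≋.trans (·-congʳ (gen·x·gen zero dx)) (·-zeroˡ dy))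

  gluing-element-I : ∀ {X Y} → IsCircuit M₁ (true ∷ X) → IsCircuit M₂ (true ∷ Y) → InI D (gluing-element X Y)
  gluing-element-I {X} {Y} cx cy = +∈
    (I-·ʳ D _ (j₁-I (I-gen (IsCircuit M₁) cx)))
    (I-·ˡ D _ (j₂-I (I-gen (IsCircuit M₂) cy)))

  glued-basis : ∀ (X : Subset m) (Y : Subset n) →
                i₁ (basis (false ∷ X)) · i₂ (basis (false ∷ Y)) ≋ basis (false ∷ (X Vec.++ Y))
  glued-basis X Y = begin
    i₁ (basis (false ∷ X)) · i₂ (basis (false ∷ Y))
      ≈⟨ ·-cong (≋.trans (proj₁ (push-gens (ι₁ m n) X)) (push-suc (_↑ˡ n) (basis X)))
                (≋.trans (proj₁ (push-gens (ι₂ m n) Y)) (push-suc (m ↑ʳ_) (basis Y))) ⟩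
    inj₀ (push (_↑ˡ n) (basis X)) · inj₀ (push (m ↑ʳ_) (basis Y))
      ≈⟨ inj₀-· _ _ ⟨
    inj₀ (push (_↑ˡ n) (basis X) · push (m ↑ʳ_) (basis Y))
      ≈⟨ ≋-split (≋.sym (basis-++ X Y)) ≋.refl ⟩
    basis (false ∷ (X Vec.++ Y)) ∎

  Lift : EP → Set (c ⊔ ℓ)
  Lift x = ∃[ z ] (InI D z × φ* z ≋ x)

  -- A cofactor `a` lifts to `σ a` because `φ*` undoes `σ`, so only the circuit relations themselves
  -- require a lift.
  φ*-I-surjective : ∀ {x} → InI P x → Lift x
  φ*-I-surjective = I-rec P Lift
    (λ { p (z , zI , e) → z , zI , ≋.trans e p })
    (0E , 0∈ , push-0 (φ m n))
    (λ { (z , zI , e) (z′ , z′I , e′) → z ⊕ z′ , +∈ zI z′I , ≋.trans (push-⊕ (φ m n) z z′) (⊕-cong e e′) })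
    (λ { a _ (z , zI , e) → σ a · z , I-·ˡ D (σ a) zI , ≋.trans (push-· (φ m n) (σ a) z) (·-cong (φ*-σ a) e) })
    (λ { a _ (z , zI , e) → z · σ a , I-·ʳ D (σ a) zI , ≋.trans (push-· (φ m n) z (σ a)) (·-cong e (φ*-σ a)) })
    gens
    where
    gens : ∀ {C} → P C → Lift (δ₁ (basis C))
    gens (inj₁ (A , cir , im)) =
      j₁ (δ₁ (basis A)) , j₁-I (I-gen (IsCircuit M₁) cir) , ≋.trans (φ*-j₁ (δ₁ (basis A))) (i₁-circuit im)
    gens (inj₂ (inj₁ (A , cir , im))) =
      j₂ (δ₁ (basis A)) , j₂-I (I-gen (IsCircuit M₂) cir) , ≋.trans (φ*-j₂ (δ₁ (basis A))) (i₂-circuit im)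
    gens {C} (inj₂ (inj₂ (true ∷ X , true ∷ Y , cx , cy , here , here , q))) =
      -- The gluing element lies above the monomial e_C; its derivative remains in the ideal of `D`
      -- and lies above ∂ e_C.
      δ₁ z , I-δ₁ D (gluing-element-I cx cy) , (begin
        φ* (δ₁ z)                                                   ≈⟨ δ-push (λ _ → 1#) (φ m n) z ⟨
        δ₁ (φ* z)                                                   ≈⟨ δ-cong _ (≋.trans (φ*-gluing-element X Y) (glued-basis X Y)) ⟩
        δ₁ (basis (false ∷ (X Vec.++ Y)))                           ≈⟨ ≋.reflexive (≡.cong (δ₁ ∘ basis) (subset-ext (∈-glued m n X Y) q)) ⟩
        δ₁ (basis C)                                                ∎)
      where z = gluing-element X Y

  -- A circuit of the direct sum lies in one summand. On a relation from M₁ the derivation acts as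
  -- ∂, which squares to zero, and it annihilates everything from M₂.
  I-∂₁ : ∀ {x} → InI D x → InI D (∂₁ x)
  I-∂₁ = I-δ D indicator₁ gens
    where
    gens : ∀ {C} → D C → InI D (∂₁ (δ₁ (basis C)))
    gens {C} (inj₁ (A , _ , im)) = I-resp D (≋.sym (begin
      ∂₁ (δ₁ (basis C))            ≈⟨ δ-cong indicator₁ (j₁-circuit im) ⟨
      ∂₁ (j₁ (δ₁ (basis A)))       ≈⟨ ∂₁-j₁ (δ₁ (basis A)) ⟩
      j₁ (δ₁ (δ₁ (basis A)))       ≈⟨ push-cong (_↑ˡ suc n) (δ-δ (λ _ → 1#) (basis A)) ⟩
      j₁ 0E                        ≈⟨ push-0 {suc m} (_↑ˡ suc n) ⟩
      0E                           ∎)) 0∈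
    gens (inj₂ (A , _ , im)) = I-resp D
      (≋.sym (≋.trans (δ-cong indicator₁ (≋.sym (j₂-circuit im))) (∂₁-j₂ (δ₁ (basis A))))) 0∈

  f : EP → ED
  f x = w · σ x

  f-linear : IsLinear f
  f-linear = record
    { congruent = λ p → ·-congˡ (push-cong section p)
    ; additive  = λ x y → ≋.trans (·-congˡ (push-⊕ section x y)) (·-distribˡ w (σ x) (σ y))
    ; scalable  = λ k x → ≋.trans (·-congˡ (push-• section k x)) (·-•ʳ k w (σ x))
    }

  -- A relation is first lifted to some `z` in the ideal of `D`; then w σ(φ* z) = w z is a multiple
  -- of `z`. Applying `σ` to the relation directly could leave the ideal.
  f-I : ∀ {x} → InI P x → InI D (f x)
  f-I xI with φ*-I-surjective xI
  ... | z , zI , e = I-resp D (≋.trans (≋.sym (w·σφ z)) (·-congˡ (push-cong section e))) (I-·ˡ D w zI)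

  w·-exact : ∀ {x} → InI D (w · x) → InI D (x ⊕ ⊖ (w · ∂₁ x))
  w·-exact {x} xI = I-resp D (∂₁-w· x) (I-∂₁ xI)

  φ*-f : ∀ x → φ* (f x) ≋ 0E
  φ*-f x = φ*-w· (σ x)

  -- If w σ(x) is zero in A(D), the homotopy makes σ(x) a multiple of w there, and `φ*` annihilates
  -- such multiples.
  f-injective : ∀ {x} → InI D (f x) → InI P x
  f-injective {x} xI = I-resp P (begin
    φ* (σ x ⊕ ⊖ (w · ∂₁ (σ x)))          ≈⟨ ≋.trans (push-⊕ (φ m n) (σ x) (⊖ (w · ∂₁ (σ x)))) (⊕-cong (φ*-σ x) (push-⊖ (φ m n) (w · ∂₁ (σ x)))) ⟩
    x ⊕ ⊖ φ* (w · ∂₁ (σ x))              ≈⟨ ⊕-cong ≋.refl (≋.trans (⊖-cong (φ*-w· (∂₁ (σ x)))) ⊖0) ⟩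
    x ⊕ 0E                               ≈⟨ ⊕-identityʳ x ⟩
    x                                    ∎) (φ*-I (w·-exact xI))

  -- Subtracting a lift `z` of the relation `φ* y` leaves an element that `φ*` kills exactly, not
  -- just modulo the ideal. By `mod-w` it is w u, which equals `f (φ* u)`.
  kernel-φ* : ∀ y → InI P (φ* y) → ∃[ x ] (f x ≈A[ D ] y)
  kernel-φ* y yI = φ* u , I-resp D (begin
    ⊖ z                            ≈⟨ ⟪ (λ A → solve 2 (λ z y → :- z := (y :- z) :- y) refl (z A) (y A)) ⟫ ⟩
    d ⊕ ⊖ y                        ≈⟨ ⊕-cong d≋ ≋.refl ⟩
    w · u ⊕ ⊖ y                    ≈⟨ ⊕-cong (w·σφ u) ≋.refl ⟨
    f (φ* u) ⊕ ⊖ y                 ∎) (I-⊖ D (proj₁ (proj₂ lift)))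
    where
    lift = φ*-I-surjective yI
    z = proj₁ lift
    d = y ⊕ ⊖ z
    u = proj₁ (mod-w d)
    φ*-d : φ* d ≋ 0E
    φ*-d = begin
      φ* (y ⊕ ⊖ z)       ≈⟨ ≋.trans (push-⊕ (φ m n) y (⊖ z)) (⊕-cong ≋.refl (push-⊖ (φ m n) z)) ⟩
      φ* y ⊕ ⊖ φ* z      ≈⟨ ⊕-cong ≋.refl (⊖-cong (proj₂ (proj₂ lift))) ⟩
      φ* y ⊕ ⊖ φ* y      ≈⟨ ⊕-inverseʳ (φ* y) ⟩
      0E                 ∎
    d≋ : d ≋ w · u
    d≋ = begin
      d                    ≈⟨ proj₂ (mod-w d) ⟩
      σ (φ* d) ⊕ w · u     ≈⟨ ⊕-cong (≋.trans (push-cong section φ*-d) (push-0 section)) ≋.refl ⟩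
      0E ⊕ w · u           ≈⟨ ⊕-identityˡ _ ⟩
      w · u                ∎

  f-degree : ∀ p x → Homog p x → Homog (suc p) (f x)
  f-degree p x h = H-resp 0 (begin
    gen i · σ x ⊕ ⊖ (gen i′ · σ x)       ≈⟨ ⊕-cong ≋.refl (·-⊖ˡ (gen i′) (σ x)) ⟨
    gen i · σ x ⊕ (⊖ gen i′) · σ x       ≈⟨ ·-distribʳ (gen i) (⊖ gen i′) (σ x) ⟨
    w · σ x                              ∎)
    (H-⊕ 0 (H-gen· 0 i σx) (H-⊖ 0 (H-gen· 0 i′ σx)))
    where
    -- Degree p is written as (p + 1) - 1, the form from which `H-gen·` raises the degree.
    σx : Homog[ 1 ] (suc p) (σ x)
    σx = H-push 1 section (λ A ne → h A (ne ∘ ≡.cong suc))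

  shortExact : ShortExact D P (φ m n) f
  shortExact = record
    { f-wd = λ x y e → ≈A-linear D f-linear {x} {y} (f-I e)
    ; f-+ = λ x y → ≋⇒≈A D (additive f-linear x y)
    ; f-• = λ k x → ≋⇒≈A D (scalable f-linear k x)
    ; f-deg = λ p x h → f x , f-degree p x h , ≋⇒≈A D {x = f x} ≋.refl
    ; g-wd = λ x y e → via-φ* x y (≈A-linear P (push-linear (φ m n)) {x} {y} (φ*-I e))
    ; g-+ = λ x y → ≋⇒≈A P (≋.trans (Emap≋push (φ m n) (x ⊕ y))
        (≋.trans (push-⊕ (φ m n) x y) (≋.sym (⊕-cong (Emap≋push (φ m n) x) (Emap≋push (φ m n) y)))))
    ; g-• = λ k x → ≋⇒≈A P (≋.trans (Emap≋push (φ m n) (k • x))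
        (≋.trans (push-• (φ m n) k x) (≋.sym (•-cong refl (Emap≋push (φ m n) x)))))
    ; g-deg = λ p x h → φ* x , H-push 0 (φ m n) h , ≋⇒≈A P (Emap≋push (φ m n) x)
    ; f-injective = λ x e → I⇒≈A0 P (f-injective (≈A0⇒I D e))
    ; exact-middle = λ y → mk⇔
        (λ e → kernel-φ* y (I-resp P (Emap≋push (φ m n) y) (≈A0⇒I P e)))
        (λ { (x , e) → I⇒≈A0 P (≈∈-sym y x (φ*-I e)) })
    ; g-surjective = λ z → σ z , ≋⇒≈A P (≋.trans (Emap≋push (φ m n) (σ z)) (φ*-σ z))
    }
    where
    via-φ* : ∀ x y → φ* x ≈A[ P ] φ* y → Emap (φ m n) x ≈A[ P ] Emap (φ m n) y
    via-φ* x y = I-resp P (⊕-cong (≋.sym (Emap≋push (φ m n) x)) (⊖-cong (≋.sym (Emap≋push (φ m n) y))))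
    ≈∈-sym : ∀ y x → InI P (φ* (f x ⊕ ⊖ y)) → InI P (Emap (φ m n) y)
    ≈∈-sym y x e = I-resp P (begin
      ⊖ φ* (f x ⊕ ⊖ y)             ≈⟨ ⊖-cong (≋.trans (push-⊕ (φ m n) (f x) (⊖ y)) (⊕-cong (φ*-f x) (push-⊖ (φ m n) y))) ⟩
      ⊖ (0E ⊕ ⊖ φ* y)              ≈⟨ ≋.trans (⊖-cong (⊕-identityˡ _)) (⊖-involutive _) ⟩
      φ* y                         ≈⟨ Emap≋push (φ m n) y ⟨
      Emap (φ m n) y               ∎) (I-⊖ P e)

-- The subalgebra generated by differences of generators.

module ReducedAlgebra {c ℓ} (K : Field c ℓ) where
  open Field K hiding (zero) renaming (Carrier to 𝕜)
  open OS K using (E; 0E; 1E; gen; sumE; sumK; InI; 0∈; +∈; ≈∈; InĀ; one∈; v̄∈; •∈; *∈; _≈A[_]_)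
    renaming (_+E_ to infixl 6 _⊕_; -E_ to infix 8 ⊖_; _•_ to infixr 7 _•_)
  open IntegerCoefficientSolver commutativeRing using (solve; _:=_; _:+_; _:*_; :-_; _:-_)
  open Exterior K
  open Derivations K
  open Linking K
  open Ideals K
  open Ideal
  open ≋-Reasoning

  linearForm : ∀ {n} → (Fin n → 𝕜) → List (Fin n) → E n
  linearForm v ss = sumE (map (λ s → v s • gen s) ss)

  δ₁-linearForm : ∀ {n} (v : Fin n → 𝕜) ss → δ₁ (linearForm v ss) ≋ sumK (map v ss) • 1E
  δ₁-linearForm v []       = ≋.trans (δ-0 _) (≋.sym (0• 1E))
  δ₁-linearForm v (s ∷ ss) = begin
    δ₁ (v s • gen s ⊕ linearForm v ss)               ≈⟨ δ-⊕ _ (v s • gen s) (linearForm v ss) ⟩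
    δ₁ (v s • gen s) ⊕ δ₁ (linearForm v ss)          ≈⟨ ⊕-cong (≋.trans (δ-• _ (v s) (gen s)) (•-cong refl (≋.trans (δ-gen (λ _ → 1#) s) (1• 1E))))
                                                               (δ₁-linearForm v ss) ⟩
    v s • 1E ⊕ sumK (map v ss) • 1E                  ≈⟨ ⟪ (λ A → distribʳ (1E A) _ _) ⟫ ⟨
    sumK (map v (s ∷ ss)) • 1E                       ∎

  difference : ∀ {n} → Fin n → Fin n → E n
  difference s t = gen s ⊕ ⊖ gen t

  -- Each v_s e_s is split as v_s (e_s - e_t) + v_s e_t. When the coordinates sum to zero the e_t
  -- terms cancel, so the differences with a fixed `t` span.
  linearForm-differences : ∀ {n} (v : Fin n → 𝕜) t ss →
    linearForm v ss ≋ sumE (map (λ s → v s • difference s t) ss) ⊕ sumK (map v ss) • gen t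
  linearForm-differences v t []       = ≋.sym (≋.trans (⊕-identityˡ _) (0• (gen t)))
  linearForm-differences v t (s ∷ ss) = ≋.trans (⊕-cong ≋.refl (linearForm-differences v t ss))
    ⟪ (λ A → solve 5 (λ v g h d k → v :* g :+ (d :+ k :* h) := (v :* (g :- h) :+ d) :+ (v :+ k) :* h) refl
         (v s) (gen s A) (gen t A) (sumE (map (λ s → v s • difference s t) ss) A) (sumK (map v ss))) ⟫

  unitVector : ∀ {n} → Fin n → Fin n → 𝕜
  unitVector zero    zero    = 1#
  unitVector zero    (suc s) = 0#
  unitVector (suc t) zero    = 0#
  unitVector (suc t) (suc s) = unitVector t s

  sumE-allFin : ∀ {n k} (F : Fin (suc n) → E k) → sumE (map F (allFin (suc n))) ≡ F zero ⊕ sumE (map (F ∘ suc) (allFin n))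
  sumE-allFin F = ≡.cong (λ xs → F zero ⊕ sumE xs) (≡.trans (map-tabulate suc F) (≡.sym (map-tabulate id (F ∘ suc))))

  sumE-unitVector : ∀ {n k} (t : Fin n) (F : Fin n → E k) → sumE (map (λ s → unitVector t s • F s) (allFin n)) ≋ F t
  sumE-unitVector {suc n} zero F = begin
    sumE (map G (allFin (suc n)))                 ≈⟨ ≋.reflexive (sumE-allFin G) ⟩
    1# • F zero ⊕ sumE (map (G ∘ suc) (allFin n)) ≈⟨ ⊕-cong (1• _) (zeros (allFin n)) ⟩
    F zero ⊕ 0E                                   ≈⟨ ⊕-identityʳ _ ⟩
    F zero                                        ∎
    where
    G = λ s → unitVector zero s • F s
    zeros : ∀ ss → sumE (map (G ∘ suc) ss) ≋ 0E
    zeros []       = ≋.refl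
    zeros (s ∷ ss) = ≋.trans (⊕-cong (0• _) (zeros ss)) (⊕-identityˡ _)
  sumE-unitVector {suc n} (suc t) F = begin
    sumE (map G (allFin (suc n)))                 ≈⟨ ≋.reflexive (sumE-allFin G) ⟩
    0# • F zero ⊕ sumE (map (G ∘ suc) (allFin n)) ≈⟨ ⊕-cong (0• _) (sumE-unitVector t (F ∘ suc)) ⟩
    0E ⊕ F (suc t)                                ≈⟨ ⊕-identityˡ _ ⟩
    F (suc t)                                     ∎
    where G = λ s → unitVector (suc t) s • F s

  1E-⊥ : ∀ {n} → 1E {n} ⊥ ≈ 1#
  1E-⊥ {zero}  = refl
  1E-⊥ {suc n} = 1E-⊥ {n}

  push-of-difference : ∀ {n k} (g : Fin (suc n) → Fin k) s → push g (difference s zero) ≋ difference (g s) (g zero)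
  push-of-difference g s = ≋.trans (push-⊕ g (gen s) (⊖ gen zero))
    (⊕-cong (push-gen g s) (≋.trans (push-⊖ g (gen zero)) (⊖-cong (push-gen g zero))))

  module Reduced {n} (Circ : Subset n → Set) where

    Ā-resp : ∀ {x y} → x ≋ y → InĀ Circ x → InĀ Circ y
    Ā-resp p = ≈∈ (≋⇒≈A Circ p)

    Ā-· : ∀ {x y} → InĀ Circ x → InĀ Circ y → InĀ Circ (x · y)
    Ā-· p q = Ā-resp (*E≋· _ _) (*∈ p q)

    Ā-difference : ∀ s t → InĀ Circ (difference s t)
    Ā-difference s t = Ā-resp form (v̄∈ v sum-zero)
      where
      v : Fin n → 𝕜
      v r = unitVector s r - unitVector t r
      subtract : ∀ ss → linearForm v ss ≋ linearForm (unitVector s) ss ⊕ ⊖ linearForm (unitVector t) ss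
      subtract []       = ≋.sym (⊕-inverseʳ 0E)
      subtract (r ∷ ss) = ≋.trans (⊕-cong ≋.refl (subtract ss))
        ⟪ (λ A → solve 5 (λ a b g x y → (a :- b) :* g :+ (x :- y) := (a :* g :+ x) :- (b :* g :+ y)) refl
             (unitVector s r) (unitVector t r) (gen r A) (linearForm (unitVector s) ss A) (linearForm (unitVector t) ss A)) ⟫
      form : linearForm v (allFin n) ≋ difference s t
      form = ≋.trans (subtract (allFin n)) (⊕-cong (sumE-unitVector s gen) (⊖-cong (sumE-unitVector t gen)))
      -- The coordinate sum of v is the coefficient of 1 in ∂(e_s - e_t) = 0.
      sum-zero : sumK (map v (allFin n)) ≈ 0#
      sum-zero = trans (sym (trans (*-congˡ (1E-⊥ {n})) (*-identityʳ _))) (at (begin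
        sumK (map v (allFin n)) • 1E       ≈⟨ δ₁-linearForm v (allFin n) ⟨
        δ₁ (linearForm v (allFin n))       ≈⟨ δ-cong _ form ⟩
        δ₁ (gen s ⊕ ⊖ gen t)               ≈⟨ ≋.trans (δ-⊕ _ (gen s) (⊖ gen t)) (⊕-cong (δ-gen (λ _ → 1#) s) (≋.trans (δ-⊖ _ (gen t)) (⊖-cong (δ-gen (λ _ → 1#) t)))) ⟩
        1# • 1E ⊕ ⊖ (1# • 1E)              ≈⟨ ⊕-inverseʳ (1# • 1E) ⟩
        0E                                 ∎) ⊥)

    -- Fixing a base point `r` reduces the linear generators from all vectors of coordinate sum zero
    -- to the finitely many e_s - e_r.
    Ā-rec : ∀ {p} (Q : E n → Set p) (r : Fin n) →
            (∀ {x y} → x ≈A[ Circ ] y → Q x → Q y) →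
            Q 1E →
            (∀ s → Q (difference s r)) →
            (∀ {x y} → Q x → Q y → Q (x ⊕ y)) →
            (∀ {x} k → Q x → Q (k • x)) →
            (∀ {x y} → InĀ Circ x → Q x → Q y → Q (x · y)) →
            ∀ {x} → InĀ Circ x → Q x
    Ā-rec Q r resp one diff add scale mul = go
      where
      sums : ∀ (v : Fin n → 𝕜) ss → Q (sumE (map (λ s → v s • difference s r) ss))
      -- Zero is obtained as a scalar multiple of the unit, since `InĀ` has no constructor for it.
      sums v []       = resp (≋⇒≈A Circ (0• 1E)) (scale 0# one)
      sums v (s ∷ ss) = add (scale (v s) (diff s)) (sums v ss)
      go : ∀ {x} → InĀ Circ x → Q x
      go one∈       = one
      go (v̄∈ v e)   = resp (≋⇒≈A Circ (≋.sym (begin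
        linearForm v (allFin n)                                ≈⟨ linearForm-differences v r (allFin n) ⟩
        d ⊕ sumK (map v (allFin n)) • gen r                    ≈⟨ ⊕-cong ≋.refl (≋.trans (•-cong e ≋.refl) (0• (gen r))) ⟩
        d ⊕ 0E                                                 ≈⟨ ⊕-identityʳ d ⟩
        d                                                      ∎))) (sums v (allFin n))
        where d = sumE (map (λ s → v s • difference s r) (allFin n))
      go (+∈ p q)   = add (go p) (go q)
      go (•∈ k p)   = scale k (go p)
      go (*∈ p q)   = resp (≋⇒≈A Circ (≋.sym (*E≋· _ _))) (mul p (go p) (go q))
      go (≈∈ e p)   = resp e (go p)

  module _ {n} {Circ : Subset (suc n) → Set} where
    open Reduced

    -- ∂ kills the unit and every difference of generators, hence their products by the Leibniz
    -- rule. The conclusion is membership in the ideal because elements of Ā are only given modulo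
    -- relations.
    Ā-δ₁ : ∀ {x} → InĀ Circ x → InI Circ (δ₁ x)
    Ā-δ₁ = Ā-rec Circ (InI Circ ∘ δ₁) zero
      (λ {x} {y} e i → I-resp Circ
        ⟪ (λ A → solve 2 (λ x y → x :- (x :- y) := y) refl (δ₁ x A) (δ₁ y A)) ⟫
        (+∈ i (I-⊖ Circ (≈A-linear Circ (δ-linear _) {x} {y} (I-δ₁ Circ e)))))
      (I-resp Circ (≋.sym (δ-1 _)) 0∈)
      (λ s → I-resp Circ (≋.sym (begin
        δ₁ (gen s ⊕ ⊖ gen zero)          ≈⟨ ≋.trans (δ-⊕ _ (gen s) (⊖ gen zero)) (⊕-cong (δ-gen (λ _ → 1#) s) (≋.trans (δ-⊖ _ (gen zero)) (⊖-cong (δ-gen (λ _ → 1#) zero)))) ⟩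
        1# • 1E ⊕ ⊖ (1# • 1E)            ≈⟨ ⊕-inverseʳ _ ⟩
        0E                               ∎)) 0∈)
      (λ i j → I-resp Circ (≋.sym (δ-⊕ _ _ _)) (+∈ i j))
      (λ k i → I-resp Circ (≋.sym (δ-• _ k _)) (I-• Circ k i))
      (λ {x} {y} _ i j → I-resp Circ (≋.sym (δ-· _ x y)) (+∈ (I-·ʳ Circ y i) (I-·ˡ Circ (α x) j)))

    -- `α` negates each difference of generators. The stability is needed for the Koszul sign when a
    -- factor from M₁ moves past an element of Ā(M₂).
    Ā-α : ∀ {x} → InĀ Circ x → InĀ Circ (α x)
    Ā-α = Ā-rec Circ (InĀ Circ ∘ α) zero
      (λ {x} {y} e → ≈∈ (I-resp Circ (≋.trans (α-⊕ x (⊖ y)) (⊕-cong ≋.refl (α-⊖ y))) (I-α Circ e)))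
      (Ā-resp Circ (≋.sym α-1) one∈)
      (λ s → Ā-resp Circ (begin
        (- 1#) • (gen s ⊕ ⊖ gen zero)     ≈⟨ ⊖≋-1• _ ⟨
        ⊖ (gen s ⊕ ⊖ gen zero)            ≈⟨ ⊖-⊕ (gen s) (⊖ gen zero) ⟩
        ⊖ gen s ⊕ ⊖ ⊖ gen zero            ≈⟨ ≋.trans (α-⊕ (gen s) (⊖ gen zero)) (⊕-cong (α-gen s) (≋.trans (α-⊖ (gen zero)) (⊖-cong (α-gen zero)))) ⟨
        α (gen s ⊕ ⊖ gen zero)            ∎) (•∈ (- 1#) (Ā-difference Circ s zero)))
      (λ {x} {y} i j → Ā-resp Circ (≋.sym (α-⊕ x y)) (+∈ i j))
      (λ {x} k i → Ā-resp Circ (≋.sym (α-• k x)) (•∈ k i))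
      (λ {x} {y} _ i j → Ā-resp Circ (≋.sym (α-· x y)) (Ā-· Circ i j))

    Ā-push : ∀ {k} {Circ′ : Subset k → Set} (g : Fin (suc n) → Fin k) →
             (∀ {x} → InI Circ x → InI Circ′ (push g x)) → ∀ {x} → InĀ Circ x → InĀ Circ′ (push g x)
    Ā-push {Circ′ = Circ′} g gI = Ā-rec Circ (InĀ Circ′ ∘ push g) zero
      (λ {x} {y} e → ≈∈ (≈A-linear Circ′ (push-linear g) {x} {y} (gI e)))
      (Ā-resp Circ′ (≋.sym (push-1 g)) one∈)
      (λ s → Ā-resp Circ′ (≋.sym (push-of-difference g s)) (Ā-difference Circ′ (g s) (g zero)))
      (λ {x} {y} i j → Ā-resp Circ′ (≋.sym (push-⊕ g x y)) (+∈ i j))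
      (λ {x} k i → Ā-resp Circ′ (≋.sym (push-• g k x)) (•∈ k i))
      (λ {x} {y} _ i j → Ā-resp Circ′ (≋.sym (push-· g x y)) (Ā-· Circ′ i j))

-- The direct sum as a tensor product, and the algebra isomorphism.

module TensorProduct {c ℓ} (K : Field c ℓ) {m n : ℕ} (M₁ : Matroid (suc m)) (M₂ : Matroid (suc n)) where
  open Field K hiding (zero)
  open OS K using (E; T; 0E; 1E; 1T; basis; gen; Homog; HomogT; InI; 0∈; +∈; ≈∈; InĀ; one∈; •∈; _≈A[_]_; _⊗_; _•T_; _*T_; _≈T_; InJ; left; right; _≈⊗[_,_]_; InĀ⊗Ā; pure; GradedAlgIso)
    renaming (_+E_ to infixl 6 _⊕_; -E_ to infix 8 ⊖_; _•_ to infixr 7 _•_; _+T_ to infixl 6 _+T_; -T_ to infix 8 -T_)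
  open IntegerCoefficientSolver commutativeRing using (solve; _:=_; _:+_; :-_; _:-_)
  open Exterior K
  open Derivations K
  open Linking K
  open Ideals K
  open Coordinates K
  open Degrees K
  open GluedGroundSet K m n
  open Ideal
  open ExactSequence K M₁ M₂
  open ReducedAlgebra K
  open Reduced
  open ≋-Reasoning

  C₁ : Subset (suc m) → Set
  C₁ = IsCircuit M₁
  C₂ : Subset (suc n) → Set
  C₂ = IsCircuit M₂

  T₁₂ : Set c
  T₁₂ = T (suc m) (suc n)

  J : T₁₂ → Set (c ⊔ ℓ)
  J = InJ C₁ C₂

  Ā⊗Ā : T₁₂ → Set (c ⊔ ℓ)
  Ā⊗Ā = InĀ⊗Ā C₁ C₂

  Θ : T₁₂ → ED
  Θ = θ (suc m)

  Θ-⊗ : ∀ x y → Θ (x ⊗ y) ≋ j₁ x · j₂ y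
  Θ-⊗ = θ-⊗ (suc m)

  θ-split : ∀ a {b} (z : E (a +ℕ b)) → θ a (split a z) ≋ z
  θ-split zero    z = ≋.refl
  θ-split (suc a) z = ≋-split (θ-split a (lo z)) (θ-split a (hi z))

  J-Θ : ∀ {t} → J t → InI D (Θ t)
  J-Θ (left {x} xI y)  = I-resp D (≋.sym (Θ-⊗ x y)) (I-·ʳ D (j₂ y) (j₁-I xI))
  J-Θ (right {y} x yI) = I-resp D (≋.sym (Θ-⊗ x y)) (I-·ˡ D (j₁ x) (j₂-I yI))
  J-Θ 0∈               = I-resp D (≋.sym (θ-0 (suc m))) 0∈
  J-Θ (+∈ {t} {u} p q) = I-resp D (≋.sym (θ-+ (suc m) t u)) (+∈ (J-Θ p) (J-Θ q))
  J-Θ (≈∈ e p)         = I-resp D (θ-cong (suc m) e) (J-Θ p)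

  -- The tensor ideal transported to the exterior algebra of the direct sum, where it can be
  -- compared with `InI D` by showing that it absorbs products.
  JΘ : ED → Set (c ⊔ ℓ)
  JΘ z = J (split (suc m) z)

  JΘ-resp : ∀ {z z′} → z ≋ z′ → JΘ z → JΘ z′
  JΘ-resp e = ≈∈ (λ A B → at e (A Vec.++ B))

  JΘ-Θ : ∀ {t} → J t → JΘ (Θ t)
  JΘ-Θ {t} = ≈∈ (λ A B → sym (split-θ (suc m) t A B))

  JΘ-left : ∀ {x} y → InI C₁ x → JΘ (j₁ x · j₂ y)
  JΘ-left {x} y xI = JΘ-resp (Θ-⊗ x y) (JΘ-Θ (left xI y))

  JΘ-right : ∀ x {y} → InI C₂ y → JΘ (j₁ x · j₂ y)
  JΘ-right x {y} yI = JΘ-resp (Θ-⊗ x y) (JΘ-Θ (right x yI))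

  gen-j₁ : ∀ s x → j₁ (gen s · x) ≋ gen (s ↑ˡ suc n) · j₁ x
  gen-j₁ s x = ≋.trans (push-· (_↑ˡ suc n) (gen s) x) (·-congʳ (push-gen (_↑ˡ suc n) s))

  j₁-gen : ∀ s x → j₁ (x · gen s) ≋ j₁ x · gen (s ↑ˡ suc n)
  j₁-gen s x = ≋.trans (push-· (_↑ˡ suc n) x (gen s)) (·-congˡ (push-gen (_↑ˡ suc n) s))

  gen-j₂ : ∀ s y → j₂ (gen s · y) ≋ gen (suc m ↑ʳ s) · j₂ y
  gen-j₂ s y = ≋.trans (push-· (suc m ↑ʳ_) (gen s) y) (·-congʳ (push-gen (suc m ↑ʳ_) s))

  j₂-gen : ∀ s y → j₂ (y · gen s) ≋ j₂ y · gen (suc m ↑ʳ s)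
  j₂-gen s y = ≋.trans (push-· (suc m ↑ʳ_) y (gen s)) (·-congˡ (push-gen (suc m ↑ʳ_) s))

  gen↑ˡ-j₁j₂ : ∀ s x y → j₁ (gen s · x) · j₂ y ≋ gen (s ↑ˡ suc n) · (j₁ x · j₂ y)
  gen↑ˡ-j₁j₂ s x y = ≋.trans (·-congʳ (gen-j₁ s x)) (·-assoc _ (j₁ x) (j₂ y))

  -- A generator of S₂′ has to pass `j₁ x` to reach the second factor. Recording the sign as `α x`
  -- keeps the result a pure tensor.
  gen↑ʳ-j₁j₂ : ∀ s x y → j₁ (α x) · j₂ (gen s · y) ≋ gen (suc m ↑ʳ s) · (j₁ x · j₂ y)
  gen↑ʳ-j₁j₂ s x y = begin
    j₁ (α x) · j₂ (gen s · y)        ≈⟨ ·-cong (≋.sym (α-push (_↑ˡ suc n) x)) (gen-j₂ s y) ⟩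
    α (j₁ x) · (g · j₂ y)            ≈⟨ ·-assoc (α (j₁ x)) g (j₂ y) ⟨
    α (j₁ x) · g · j₂ y              ≈⟨ ·-congʳ (gen-· (suc m ↑ʳ s) (j₁ x)) ⟨
    g · j₁ x · j₂ y                  ≈⟨ ·-assoc g (j₁ x) (j₂ y) ⟩
    g · (j₁ x · j₂ y)                ∎
    where
    g : ED
    g = gen (suc m ↑ʳ s)

  j₁j₂-gen↑ʳ : ∀ s x y → j₁ x · j₂ (y · gen s) ≋ j₁ x · j₂ y · gen (suc m ↑ʳ s)
  j₁j₂-gen↑ʳ s x y = ≋.trans (·-congˡ (j₂-gen s y)) (≋.sym (·-assoc (j₁ x) (j₂ y) _))

  j₁j₂-gen↑ˡ : ∀ s x y → j₁ (x · gen s) · j₂ (α y) ≋ j₁ x · j₂ y · gen (s ↑ˡ suc n)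
  j₁j₂-gen↑ˡ s x y = begin
    j₁ (x · gen s) · j₂ (α y)        ≈⟨ ·-cong (j₁-gen s x) (≋.sym (α-push (suc m ↑ʳ_) y)) ⟩
    j₁ x · g · α (j₂ y)              ≈⟨ ·-assoc (j₁ x) g (α (j₂ y)) ⟩
    j₁ x · (g · α (j₂ y))            ≈⟨ ·-congˡ (·-gen (j₂ y) (s ↑ˡ suc n)) ⟨
    j₁ x · (j₂ y · g)                ≈⟨ ·-assoc (j₁ x) (j₂ y) g ⟨
    j₁ x · j₂ y · g                  ∎
    where
    g : ED
    g = gen (s ↑ˡ suc n)

  JΘ-rec : ∀ {p} (Q : ED → Set p) → (∀ {z z′} → z ≋ z′ → Q z → Q z′) → Q 0E → (∀ {z z′} → Q z → Q z′ → Q (z ⊕ z′)) →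
           (∀ {x} y → InI C₁ x → Q (j₁ x · j₂ y)) → (∀ x {y} → InI C₂ y → Q (j₁ x · j₂ y)) →
           ∀ {z} → JΘ z → Q z
  JΘ-rec Q resp zr add l r {z} zJ = resp (θ-split (suc m) z) (go zJ)
    where
    go : ∀ {t} → J t → Q (Θ t)
    go (left {x} xI y)  = resp (≋.sym (Θ-⊗ x y)) (l y xI)
    go (right {y} x yI) = resp (≋.sym (Θ-⊗ x y)) (r x yI)
    go 0∈               = resp (≋.sym (θ-0 (suc m))) zr
    go (+∈ {t} {u} p q) = resp (≋.sym (θ-+ (suc m) t u)) (add (go p) (go q))
    go (≈∈ e p)         = resp (θ-cong (suc m) e) (go p)

  -- A generator of either summand takes a pure tensor to a pure tensor. If it passes a relation of
  -- M₁, that relation is only changed by `α`, under which the ideal is stable.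
  JΘ-gen· : ∀ s {z} → JΘ z → JΘ (gen s · z)
  JΘ-gen· s = JΘ-rec (λ z → JΘ (gen s · z))
    (λ e → JΘ-resp (·-congˡ e))
    (JΘ-resp (≋.sym (·-zeroʳ (gen s))) 0∈)
    (λ {z} {z′} p q → JΘ-resp (≋.sym (·-distribˡ (gen s) z z′)) (+∈ p q))
    (λ {x} y xI → onLeft (view s) x y xI)
    (λ x {y} yI → onRight (view s) x y yI)
    where
    onLeft : ∀ {s} → View s → ∀ x y → InI C₁ x → JΘ (gen s · (j₁ x · j₂ y))
    onLeft (left s)  x y xI = JΘ-resp (gen↑ˡ-j₁j₂ s x y) (JΘ-left y (I-·ˡ C₁ (gen s) xI))
    onLeft (right s) x y xI = JΘ-resp (gen↑ʳ-j₁j₂ s x y) (JΘ-left (gen s · y) (I-α C₁ xI))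
    onRight : ∀ {s} → View s → ∀ x y → InI C₂ y → JΘ (gen s · (j₁ x · j₂ y))
    onRight (left s)  x y yI = JΘ-resp (gen↑ˡ-j₁j₂ s x y) (JΘ-right (gen s · x) yI)
    onRight (right s) x y yI = JΘ-resp (gen↑ʳ-j₁j₂ s x y) (JΘ-right (α x) (I-·ˡ C₂ (gen s) yI))

  JΘ-·gen : ∀ s {z} → JΘ z → JΘ (z · gen s)
  JΘ-·gen s = JΘ-rec (λ z → JΘ (z · gen s))
    (λ e → JΘ-resp (·-congʳ e))
    (JΘ-resp (≋.sym (·-zeroˡ (gen s))) 0∈)
    (λ {z} {z′} p q → JΘ-resp (≋.sym (·-distribʳ z z′ (gen s))) (+∈ p q))
    (λ {x} y xI → onLeft (view s) x y xI)
    (λ x {y} yI → onRight (view s) x y yI)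
    where
    onLeft : ∀ {s} → View s → ∀ x y → InI C₁ x → JΘ (j₁ x · j₂ y · gen s)
    onLeft (left s)  x y xI = JΘ-resp (j₁j₂-gen↑ˡ s x y) (JΘ-left (α y) (I-·ʳ C₁ (gen s) xI))
    onLeft (right s) x y xI = JΘ-resp (j₁j₂-gen↑ʳ s x y) (JΘ-left (y · gen s) xI)
    onRight : ∀ {s} → View s → ∀ x y → InI C₂ y → JΘ (j₁ x · j₂ y · gen s)
    onRight (left s)  x y yI = JΘ-resp (j₁j₂-gen↑ˡ s x y) (JΘ-right (x · gen s) (I-α C₂ yI))
    onRight (right s) x y yI = JΘ-resp (j₁j₂-gen↑ʳ s x y) (JΘ-right x (I-·ʳ C₂ (gen s) yI))

  JΘ-• : ∀ k {z} → JΘ z → JΘ (k • z)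
  JΘ-• k {z₀} = JΘ-rec (λ z → JΘ (k • z))
    (λ e → JΘ-resp (•-cong refl e))
    (JΘ-resp (≋.sym (•0 k)) 0∈)
    (λ {z} {z′} p q → JΘ-resp (≋.sym (•-⊕ k z z′)) (+∈ p q))
    (λ {x} y xI → JΘ-resp (≋.trans (·-congʳ (push-• (_↑ˡ suc n) k x)) (·-•ˡ k (j₁ x) (j₂ y))) (JΘ-left y (I-• C₁ k xI)))
    (λ x {y} yI → JΘ-resp (≋.trans (·-congʳ (push-• (_↑ˡ suc n) k x)) (·-•ˡ k (j₁ x) (j₂ y))) (JΘ-right (k • x) yI)) {z₀}

  -- `push` along the identity presents `x` as nested sums of generators times smaller terms. The
  -- induction runs over arbitrary `g`, because peeling off a generator replaces the identity by
  -- `suc`.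
  generated : ∀ {p k} (Q : E k → Set p) → (∀ {x y} → x ≋ y → Q x → Q y) → Q 1E →
              (∀ {x y} → Q x → Q y → Q (x ⊕ y)) → (∀ a {x} → Q x → Q (a • x)) →
              (∀ s {x} → Q x → Q (gen s · x)) → ∀ x → Q x
  generated {k = k} Q resp one add scale mul x = resp (push-id x) (go (λ s → s) x)
    where
    go : ∀ {l} (g : Fin l → Fin k) x → Q (push g x)
    go {zero}  g x = scale (x []) one
    go {suc l} g x = add (go (g ∘ suc) (lo x)) (mul (g zero) (go (g ∘ suc) (hi x)))

  JΘ-·ˡ : ∀ a {z} → JΘ z → JΘ (a · z)
  JΘ-·ˡ = generated (λ a → ∀ {z} → JΘ z → JΘ (a · z))
    (λ e p {z} zJ → JΘ-resp (·-congʳ e) (p {z} zJ))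
    (λ {z} zJ → JΘ-resp (≋.sym (·-identityˡ z)) zJ)
    (λ {x} {y} p q {z} zJ → JΘ-resp (≋.sym (·-distribʳ x y z)) (+∈ (p {z} zJ) (q {z} zJ)))
    (λ k {x} p {z} zJ → JΘ-resp (≋.sym (·-•ˡ k x z)) (JΘ-• k {x · z} (p {z} zJ)))
    (λ s {x} p {z} zJ → JΘ-resp (≋.sym (·-assoc (gen s) x z)) (JΘ-gen· s {x · z} (p {z} zJ)))

  JΘ-·ʳ : ∀ a {z} → JΘ z → JΘ (z · a)
  JΘ-·ʳ = generated (λ a → ∀ {z} → JΘ z → JΘ (z · a))
    (λ e p {z} zJ → JΘ-resp (·-congˡ e) (p {z} zJ))
    (λ {z} zJ → JΘ-resp (≋.sym (·-identityʳ z)) zJ)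
    (λ {x} {y} p q {z} zJ → JΘ-resp (≋.sym (·-distribˡ z x y)) (+∈ (p {z} zJ) (q {z} zJ)))
    (λ k {x} p {z} zJ → JΘ-resp (≋.sym (·-•ʳ k z x)) (JΘ-• k {z · x} (p {z} zJ)))
    (λ s {x} p {z} zJ → JΘ-resp (·-assoc z (gen s) x) (p {z · gen s} (JΘ-·gen s {z} zJ)))

  -- The transported tensor ideal is two-sided, and each circuit relation of `D` has the form r ⊗ 1
  -- or 1 ⊗ r. Together with `J-Θ` this identifies A(M₁ ⊕ M₂) with A(M₁) ⊗ A(M₂).
  I-JΘ : ∀ {z} → InI D z → JΘ z
  I-JΘ = I-rec D JΘ JΘ-resp 0∈ +∈ (λ a _ → JΘ-·ˡ a) (λ a _ → JΘ-·ʳ a) gens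
    where
    gens : ∀ {C} → D C → JΘ (δ₁ (basis C))
    gens (inj₁ (A , cir , im)) = JΘ-resp
      (≋.trans (·-congˡ (push-1 {suc n} (suc m ↑ʳ_))) (≋.trans (·-identityʳ (j₁ (δ₁ (basis A)))) (j₁-circuit im)))
      (JΘ-left 1E (I-gen C₁ cir))
    gens (inj₂ (A , cir , im)) = JΘ-resp
      (≋.trans (·-congʳ (push-1 {suc m} (_↑ˡ suc n))) (≋.trans (·-identityˡ (j₂ (δ₁ (basis A)))) (j₂-circuit im)))
      (JΘ-right 1E (I-gen C₂ cir))

  Θ-I-J : ∀ {t} → InI D (Θ t) → J t
  Θ-I-J {t} i = ≈∈ (split-θ (suc m) t) (I-JΘ i)

  Θ-- : ∀ t u → Θ (t +T -T u) ≋ Θ t ⊕ ⊖ Θ u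
  Θ-- t u = ≋.trans (θ-+ (suc m) t (-T u)) (⊕-cong ≋.refl (θ-- (suc m) u))

  ≈⊗⇒Θ : ∀ {t u} → t ≈⊗[ C₁ , C₂ ] u → Θ t ≈A[ D ] Θ u
  ≈⊗⇒Θ {t} {u} e = I-resp D (Θ-- t u) (J-Θ e)

  Θ⇒≈⊗ : ∀ {t u} → Θ t ≈A[ D ] Θ u → t ≈⊗[ C₁ , C₂ ] u
  Θ⇒≈⊗ {t} {u} e = Θ-I-J (I-resp D (≋.sym (Θ-- t u)) e)

  ψ : T₁₂ → EP
  ψ t = φ* (Θ t)

  ψ-+ : ∀ t u → ψ (t +T u) ≋ ψ t ⊕ ψ u
  ψ-+ t u = ≋.trans (push-cong (φ m n) (θ-+ (suc m) t u)) (push-⊕ (φ m n) (Θ t) (Θ u))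

  ψ-• : ∀ k t → ψ (k •T t) ≋ k • ψ t
  ψ-• k t = ≋.trans (push-cong (φ m n) (θ-• (suc m) k t)) (push-• (φ m n) k (Θ t))

  ψ-* : ∀ t u → ψ (t *T u) ≋ ψ t · ψ u
  ψ-* t u = ≋.trans (push-cong (φ m n) (θ-*T t u)) (push-· (φ m n) (Θ t) (Θ u))

  ψ-⊗ : ∀ x y → ψ (x ⊗ y) ≋ i₁ x · i₂ y
  ψ-⊗ x y = ≋.trans (push-cong (φ m n) (Θ-⊗ x y))
    (≋.trans (push-· (φ m n) (j₁ x) (j₂ y)) (·-cong (φ*-j₁ x) (φ*-j₂ y)))

  ψ-1 : ψ 1T ≋ 1E
  ψ-1 = ≋.trans (ψ-⊗ 1E 1E) (≋.trans (·-cong (push-1 (ι₁ m n)) (push-1 (ι₂ m n))) (·-identityˡ 1E))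

  φ*-≈A : ∀ {x y} → x ≈A[ D ] y → φ* x ≈A[ P ] φ* y
  φ*-≈A {x} {y} e = ≈A-linear P (push-linear (φ m n)) {x} {y} (φ*-I e)

  ψ-cong : ∀ {t u} → t ≈⊗[ C₁ , C₂ ] u → ψ t ≈A[ P ] ψ u
  ψ-cong {t} {u} e = φ*-≈A {Θ t} {Θ u} (≈⊗⇒Θ e)

  i₁-I : ∀ {x} → InI C₁ x → InI P (i₁ x)
  i₁-I {x} xI = I-resp P (φ*-j₁ x) (φ*-I (j₁-I xI))

  i₂-I : ∀ {x} → InI C₂ x → InI P (i₂ x)
  i₂-I {x} xI = I-resp P (φ*-j₂ x) (φ*-I (j₂-I xI))

  ψ-into : ∀ {t} → Ā⊗Ā t → InĀ P (ψ t)
  ψ-into (pure {x} {y} p q) = Ā-resp P (≋.sym (ψ-⊗ x y))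
    (Ā-· P (Ā-push (ι₁ m n) i₁-I p) (Ā-push (ι₂ m n) i₂-I q))
  ψ-into 0∈ = Ā-resp P (≋.trans (0• 1E) (≋.sym (≋.trans (push-cong (φ m n) (θ-0 (suc m))) (push-0 (φ m n))))) (•∈ 0# one∈)
  ψ-into (+∈ {t} {u} p q) = Ā-resp P (≋.sym (ψ-+ t u)) (+∈ (ψ-into p) (ψ-into q))
  ψ-into (≈∈ {t} {u} e p) = ≈∈ (ψ-cong {t} {u} e) (ψ-into p)

  ≈T⇒≈⊗ : ∀ {t u : T₁₂} → t ≈T u → t ≈⊗[ C₁ , C₂ ] u
  ≈T⇒≈⊗ {t} {u} e = Θ⇒≈⊗ (≋⇒≈A D (θ-cong (suc m) e))

  -- On a pure tensor the scalar is absorbed by the first factor; `InĀ⊗Ā` has no constructor for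
  -- scalar multiples.
  Ā⊗Ā-• : ∀ k {t} → Ā⊗Ā t → Ā⊗Ā (k •T t)
  Ā⊗Ā-• k (pure {x} {y} p q) = ≈∈ (≈T⇒≈⊗ (λ A B → *-assoc k (x A) (y B))) (pure (•∈ k p) q)
  Ā⊗Ā-• k 0∈ = ≈∈ (≈T⇒≈⊗ (λ A B → sym (zeroʳ k))) 0∈
  Ā⊗Ā-• k (+∈ {t} {u} p q) = ≈∈ (≈T⇒≈⊗ (λ A B → sym (distribˡ k (t A B) (u A B)))) (+∈ (Ā⊗Ā-• k p) (Ā⊗Ā-• k q))
  Ā⊗Ā-• k (≈∈ {t} {u} e p) = ≈∈ (Θ⇒≈⊗ (I-resp D scaled (≈A-• D k {Θ t} {Θ u} (≈⊗⇒Θ e)))) (Ā⊗Ā-• k p)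
    where
    scaled : k • Θ t ⊕ ⊖ (k • Θ u) ≋ Θ (k •T t) ⊕ ⊖ Θ (k •T u)
    scaled = ⊕-cong (≋.sym (θ-• (suc m) k t)) (⊖-cong (≋.sym (θ-• (suc m) k u)))

  -- Under Θ the derivation is ∂ ⊗ 1, and ∂ vanishes on Ā(M₁).
  Ā⊗Ā-∂₁ : ∀ {t} → Ā⊗Ā t → InI D (∂₁ (Θ t))
  Ā⊗Ā-∂₁ (pure {x} {y} p q) = I-resp D (≋.sym (begin
    ∂₁ (Θ (x ⊗ y))                               ≈⟨ δ-cong indicator₁ (Θ-⊗ x y) ⟩
    ∂₁ (j₁ x · j₂ y)                             ≈⟨ δ-· indicator₁ (j₁ x) (j₂ y) ⟩
    ∂₁ (j₁ x) · j₂ y ⊕ α (j₁ x) · ∂₁ (j₂ y)      ≈⟨ ⊕-cong (·-congʳ (∂₁-j₁ x)) (≋.trans (·-congˡ (∂₁-j₂ y)) (·-zeroʳ (α (j₁ x)))) ⟩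
    j₁ (δ₁ x) · j₂ y ⊕ 0E                        ≈⟨ ⊕-identityʳ _ ⟩
    j₁ (δ₁ x) · j₂ y                             ∎)) (I-·ʳ D (j₂ y) (j₁-I (Ā-δ₁ p)))
  Ā⊗Ā-∂₁ 0∈ = I-resp D (≋.sym (≋.trans (δ-cong indicator₁ (θ-0 (suc m))) (δ-0 indicator₁))) 0∈
  Ā⊗Ā-∂₁ (+∈ {t} {u} p q) = I-resp D
    (≋.sym (≋.trans (δ-cong indicator₁ (θ-+ (suc m) t u)) (δ-⊕ indicator₁ (Θ t) (Θ u))))
    (+∈ (Ā⊗Ā-∂₁ p) (Ā⊗Ā-∂₁ q))
  Ā⊗Ā-∂₁ (≈∈ {t} {u} e p) = I-resp D
    ⟪ (λ A → solve 2 (λ x y → x :- (x :- y) := y) refl (∂₁ (Θ t) A) (∂₁ (Θ u) A)) ⟫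
    (+∈ (Ā⊗Ā-∂₁ p) (I-⊖ D (≈A-linear D (δ-linear indicator₁) {Θ t} {Θ u} (I-∂₁ (≈⊗⇒Θ e)))))

  ψ-kernel : ∀ {t} → Ā⊗Ā t → InI P (ψ t) → J t
  ψ-kernel {t} tĀ ψtI = Θ-I-J (I-resp D
    ⟪ (λ A → solve 2 (λ x y → y :- (y :- x) := x) refl (Θ t A) (f x A)) ⟫ (+∈ fxI (I-⊖ D e)))
    where
    x = proj₁ (kernel-φ* (Θ t) ψtI)
    e : f x ≈A[ D ] Θ t
    e = proj₂ (kernel-φ* (Θ t) ψtI)
    ∂₁fx : InI D (∂₁ (f x))
    ∂₁fx = I-resp D ⟪ (λ A → solve 2 (λ x y → (x :- y) :+ y := x) refl (∂₁ (f x) A) (∂₁ (Θ t) A)) ⟫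
      (+∈ (≈A-linear D (δ-linear indicator₁) {f x} {Θ t} (I-∂₁ e)) (Ā⊗Ā-∂₁ tĀ))
    -- ∂₁ f x = σ x - w ∂₁ σ x, and multiplying by w recovers f x because w² = 0.
    fxI : InI D (f x)
    fxI = I-resp D (begin
      w · ∂₁ (w · σ x)                         ≈⟨ ·-congˡ (∂₁-w· (σ x)) ⟩
      w · (σ x ⊕ ⊖ (w · ∂₁ (σ x)))             ≈⟨ ≋.trans (·-distribˡ w (σ x) (⊖ (w · ∂₁ (σ x)))) (⊕-cong ≋.refl (·-⊖ʳ w (w · ∂₁ (σ x)))) ⟩
      w · σ x ⊕ ⊖ (w · (w · ∂₁ (σ x)))         ≈⟨ ⊕-cong ≋.refl (≋.trans (⊖-cong (w·w· (∂₁ (σ x)))) ⊖0) ⟩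
      w · σ x ⊕ 0E                             ≈⟨ ⊕-identityʳ (w · σ x) ⟩
      w · σ x                                  ∎) (I-·ˡ D w ∂₁fx)

  ψ-injective : ∀ {t u} → Ā⊗Ā t → Ā⊗Ā u → ψ t ≈A[ P ] ψ u → t ≈⊗[ C₁ , C₂ ] u
  ψ-injective {t} {u} p q e = ψ-kernel
    -- The difference is formed as t + (-1) u, using closure under scalars.
    (+∈ p (≈∈ (≈T⇒≈⊗ (λ A B → at (≋.sym (⊖≋-1• (u A))) B)) (Ā⊗Ā-• (- 1#) q)))
    (I-resp P (begin
      ψ t ⊕ ⊖ ψ u                    ≈⟨ ⊕-cong ≋.refl (push-⊖ (φ m n) (Θ u)) ⟨
      φ* (Θ t) ⊕ φ* (⊖ Θ u)          ≈⟨ push-⊕ (φ m n) (Θ t) (⊖ Θ u) ⟨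
      φ* (Θ t ⊕ ⊖ Θ u)               ≈⟨ push-cong (φ m n) (Θ-- t u) ⟨
      ψ (t +T -T u)                  ∎) e)

  Image : EP → Set (c ⊔ ℓ)
  Image z = ∃[ t ] (Ā⊗Ā t × ψ t ≈A[ P ] z)

  Image-resp : ∀ {y z} → y ≈A[ P ] z → Image y → Image z
  Image-resp {y} {z} e (t , p , d) = t , p , ≈A-trans P {ψ t} {y} {z} d e

  Image-⊕ : ∀ {y z} → Image y → Image z → Image (y ⊕ z)
  Image-⊕ {y} {z} (t , p , d) (u , q , e) = t +T u , +∈ p q ,
    ≈A-trans P {ψ (t +T u)} {ψ t ⊕ ψ u} {y ⊕ z} (≋⇒≈A P (ψ-+ t u)) (≈A-⊕ P {ψ t} {y} {ψ u} {z} d e)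

  Image-• : ∀ k {z} → Image z → Image (k • z)
  Image-• k {z} (t , p , d) = k •T t , Ā⊗Ā-• k p ,
    ≈A-trans P {ψ (k •T t)} {k • ψ t} {k • z} (≋⇒≈A P (ψ-• k t)) (≈A-• P k {ψ t} {z} d)

  -- Right multiplication by one difference of generators at a time avoids showing that Ā ⊗ Ā is closed under the
  -- Koszul product.
  MulClosed : ED → Set (c ⊔ ℓ)
  MulClosed v = ∀ {t} → Ā⊗Ā t → ∃[ u ] (Ā⊗Ā u × Θ u ≈A[ D ] (Θ t · v))

  mul-closed : ∀ v → (∀ {x y} → InĀ C₁ x → InĀ C₂ y → ∃[ u ] (Ā⊗Ā u × Θ u ≋ j₁ x · j₂ y · v)) → MulClosed v
  mul-closed v onPure (pure {x} {y} p q) =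
    let (u , r , e) = onPure p q
    in u , r , ≋⇒≈A D (≋.trans e (·-congʳ (≋.sym (Θ-⊗ x y))))
  mul-closed v onPure 0∈ = (λ _ _ → 0#) , 0∈ ,
    ≋⇒≈A D (≋.trans (θ-0 (suc m)) (≋.sym (≋.trans (·-congʳ (θ-0 (suc m))) (·-zeroˡ v))))
  mul-closed v onPure (+∈ {t} {t′} p q) =
    let (u , r , e) = mul-closed v onPure p
        (u′ , r′ , e′) = mul-closed v onPure q
    in u +T u′ , +∈ r r′ , I-resp D
      (⊕-cong (≋.sym (θ-+ (suc m) u u′))
        (⊖-cong (≋.trans (≋.sym (·-distribʳ (Θ t) (Θ t′) v)) (·-congʳ (≋.sym (θ-+ (suc m) t t′))))))
      (≈A-⊕ D {Θ u} {Θ t · v} {Θ u′} {Θ t′ · v} e e′)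
  mul-closed v onPure (≈∈ {t} {t′} d p) =
    let (u , r , e) = mul-closed v onPure p
    in u , r , ≈A-trans D {Θ u} {Θ t · v} {Θ t′ · v} e (≈A-·ʳ D v {Θ t} {Θ t′} (≈⊗⇒Θ d))

  j₁-difference : ∀ s → MulClosed (difference (s ↑ˡ suc n) i)
  j₁-difference s = mul-closed _ (λ {x} {y} p q →
    -- `α y` compensates for moving the difference, of degree one, leftwards past `y` into the first
    -- factor.
    (x · d) ⊗ α y , pure (Ā-· C₁ p (Ā-difference C₁ s zero)) (Ā-α q) , (begin
      Θ ((x · d) ⊗ α y)                                        ≈⟨ Θ-⊗ (x · d) (α y) ⟩
      j₁ (x · d) · j₂ (α y)                                    ≈⟨ ·-congʳ (≋.trans (push-cong (_↑ˡ suc n) (subtract x (gen s) (gen zero))) (≋.trans (push-⊕ (_↑ˡ suc n) (x · gen s) (⊖ (x · gen zero))) (⊕-cong ≋.refl (push-⊖ (_↑ˡ suc n) (x · gen zero))))) ⟩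
      (j₁ (x · gen s) ⊕ ⊖ j₁ (x · gen zero)) · j₂ (α y)        ≈⟨ ≋.trans (·-distribʳ (j₁ (x · gen s)) _ (j₂ (α y))) (⊕-cong ≋.refl (·-⊖ˡ (j₁ (x · gen zero)) (j₂ (α y)))) ⟩
      j₁ (x · gen s) · j₂ (α y) ⊕ ⊖ (j₁ (x · gen zero) · j₂ (α y))   ≈⟨ ⊕-cong (j₁j₂-gen↑ˡ s x y) (⊖-cong (j₁j₂-gen↑ˡ zero x y)) ⟩
      j₁ x · j₂ y · gen (s ↑ˡ suc n) ⊕ ⊖ (j₁ x · j₂ y · gen i)       ≈⟨ subtract (j₁ x · j₂ y) (gen (s ↑ˡ suc n)) (gen i) ⟨
      j₁ x · j₂ y · difference (s ↑ˡ suc n) i                  ∎))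
    where
    d = difference s zero
    subtract : ∀ {k} (x y z : E k) → x · (y ⊕ ⊖ z) ≋ x · y ⊕ ⊖ (x · z)
    subtract x y z = ≋.trans (·-distribˡ x y (⊖ z)) (⊕-cong ≋.refl (·-⊖ʳ x z))

  j₂-difference : ∀ s → MulClosed (difference (suc m ↑ʳ s) i′)
  j₂-difference s = mul-closed _ (λ {x} {y} p q →
    x ⊗ (y · d) , pure p (Ā-· C₂ q (Ā-difference C₂ s zero)) , (begin
      Θ (x ⊗ (y · d))                                          ≈⟨ Θ-⊗ x (y · d) ⟩
      j₁ x · j₂ (y · d)                                        ≈⟨ ·-congˡ (push-· (suc m ↑ʳ_) y d) ⟩
      j₁ x · (j₂ y · j₂ d)                                     ≈⟨ ·-assoc (j₁ x) (j₂ y) (j₂ d) ⟨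
      j₁ x · j₂ y · j₂ d                                       ≈⟨ ·-congˡ (push-of-difference (suc m ↑ʳ_) s) ⟩
      j₁ x · j₂ y · difference (suc m ↑ʳ s) i′                 ∎))
    where
    d = difference s zero

  φ*-difference : ∀ s t {a b} → φ m n s ≡ a → φ m n t ≡ b → φ* (difference s t) ≋ difference a b
  φ*-difference s t ≡.refl ≡.refl = ≋.trans (push-⊕ (φ m n) (gen s) (⊖ gen t))
    (⊕-cong (push-gen (φ m n) s) (≋.trans (push-⊖ (φ m n) (gen t)) (⊖-cong (push-gen (φ m n) t))))

  Image-·φ* : ∀ {v} → MulClosed v → ∀ {d} → φ* v ≋ d → ∀ {y} → Image y → Image (y · d)
  Image-·φ* {v} closed {d} v≋d {y} (t , p , e) =
    let (u , q , e′) = closed p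
    in u , q , ≈A-trans P {ψ u} {ψ t · d} {y · d}
         (≈A-trans P {ψ u} {φ* (Θ t · v)} {ψ t · d} (φ*-≈A {Θ u} {Θ t · v} e′)
           (≋⇒≈A P (≋.trans (push-· (φ m n) (Θ t) v) (·-congˡ v≋d))))
         (≈A-·ʳ P d {ψ t} {y} e)

  -- Each e_s - e_i in P comes from a difference inside one summand: for s in S₁ it is based at `i`,
  -- otherwise at `i′`, and φ sends both base points to `zero`.
  Image-difference : ∀ s {y} → Image y → Image (y · difference s zero)
  Image-difference s = go (viewₚ s)
    where
    go : ∀ {s} → Viewₚ s → ∀ {y} → Image y → Image (y · difference s zero)
    go (left x)  = Image-·φ* (j₁-difference x) (φ*-difference (x ↑ˡ suc n) i (φ-↑ˡ x) ≡.refl)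
    go (right x) = Image-·φ* (j₂-difference (suc x)) (φ*-difference (suc m ↑ʳ suc x) i′ (φ-↑ʳ (suc x)) (φ-↑ʳ zero))

  -- Because the property of `z` quantifies over all `y`, its product case is two successive right
  -- multiplications, and no product of two tensors has to be formed.
  Image-·Ā : ∀ {z} → InĀ P z → ∀ {y} → Image y → Image (y · z)
  Image-·Ā = Ā-rec P (λ z → ∀ {y} → Image y → Image (y · z)) zero
    (λ {x} {z} e p {y} yIm → Image-resp (≈A-linear P (·ʳ-linear y) {x} {z} (I-·ˡ P y e)) (p yIm))
    (λ {y} yIm → Image-resp (≋⇒≈A P (≋.sym (·-identityʳ y))) yIm)
    Image-difference
    (λ {x} {z} p q {y} yIm → Image-resp (≋⇒≈A P (≋.sym (·-distribˡ y x z))) (Image-⊕ (p yIm) (q yIm)))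
    (λ {x} k p {y} yIm → Image-resp (≋⇒≈A P (≋.sym (·-•ʳ k y x))) (Image-• k (p yIm)))
    (λ {x} {z} _ p q {y} yIm → Image-resp (≋⇒≈A P (·-assoc y x z)) (q (p yIm)))

  ψ-surjective : ∀ {z} → InĀ P z → Image z
  ψ-surjective {z} p = Image-resp (≋⇒≈A P (·-identityˡ z))
    (Image-·Ā p (1T , pure one∈ one∈ , ≋⇒≈A P ψ-1))

  ψ-degree : ∀ p t → HomogT p t → Homog p (ψ t)
  ψ-degree p t h = H-push 0 (φ m n) (H-θ (suc m) 0 t h)

  gradedAlgIso : GradedAlgIso C₁ C₂ P ψ
  gradedAlgIso = record
    { into = λ t → ψ-into
    ; wd = λ t u _ _ e → ψ-cong {t} {u} e
    ; ψ-+ = λ t u _ _ → ≋⇒≈A P (ψ-+ t u)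
    ; ψ-• = λ k t _ → ≋⇒≈A P (ψ-• k t)
    ; ψ-* = λ t u _ _ → ≋⇒≈A P (≋.trans (ψ-* t u) (≋.sym (*E≋· (ψ t) (ψ u))))
    ; ψ-1 = ≋⇒≈A P ψ-1
    ; ψ-deg = λ p t _ h → ψ t , ψ-degree p t h , ≋⇒≈A P {x = ψ t} ≋.refl
    ; injective = λ t u p q e → ψ-injective p q e
    ; surjective = λ z p → ψ-surjective p
    }

theorem4p14 : ∀ {c ℓ} (K : Field c ℓ) (m n : ℕ)
    (M₁ : Matroid (suc m)) (M₂ : Matroid (suc n)) →
    Flat M₁ ⁅ zero ⁆ → ¬ Loop M₂ zero →
    (∃[ f ] OS.ShortExact K (DirectSumCircuit M₁ M₂) (ParallelCircuit M₁ M₂) (φ m n) f)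
    × (∃[ ψ ] OS.GradedAlgIso K (IsCircuit M₁) (IsCircuit M₂) (ParallelCircuit M₁ M₂) ψ)
theorem4p14 K m n M₁ M₂ _ _ =
  (ExactSequence.f K M₁ M₂ , ExactSequence.shortExact K M₁ M₂) ,
  (TensorProduct.ψ K M₁ M₂ , TensorProduct.gradedAlgIso K M₁ M₂)
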